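{- Let $\ell$ be a prime with $\ell\nmid p-1$, $\mathcal{O}$ the valuation ring of $\mathbb{Q}_\ell(\mu_{p-1})$, and $Y$ as in the context. For every character $\psi:\Delta\to\mathcal{O}^\times$, $$e_\psi\,\mathrm{BF}_{\mathcal{O}}(Y)\cong\mathcal{O}/\psi(p\theta)\mathcal{O}.$$ In particular, if $\psi$ is even and nontrivial, then $e_\psi\mathrm{BF}_{\mathcal{O}}(Y)\cong\mathcal{O}$.
   Context: Let $p$ be an odd prime, $\Delta=\mathrm{Gal}(\mathbb{Q}(\zeta_p)/\mathbb{Q})$, $\sigma_i:\zeta_p\mapsto\zeta_p^i$, $j=\sigma_{ -1}$; $\psi$ is even if $\psi(j)=1$. $p\theta=-\sum_{i=1}^{p-1}i\sigma_i^{ -1}\in\mathbb{Z}[\Delta]$, and $\psi$ is extended linearly to the group ring. Digraphs have incidence $e\mapsto(o(e),t(e))$; derived digraph $X(G,\alpha)$: vertices $V_X\times G$, edges $E_X\times G$, $o(e,\sigma)=(o(e),\sigma)$, $t(e,\sigma)=(t(e),\sigma\alpha(e))$, $G$ acting by left multiplication on the second coordinate. $X$ is the bouquet with $\frac{p-1}{2}p+1$ loops $e_0$, $e_{i,k}$ ($1\le k\le i\le p-1$), $\alpha(e_0)=\sigma_1$, $\alpha(e_{i,k})=\sigma_i^{ -1}$, $Y=X(\Delta,\alpha)$. $\mathcal{A}_Y(w)=\sum_{o(\varepsilon)=w}t(\varepsilon)$, $\mathrm{BF}(Y)=\mathrm{coker}(\mathcal{I}-\mathcal{A}_Y)$ (a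 $\mathbb{Z}[\Delta]$-module), $\mathrm{BF}_{\mathcal{O}}(Y)=\mathcal{O}\otimes_{\mathbb{Z}_\ell}(\mathbb{Z}_\ell\otimes_{\mathbb{Z}}\mathrm{BF}(Y))$, and $e_\psi=\frac{1}{p-1}\sum_{\sigma\in\Delta}\psi(\sigma)\sigma^{ -1}\in\mathcal{O}[\Delta]$. -}

module Defs where

open import Level using (Level; _⊔_; 0ℓ) renaming (suc to lsuc)
open import Algebra.Bundles using (AbelianGroup; CommutativeRing; Group)
open import Algebra.Apartness.Bundles using (HeytingField)
open import Algebra.Morphism.Bundles using (RingHomomorphism; GroupHomomorphism)
open import Algebra.Morphism.Structures using (IsRingIsomorphism)
open import Algebra.Module.Bundles using (LeftModule)
open import Algebra.Module.Morphism.Structures using (module LeftModuleMorphisms)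
import Algebra.Apartness.Properties.HeytingCommutativeRing as HCR
import Algebra.Properties.Semiring.Exp as SemiringExp
import Algebra.Module.Construct.TensorUnit as TensorUnit
import Algebra.Morphism.Construct.Composition as Composition
import Algebra.Morphism.Construct.Identity as Identity
import Algebra.Properties.AbelianGroup as AbelianGroupProperties
import Algebra.Properties.CommutativeMonoid.Sum as SumProperties
import Algebra.Properties.Group as GroupProperties
import Algebra.Properties.Ring as RingProperties
import Algebra.Properties.CommutativeSemigroup as CommutativeSemigroupProperties
open import Data.Empty using (⊥-elim)
open import Data.Fin.Base using (Fin; zero; suc; toℕ; _↑ˡ_; _↑ʳ_; splitAt; join)
import Data.Fin.Properties as Fin
open import Data.Fin.Permutation using (Permutation; permutation)
open import Data.Integer.Base as ℤ using (ℤ; +_)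
open import Data.Integer.Divisibility.Signed using (_∣_; divides; ∣m∣n⇒∣m+n; ∣m⇒∣-m; ∣m⇒∣m*n; ∣n⇒∣m*n; _∣?_)
import Data.Integer.Properties as ℤ
open import Data.Integer.Tactic.RingSolver using (solve-∀)
open import Data.Nat.Base as ℕ using (ℕ; zero; suc; z≤n; s≤s)
import Data.Nat.Coprimality as ℕ
import Data.Nat.Divisibility as ℕ
open import Data.Nat.GCD using (module Bézout)
open import Data.Nat.Primality using (Prime)
import Data.Nat.Primality as ℕ
import Data.Nat.Properties as ℕ
open import Data.Product.Base using (Σ; ∃; _×_; _,_; proj₁; proj₂; uncurry)
open import Data.Product.Relation.Binary.Pointwise.NonDependent using (×-setoid)
import Data.Rational.Base as ℚ
open import Data.Rational.Base using (ℚ; 0ℚ)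
import Data.Rational.Properties as ℚ
open import Data.Sum.Base using (_⊎_; inj₁; inj₂)
open import Data.Unit.Base using (⊤; tt)
open import Data.Vec.Functional using (Vector)
open import Function.Base using (_∘_; id)
open import Function.Bundles using (Func)
open import Relation.Binary.Bundles using (Setoid)
open import Relation.Binary.PropositionalEquality as ≡ using (_≡_; refl)
open import Relation.Nullary using (¬_; yes; no; contradiction)
import Relation.Binary.Reasoning.Setoid as ≈-Reasoning

private
  variable
    a b c d ℓa ℓb ℓc ℓd ℓ₁ ℓ₂ : Level

record _≡_[mod_] (i j : ℤ) (q : ℕ) : Set where
  constructor mod
  field
    difference : + q ∣ i ℤ.- j

mod-reflexive : ∀ {q i j} → i ≡ j → i ≡ j [mod q ]
mod-reflexive {q} {i} refl = mod (divides (+ 0) (ℤ.+-inverseʳ i))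

mod-sym : ∀ {q i j} → i ≡ j [mod q ] → j ≡ i [mod q ]
mod-sym {q} {i} {j} (mod h) = mod (≡.subst (+ q ∣_) (lem i j) (∣m⇒∣-m h))
  where
  lem : ∀ i j → ℤ.- (i ℤ.- j) ≡ j ℤ.- i
  lem = solve-∀

mod-trans : ∀ {q i j k} → i ≡ j [mod q ] → j ≡ k [mod q ] → i ≡ k [mod q ]
mod-trans {q} {i} {j} {k} (mod h) (mod h′) = mod (≡.subst (+ q ∣_) (lem i j k) (∣m∣n⇒∣m+n h h′))
  where
  lem : ∀ i j k → (i ℤ.- j) ℤ.+ (j ℤ.- k) ≡ i ℤ.- k
  lem = solve-∀

mod-+ : ∀ {q i j i′ j′} → i ≡ j [mod q ] → i′ ≡ j′ [mod q ] → (i ℤ.+ i′) ≡ (j ℤ.+ j′) [mod q ]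
mod-+ {q} {i} {j} {i′} {j′} (mod h) (mod h′) =
  mod (≡.subst (+ q ∣_) (lem i j i′ j′) (∣m∣n⇒∣m+n h h′))
  where
  lem : ∀ i j i′ j′ → (i ℤ.- j) ℤ.+ (i′ ℤ.- j′) ≡ (i ℤ.+ i′) ℤ.- (j ℤ.+ j′)
  lem = solve-∀

mod-* : ∀ {q i j i′ j′} → i ≡ j [mod q ] → i′ ≡ j′ [mod q ] → (i ℤ.* i′) ≡ (j ℤ.* j′) [mod q ]
mod-* {q} {i} {j} {i′} {j′} (mod h) (mod h′) =
  mod (≡.subst (+ q ∣_) (lem i j i′ j′) (∣m∣n⇒∣m+n (∣m⇒∣m*n i′ h) (∣n⇒∣m*n j h′)))
  where
  lem : ∀ i j i′ j′ → (i ℤ.- j) ℤ.* i′ ℤ.+ j ℤ.* (i′ ℤ.- j′) ≡ (i ℤ.* i′) ℤ.- (j ℤ.* j′)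
  lem = solve-∀

mod-neg : ∀ {q i j} → i ≡ j [mod q ] → (ℤ.- i) ≡ (ℤ.- j) [mod q ]
mod-neg {q} {i} {j} (mod h) = mod (≡.subst (+ q ∣_) (lem i j) (∣m⇒∣-m h))
  where
  lem : ∀ i j → ℤ.- (i ℤ.- j) ≡ (ℤ.- i) ℤ.- (ℤ.- j)
  lem = solve-∀

module _ (ℓ : ℕ) where

  -- An element of lim ℤ/ℓⁿ: the class modulo ℓⁿ is represented by the
  -- integer approx n.
  record ℤ-adic : Set where
    constructor mk
    field
      approx   : ℕ → ℤ
      coherent : ∀ n → approx (suc n) ≡ approx n [mod ℓ ℕ.^ n ]

  open ℤ-adic

  infix 4 _≈ₐ_
  record _≈ₐ_ (x y : ℤ-adic) : Set where
    constructor digitwise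
    field
      at : ∀ n → approx x n ≡ approx y n [mod ℓ ℕ.^ n ]

  open _≈ₐ_

  fromℤ : ℤ → ℤ-adic
  fromℤ i = mk (λ _ → i) (λ _ → mod-reflexive refl)

  ℤ-adicRing : CommutativeRing 0ℓ 0ℓ
  ℤ-adicRing = record
    { Carrier = ℤ-adic
    ; _≈_ = _≈ₐ_
    ; _+_ = λ x y → mk (λ n → approx x n ℤ.+ approx y n) (λ n → mod-+ (coherent x n) (coherent y n))
    ; _*_ = λ x y → mk (λ n → approx x n ℤ.* approx y n) (λ n → mod-* (coherent x n) (coherent y n))
    ; -_ = λ x → mk (λ n → ℤ.- approx x n) (λ n → mod-neg (coherent x n))
    ; 0# = fromℤ (+ 0)
    ; 1# = fromℤ (+ 1)
    ; isCommutativeRing = record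
      { isRing = record
        { +-isAbelianGroup = record
          { isGroup = record
            { isMonoid = record
              { isSemigroup = record
                { isMagma = record
                  { isEquivalence = record
                    { refl = digitwise λ _ → mod-reflexive refl
                    ; sym = λ h → digitwise λ n → mod-sym (at h n)
                    ; trans = λ h h′ → digitwise λ n → mod-trans (at h n) (at h′ n)
                    }
                  ; ∙-cong = λ h h′ → digitwise λ n → mod-+ (at h n) (at h′ n)
                  }
                ; assoc = λ x y z → digitwise λ n → mod-reflexive (ℤ.+-assoc (approx x n) (approx y n) (approx z n))
                }
              ; identity = (λ x → digitwise λ n → mod-reflexive (ℤ.+-identityˡ (approx x n)))
                         , (λ x → digitwise λ n → mod-reflexive (ℤ.+-identityʳ (approx x n)))
              }
            ; inverse = (λ x → digitwise λ n → mod-reflexive (ℤ.+-inverseˡ (approx x n)))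
                      , (λ x → digitwise λ n → mod-reflexive (ℤ.+-inverseʳ (approx x n)))
            ; ⁻¹-cong = λ h → digitwise λ n → mod-neg (at h n)
            }
          ; comm = λ x y → digitwise λ n → mod-reflexive (ℤ.+-comm (approx x n) (approx y n))
          }
        ; *-cong = λ h h′ → digitwise λ n → mod-* (at h n) (at h′ n)
        ; *-assoc = λ x y z → digitwise λ n → mod-reflexive (ℤ.*-assoc (approx x n) (approx y n) (approx z n))
        ; *-identity = (λ x → digitwise λ n → mod-reflexive (ℤ.*-identityˡ (approx x n)))
                     , (λ x → digitwise λ n → mod-reflexive (ℤ.*-identityʳ (approx x n)))
        ; distrib = (λ x y z → digitwise λ n → mod-reflexive (ℤ.*-distribˡ-+ (approx x n) (approx y n) (approx z n)))
                  , (λ x y z → digitwise λ n → mod-reflexive (ℤ.*-distribʳ-+ (approx x n) (approx y n) (approx z n)))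
        }
      ; *-comm = λ x y → digitwise λ n → mod-reflexive (ℤ.*-comm (approx x n) (approx y n))
      }
    }

  ℤ→ℤ-adic : RingHomomorphism (CommutativeRing.rawRing ℤ.+-*-commutativeRing)
                               (CommutativeRing.rawRing ℤ-adicRing)
  ℤ→ℤ-adic = record
    { ⟦_⟧ = fromℤ
    ; isRingHomomorphism = record
      { isSemiringHomomorphism = record
        { isNearSemiringHomomorphism = record
          { +-isMonoidHomomorphism = record
            { isMagmaHomomorphism = record
              { isRelHomomorphism = record { cong = λ h → digitwise λ _ → mod-reflexive h }
              ; homo = λ _ _ → digitwise λ _ → mod-reflexive refl
              }
            ; ε-homo = digitwise λ _ → mod-reflexive refl
            }
          ; *-homo = λ _ _ → digitwise λ _ → mod-reflexive refl
          }
        ; 1#-homo = digitwise λ _ → mod-reflexive refl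
        }
      ; -‿homo = λ _ → digitwise λ _ → mod-reflexive refl
      }
    }

  -- The ℓ-adic valuation of x is n.
  _HasOrder_ : ℤ-adic → ℕ → Set
  x HasOrder n = approx x n ≡ + 0 [mod ℓ ℕ.^ n ] × ¬ (approx x (suc n) ≡ + 0 [mod ℓ ℕ.^ suc n ])

  private
    coprimeTo : ∀ {k} → Prime ℓ → ¬ (ℓ ℕ.∣ k) → ℕ.Coprime k ℓ
    coprimeTo ℓ-prime ℓ∤k {i} (i∣k , i∣ℓ) with ℕ.prime⇒irreducible ℓ-prime i∣ℓ
    ... | inj₁ i≡1 = i≡1
    ... | inj₂ refl = contradiction i∣k ℓ∤k

    bézout : ∀ {k} → ℕ.Coprime k ℓ → ∃ λ u → ∃ λ w → u ℤ.* (+ k) ℤ.+ w ℤ.* (+ ℓ) ≡ + 1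
    bézout {k} k⊥ℓ with ℕ.coprime-Bézout k⊥ℓ
    ... | Bézout.+- u w eq = + u , ℤ.- + w , (begin
            + u ℤ.* + k ℤ.+ (ℤ.- + w) ℤ.* + ℓ        ≡⟨ ≡.cong₂ ℤ._+_ (ℤ.pos-* u k) (≡.trans (≡.cong ℤ.-_ (ℤ.pos-* w ℓ)) (ℤ.neg-distribˡ-* (+ w) (+ ℓ))) ⟨
            + (u ℕ.* k) ℤ.+ ℤ.- + (w ℕ.* ℓ)          ≡⟨ ≡.cong (λ t → + t ℤ.+ ℤ.- + (w ℕ.* ℓ)) eq ⟨
            + (1 ℕ.+ w ℕ.* ℓ) ℤ.+ ℤ.- + (w ℕ.* ℓ)    ≡⟨ ℤ.+-assoc (+ 1) (+ (w ℕ.* ℓ)) (ℤ.- + (w ℕ.* ℓ)) ⟩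
            + 1 ℤ.+ (+ (w ℕ.* ℓ) ℤ.+ ℤ.- + (w ℕ.* ℓ)) ≡⟨ ≡.cong (λ t → + 1 ℤ.+ t) (ℤ.+-inverseʳ (+ (w ℕ.* ℓ))) ⟩
            + 1 ∎)
            where open ≡.≡-Reasoning
    ... | Bézout.-+ u w eq = ℤ.- + u , + w , (begin
            (ℤ.- + u) ℤ.* + k ℤ.+ + w ℤ.* + ℓ        ≡⟨ ≡.cong₂ ℤ._+_ (≡.trans (≡.cong ℤ.-_ (ℤ.pos-* u k)) (ℤ.neg-distribˡ-* (+ u) (+ k))) (ℤ.pos-* w ℓ) ⟨
            (ℤ.- + (u ℕ.* k)) ℤ.+ + (w ℕ.* ℓ)        ≡⟨ ≡.cong (λ t → (ℤ.- + (u ℕ.* k)) ℤ.+ + t) eq ⟨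
            (ℤ.- + (u ℕ.* k)) ℤ.+ (+ 1 ℤ.+ + (u ℕ.* k)) ≡⟨ lem (+ (u ℕ.* k)) ⟩
            + 1 ∎)
            where
            open ≡.≡-Reasoning
            lem : ∀ i → (ℤ.- i) ℤ.+ (+ 1 ℤ.+ i) ≡ + 1
            lem = solve-∀

  -- With u k + w ℓ = 1, the inverse of k modulo ℓⁿ is u Σ_{i<n} (w ℓ)ⁱ.
  inverse : ∀ {k} → Prime ℓ → ¬ (ℓ ℕ.∣ k) → ∃ λ x → CommutativeRing._*_ ℤ-adicRing (fromℤ (+ k)) x ≈ₐ fromℤ (+ 1)
  inverse {k} ℓ-prime ℓ∤k with bézout (coprimeTo ℓ-prime ℓ∤k)
  ... | u , w , uk+wℓ≡1 = mk (λ n → u ℤ.* geo n) coh , digitwise inv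
    where
    geo : ℕ → ℤ
    geo zero    = + 0
    geo (suc n) = geo n ℤ.+ (w ℤ.* + ℓ) ℤ.^ n

    pow : ∀ n → + (ℓ ℕ.^ n) ∣ (w ℤ.* + ℓ) ℤ.^ n
    pow zero    = divides (+ 1) refl
    pow (suc n) with pow n
    ... | divides t eq = divides (w ℤ.* t) (≡.trans (≡.cong ((w ℤ.* + ℓ) ℤ.*_) eq)
                           (≡.trans (lem w (+ ℓ) t (+ (ℓ ℕ.^ n))) (≡.cong ((w ℤ.* t) ℤ.*_) (≡.sym (ℤ.pos-* ℓ (ℓ ℕ.^ n))))))
      where
      lem : ∀ w l t q → (w ℤ.* l) ℤ.* (t ℤ.* q) ≡ (w ℤ.* t) ℤ.* (l ℤ.* q)
      lem = solve-∀

    coh : ∀ n → (u ℤ.* geo (suc n)) ≡ (u ℤ.* geo n) [mod ℓ ℕ.^ n ]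
    coh n = mod (≡.subst (+ (ℓ ℕ.^ n) ∣_) (lem u (geo n) ((w ℤ.* + ℓ) ℤ.^ n)) (∣n⇒∣m*n u (pow n)))
      where
      lem : ∀ u g t → u ℤ.* t ≡ u ℤ.* (g ℤ.+ t) ℤ.- u ℤ.* g
      lem = solve-∀

    telescope : ∀ n → + k ℤ.* (u ℤ.* geo n) ≡ + 1 ℤ.- (w ℤ.* + ℓ) ℤ.^ n
    telescope zero    = ≡.trans (≡.cong (+ k ℤ.*_) (ℤ.*-zeroʳ u)) (ℤ.*-zeroʳ (+ k))
    telescope (suc n) = begin
      + k ℤ.* (u ℤ.* (geo n ℤ.+ t))                      ≡⟨ lem₁ (+ k) u (geo n) t ⟩
      + k ℤ.* (u ℤ.* geo n) ℤ.+ (u ℤ.* + k) ℤ.* t        ≡⟨ ≡.cong (ℤ._+ (u ℤ.* + k) ℤ.* t) (telescope n) ⟩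
      + 1 ℤ.- t ℤ.+ (u ℤ.* + k) ℤ.* t                    ≡⟨ lem₂ (u ℤ.* + k) (w ℤ.* + ℓ) t ⟩
      + 1 ℤ.- (w ℤ.* + ℓ) ℤ.* t ℤ.+ ((u ℤ.* + k ℤ.+ w ℤ.* + ℓ) ℤ.- + 1) ℤ.* t
        ≡⟨ ≡.cong (λ z → + 1 ℤ.- (w ℤ.* + ℓ) ℤ.* t ℤ.+ (z ℤ.- + 1) ℤ.* t) uk+wℓ≡1 ⟩
      + 1 ℤ.- (w ℤ.* + ℓ) ℤ.* t ℤ.+ (+ 1 ℤ.- + 1) ℤ.* t  ≡⟨ ℤ.+-identityʳ _ ⟩
      + 1 ℤ.- (w ℤ.* + ℓ) ℤ.* t                          ∎
      where
      open ≡.≡-Reasoning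
      t = (w ℤ.* + ℓ) ℤ.^ n
      lem₁ : ∀ k u g t → k ℤ.* (u ℤ.* (g ℤ.+ t)) ≡ k ℤ.* (u ℤ.* g) ℤ.+ (u ℤ.* k) ℤ.* t
      lem₁ = solve-∀
      lem₂ : ∀ a b t → + 1 ℤ.- t ℤ.+ a ℤ.* t ≡ + 1 ℤ.- b ℤ.* t ℤ.+ ((a ℤ.+ b) ℤ.- + 1) ℤ.* t
      lem₂ = solve-∀

    inv : ∀ n → (+ k ℤ.* (u ℤ.* geo n)) ≡ + 1 [mod ℓ ℕ.^ n ]
    inv n = mod (≡.subst (+ (ℓ ℕ.^ n) ∣_) (≡.trans (lem ((w ℤ.* + ℓ) ℤ.^ n)) (≡.cong (ℤ._- + 1) (≡.sym (telescope n)))) (∣m⇒∣-m (pow n)))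
      where
      lem : ∀ t → ℤ.- t ≡ (+ 1 ℤ.- t) ℤ.- + 1
      lem = solve-∀

fieldRing : HeytingField c ℓ₁ ℓ₂ → CommutativeRing c ℓ₁
fieldRing F = record { isCommutativeRing = HeytingField.isCommutativeRing F }

_⟶ʳ_ : CommutativeRing a ℓa → CommutativeRing b ℓb → Set (a ⊔ ℓa ⊔ b ⊔ ℓb)
R ⟶ʳ S = RingHomomorphism (CommutativeRing.rawRing R) (CommutativeRing.rawRing S)

_∘ʳ_ : {R : CommutativeRing a ℓa} {S : CommutativeRing b ℓb} {T : CommutativeRing c ℓ₁} →
       S ⟶ʳ T → R ⟶ʳ S → R ⟶ʳ T
_∘ʳ_ {T = T} g f = record
  { isRingHomomorphism = Composition.isRingHomomorphism (CommutativeRing.trans T)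
      (RingHomomorphism.isRingHomomorphism f) (RingHomomorphism.isRingHomomorphism g)
  }

-- Fields are Heyting fields throughout, since equality in ℚℓ is undecidable.
record FractionField (R : CommutativeRing a ℓa) c ℓ₁ ℓ₂ : Set (a ⊔ ℓa ⊔ lsuc (c ⊔ ℓ₁ ⊔ ℓ₂)) where
  field
    Frac : HeytingField c ℓ₁ ℓ₂
    ι    : R ⟶ʳ fieldRing Frac

  private module R = CommutativeRing R
  open HeytingField Frac
  open RingHomomorphism ι using (⟦_⟧)

  field
    injective : ∀ {a b} → ⟦ a ⟧ ≈ ⟦ b ⟧ → a R.≈ b
    fraction  : ∀ x → ∃ λ a → ∃ λ b → ⟦ b ⟧ # 0# × x * ⟦ b ⟧ ≈ ⟦ a ⟧

record Extension (F : HeytingField a b d) c ℓ₁ ℓ₂ : Set (a ⊔ b ⊔ lsuc (c ⊔ ℓ₁ ⊔ ℓ₂)) where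
  field
    K : HeytingField c ℓ₁ ℓ₂
    ι : fieldRing F ⟶ʳ fieldRing K

  open HeytingField K public
  open RingHomomorphism ι public using () renaming (⟦_⟧ to embed)
  open SemiringExp (CommutativeRing.semiring (fieldRing K)) public using (_^_)

module _ {F : HeytingField a b d} (E : Extension F c ℓ₁ ℓ₂) (ζ : Extension.Carrier E) where
  open Extension E

  data Adjoin : Carrier → Set (a ⊔ c ⊔ ℓ₁) where
    base      : ∀ q → Adjoin (embed q)
    generator : Adjoin ζ
    add       : ∀ {x y} → Adjoin x → Adjoin y → Adjoin (x + y)
    multiply  : ∀ {x y} → Adjoin x → Adjoin y → Adjoin (x * y)
    negate    : ∀ {x} → Adjoin x → Adjoin (- x)
    invert    : ∀ {x y} → x * y ≈ 1# → Adjoin x → Adjoin y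
    resp      : ∀ {x y} → x ≈ y → Adjoin x → Adjoin y

-- The field F(μₙ), with a chosen primitive n-th root of unity ζ.
record Cyclotomic (F : HeytingField a b d) (n : ℕ) c ℓ₁ ℓ₂ : Set (a ⊔ b ⊔ lsuc (c ⊔ ℓ₁ ⊔ ℓ₂)) where
  field
    extension : Extension F c ℓ₁ ℓ₂

  open Extension extension public

  field
    ζ         : Carrier
    ζⁿ≈1      : ζ ^ n ≈ 1#
    ζ-primitive : ∀ {i} → 0 ℕ.< i → i ℕ.< n → ζ ^ i # 1#
    generated : ∀ x → Adjoin extension ζ x

module Galois {F : HeytingField a b d} (E : Extension F c ℓ₁ ℓ₂) where
  open Extension E

  private
    module L = CommutativeRing (fieldRing K)

  record Auto : Set (a ⊔ c ⊔ ℓ₁) where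
    field
      apply : Carrier → Carrier
      isIso : IsRingIsomorphism L.rawRing L.rawRing apply
      fixes : ∀ q → apply (embed q) ≈ embed q

    open IsRingIsomorphism isIso public

  open Auto

  private
    ι-cong = RingHomomorphism.⟦⟧-cong ι

    inv : Auto → Carrier → Carrier
    inv σ x = proj₁ (surjective σ x)

    apply-inv : ∀ σ x → apply σ (inv σ x) ≈ x
    apply-inv σ x = proj₂ (surjective σ x) L.refl

    inv-unique : ∀ σ {x y} → apply σ y ≈ x → inv σ x ≈ y
    inv-unique σ h = injective σ (L.trans (apply-inv σ _) (L.sym h))

    inverse-auto : Auto → Auto
    inverse-auto σ = record
      { apply = inv σ
      ; isIso = record
        { isRingMonomorphism = record
          { isRingHomomorphism = record
            { isSemiringHomomorphism = record
              { isNearSemiringHomomorphism = record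
                { +-isMonoidHomomorphism = record
                  { isMagmaHomomorphism = record
                    { isRelHomomorphism = record
                      { cong = λ {x} {y} x≈y → inv-unique σ (L.trans (apply-inv σ y) (L.sym x≈y)) }
                    ; homo = λ x y → inv-unique σ (L.trans (+-homo σ _ _)
                               (L.+-cong (apply-inv σ x) (apply-inv σ y)))
                    }
                  ; ε-homo = inv-unique σ (0#-homo σ)
                  }
                ; *-homo = λ x y → inv-unique σ (L.trans (*-homo σ _ _)
                             (L.*-cong (apply-inv σ x) (apply-inv σ y)))
                }
              ; 1#-homo = inv-unique σ (1#-homo σ)
              }
            ; -‿homo = λ x → inv-unique σ (L.trans (-‿homo σ _) (L.-‿cong (apply-inv σ x)))
            }
          ; injective = λ {x} {y} h → L.trans (L.sym (apply-inv σ x))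
                          (L.trans (⟦⟧-cong σ h) (apply-inv σ y))
          }
        ; surjective = λ y → apply σ y , λ z≈σy → inv-unique σ (L.sym z≈σy)
        }
      ; fixes = λ q → inv-unique σ (fixes σ q)
      }

  Gal : Group (a ⊔ c ⊔ ℓ₁) (c ⊔ ℓ₁)
  Gal = record
    { Carrier = Auto
    ; _≈_ = λ σ τ → ∀ x → apply σ x ≈ apply τ x
    ; _∙_ = λ σ τ → record
      { apply = apply σ ∘ apply τ
      ; isIso = Composition.isRingIsomorphism L.trans (isIso τ) (isIso σ)
      ; fixes = λ q → L.trans (⟦⟧-cong σ (fixes τ q)) (fixes σ q)
      }
    ; ε = record
      { apply = id
      ; isIso = Identity.isRingIsomorphism L.rawRing L.refl
      ; fixes = λ _ → L.refl
      }
    ; _⁻¹ = inverse-auto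
    ; isGroup = record
      { isMonoid = record
        { isSemigroup = record
          { isMagma = record
            { isEquivalence = record
              { refl = λ _ → L.refl
              ; sym = λ h x → L.sym (h x)
              ; trans = λ h h′ x → L.trans (h x) (h′ x)
              }
            ; ∙-cong = λ {σ} {τ} {σ′} {τ′} h h′ x → L.trans (⟦⟧-cong σ (h′ x)) (h (apply τ′ x))
            }
          ; assoc = λ _ _ _ _ → L.refl
          }
        ; identity = (λ _ _ → L.refl) , (λ _ _ → L.refl)
        }
      ; inverse = (λ σ x → inv-unique σ L.refl) , apply-inv
      ; ⁻¹-cong = λ {σ} {τ} h x → inv-unique σ (L.trans (h (inv τ x)) (apply-inv τ x))
      }
    }

-- A valuation written additively; v(0) = ∞ is represented by v being defined only
-- away from 0.
record Valuation (K : HeytingField c ℓ₁ ℓ₂) : Set (c ⊔ ℓ₁ ⊔ ℓ₂) where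
  open HeytingField K
  field
    v      : ∀ x → x # 0# → ℚ
    v-cong : ∀ {x y} → x ≈ y → (p : x # 0#) (q : y # 0#) → v x p ≡ v y q
    v-*    : ∀ {x y} (p : x # 0#) (q : y # 0#) (r : x * y # 0#) → v (x * y) r ≡ v x p ℚ.+ v y q
    v-+    : ∀ {x y} (p : x # 0#) (q : y # 0#) (r : x + y # 0#) → v x p ℚ.⊓ v y q ℚ.≤ v (x + y) r

module ValuationRing {K : HeytingField c ℓ₁ ℓ₂} (V : Valuation K) where
  open HeytingField K
  open Valuation V

  private
    module K = CommutativeRing (fieldRing K)
    open HCR (HeytingField.heytingCommutativeRing K) using (x-0≈x; invertibleʳ⇒#; #-congʳ; 1#0)
    open RingProperties K.ring using (-‿distribˡ-*; -‿distribʳ-*; -‿involutive)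

  -- v(x) ≥ 0, with 0 included.
  Integral : Carrier → Set ℓ₂
  Integral x = (p : x # 0#) → 0ℚ ℚ.≤ v x p

  private
    factor#0 : ∀ {x y} → x * y # 0# → x # 0#
    factor#0 {x} {y} h with #⇒invertible h
    ... | z , _ , xyz≈1 = invertibleʳ⇒# (y * z , K.trans (K.*-congʳ (x-0≈x x))
            (K.trans (K.sym (K.*-assoc x y z)) (K.trans (K.*-congʳ (K.sym (x-0≈x (x * y)))) xyz≈1)))

    integral-resp : ∀ {x y} → x ≈ y → Integral x → Integral y
    integral-resp x≈y h q = ≡.subst (0ℚ ℚ.≤_) (v-cong x≈y p q) (h p)
      where p = #-congʳ (K.sym x≈y) q

    integral-0 : Integral 0#
    integral-0 p = ⊥-elim (#-irrefl K.refl p)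

    integral-* : ∀ {x y} → Integral x → Integral y → Integral (x * y)
    integral-* {x} {y} h h′ r = ≡.subst (0ℚ ℚ.≤_) (≡.sym (v-* p q r)) (ℚ.+-mono-≤ (h p) (h′ q))
      where
      p = factor#0 r
      q = factor#0 (#-congʳ (K.*-comm x y) r)

    integral-+ : ∀ {x y} → Integral x → Integral y → Integral (x + y)
    integral-+ {x} {y} h h′ r with 0ℚ ℚ.≤? v (x + y) r
    ... | yes 0≤v = 0≤v
    ... | no  0≰v = ⊥-elim (¬y#0 λ q → ¬x#0 λ p →
              0≰v (ℚ.≤-trans (ℚ.⊓-glb (h p) (h′ q)) (v-+ p q r)))
      where
      is-zero : ∀ {z} → ¬ (z # 0#) → z ≈ 0#
      is-zero = proj₁ (HeytingField.tight K _ _)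
      ¬x#0 : ¬ ¬ (x # 0#)
      ¬x#0 n = 0≰v (integral-resp (K.trans (K.sym (K.+-identityˡ y)) (K.+-congʳ (K.sym (is-zero n)))) h′ r)
      ¬y#0 : ¬ ¬ (y # 0#)
      ¬y#0 n = 0≰v (integral-resp (K.trans (K.sym (K.+-identityʳ x)) (K.+-congˡ (K.sym (is-zero n)))) h r)

    double-zero : ∀ {q} → q ≡ q ℚ.+ q → 0ℚ ≡ q
    double-zero {q} h = ≡.sym (GroupProperties.identityʳ-unique ℚ.+-0-group q q (≡.sym h))

    v-1 : ∀ p → 0ℚ ≡ v 1# p
    v-1 p = double-zero (≡.trans (v-cong (K.sym (K.*-identityˡ 1#)) p r) (v-* p p r))
      where r = #-congʳ (K.sym (K.*-identityˡ 1#)) p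

    integral-1 : Integral 1#
    integral-1 p = ℚ.≤-reflexive (v-1 p)

    integral-‿1 : Integral (- 1#)
    integral-‿1 p with 0ℚ ℚ.≤? v (- 1#) p
    ... | yes 0≤v = 0≤v
    ... | no  0≰v = ⊥-elim (ℚ.<-irrefl (≡.sym sum≡0) (ℚ.+-mono-< (ℚ.≰⇒> 0≰v) (ℚ.≰⇒> 0≰v)))
      where
      square : - 1# * - 1# ≈ 1#
      square = K.trans (K.sym (-‿distribˡ-* 1# (- 1#)))
                 (K.trans (K.-‿cong (K.*-identityˡ (- 1#))) (-‿involutive 1#))
      r : - 1# * - 1# # 0#
      r = #-congʳ (K.sym square) 1#0
      sum≡0 : 0ℚ ≡ v (- 1#) p ℚ.+ v (- 1#) p
      sum≡0 = ≡.trans (v-1 1#0) (≡.trans (v-cong (K.sym square) 1#0 r) (v-* p p r))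

    integral-neg : ∀ {x} → Integral x → Integral (- x)
    integral-neg {x} h = integral-resp
      (K.trans (K.sym (-‿distribˡ-* 1# x)) (K.-‿cong (K.*-identityˡ x))) (integral-* integral-‿1 h)

  𝒪 : CommutativeRing (c ⊔ ℓ₂) ℓ₁
  𝒪 = record
    { Carrier = Σ Carrier Integral
    ; _≈_ = λ (x , _) (y , _) → x ≈ y
    ; _+_ = λ (x , h) (y , h′) → x + y , integral-+ h h′
    ; _*_ = λ (x , h) (y , h′) → x * y , integral-* h h′
    ; -_ = λ (x , h) → - x , integral-neg h
    ; 0# = 0# , integral-0
    ; 1# = 1# , integral-1
    ; isCommutativeRing = record
      { isRing = record
        { +-isAbelianGroup = record
          { isGroup = record
            { isMonoid = record
              { isSemigroup = record
                { isMagma = record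
                  { isEquivalence = record { refl = K.refl ; sym = K.sym ; trans = K.trans }
                  ; ∙-cong = K.+-cong
                  }
                ; assoc = λ _ _ _ → K.+-assoc _ _ _
                }
              ; identity = (λ _ → K.+-identityˡ _) , (λ _ → K.+-identityʳ _)
              }
            ; inverse = (λ _ → K.-‿inverseˡ _) , (λ _ → K.-‿inverseʳ _)
            ; ⁻¹-cong = K.-‿cong
            }
          ; comm = λ _ _ → K.+-comm _ _
          }
        ; *-cong = K.*-cong
        ; *-assoc = λ _ _ _ → K.*-assoc _ _ _
        ; *-identity = (λ _ → K.*-identityˡ _) , (λ _ → K.*-identityʳ _)
        ; distrib = (λ _ _ _ → K.distribˡ _ _ _) , (λ _ _ _ → K.distribʳ _ _ _)
        }
      ; *-comm = λ _ _ → K.*-comm _ _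
      }
    }

module _ {ℓ : ℕ} (Qℓ : FractionField (ℤ-adicRing ℓ) a b d) {n : ℕ}
         (L : Cyclotomic (FractionField.Frac Qℓ) n c ℓ₁ ℓ₂) where
  open Cyclotomic L

  ℤ-adic→K : ℤ-adicRing ℓ ⟶ʳ fieldRing K
  ℤ-adic→K = _∘ʳ_ {R = ℤ-adicRing ℓ} {S = fieldRing (FractionField.Frac Qℓ)} {T = fieldRing K} ι (FractionField.ι Qℓ)

  -- v extends the ℓ-adic valuation of ℚℓ normalised by v(ℓ) = 1; being
  -- multiplicative, it suffices to compare the two on ℤℓ.
  record ℓ-adicValuation : Set (c ⊔ ℓ₁ ⊔ ℓ₂) where
    field
      valuation : Valuation K
    open Valuation valuation public
    open RingHomomorphism ℤ-adic→K using (⟦_⟧)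
    field
      extends : ∀ {x k} → _HasOrder_ ℓ x k → (p : ⟦ x ⟧ # 0#) → v ⟦ x ⟧ p ≡ + k ℚ./ 1

  module _ (V : ℓ-adicValuation) where
    open ℓ-adicValuation V
    open ValuationRing valuation
    open RingHomomorphism ℤ-adic→K using (⟦_⟧; ⟦⟧-cong; 0#-homo; 1#-homo; +-homo; *-homo; -‿homo)
    open ℤ-adic

    private
      module K = CommutativeRing (fieldRing K)

      integral : ∀ x → Integral ⟦ x ⟧
      integral x p with 0ℚ ℚ.≤? v ⟦ x ⟧ p
      ... | yes 0≤v = 0≤v
      ... | no  0≰v = ⊥-elim (#-irrefl (K.trans (⟦⟧-cong (digitwise vanishes)) 0#-homo) p)
        where
        ¬order : ∀ k → ¬ (_HasOrder_ ℓ x k)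
        ¬order k o = 0≰v (≡.subst (0ℚ ℚ.≤_) (≡.sym (extends o p))
                       (ℚ.nonNegative⁻¹ (+ k ℚ./ 1) {{ℚ.normalize-nonNeg k 1}}))
        vanishes : ∀ k → approx x k ≡ + 0 [mod ℓ ℕ.^ k ]
        vanishes zero    = mod (divides (approx x 0 ℤ.- + 0) (≡.sym (ℤ.*-identityʳ _)))
        vanishes (suc k) with + (ℓ ℕ.^ suc k) ∣? (approx x (suc k) ℤ.- + 0)
        ... | yes ∣x = mod ∣x
        ... | no  ∤x = ⊥-elim (¬order k (vanishes k , λ h → ∤x (_≡_[mod_].difference h)))

    ℤ-adic→𝒪 : ℤ-adicRing ℓ ⟶ʳ 𝒪
    ℤ-adic→𝒪 = record
      { ⟦_⟧ = λ x → ⟦ x ⟧ , integral x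
      ; isRingHomomorphism = record
        { isSemiringHomomorphism = record
          { isNearSemiringHomomorphism = record
            { +-isMonoidHomomorphism = record
              { isMagmaHomomorphism = record
                { isRelHomomorphism = record { cong = ⟦⟧-cong }
                ; homo = +-homo
                }
              ; ε-homo = 0#-homo
              }
            ; *-homo = *-homo
            }
          ; 1#-homo = 1#-homo
          }
        ; -‿homo = -‿homo
        }
      }

Mod : CommutativeRing a ℓa → ∀ b ℓb → Set (a ⊔ ℓa ⊔ lsuc (b ⊔ ℓb))
Mod R b ℓb = LeftModule (CommutativeRing.ring R) b ℓb

regular : (R : CommutativeRing a ℓa) → Mod R a ℓa
regular R = TensorUnit.leftModule

private
  module Lemmas (R : CommutativeRing a ℓa) (M : Mod R b ℓb) where
    open LeftModule M public
    open AbelianGroupProperties +ᴹ-abelianGroup public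
      using () renaming (⁻¹-∙-comm to -ᴹ-+ᴹ-comm; ⁻¹-anti-homo‿- to -ᴹ-anti; ⁻¹-involutive to -ᴹ-involutive)
    open GroupProperties +ᴹ-group public
      using () renaming (inverseʳ-unique to -ᴹ-unique; x≈y⇒x∙y⁻¹≈ε to x≈y⇒x-y≈0)
    open CommutativeSemigroupProperties
      (AbelianGroup.commutativeSemigroup +ᴹ-abelianGroup) public
      using (interchange)
    open ≈-Reasoning ≈ᴹ-setoid public

    sub-+ : ∀ x y x′ y′ → (x +ᴹ y) +ᴹ -ᴹ (x′ +ᴹ y′) ≈ᴹ (x +ᴹ -ᴹ x′) +ᴹ (y +ᴹ -ᴹ y′)
    sub-+ x y x′ y′ = begin
      (x +ᴹ y) +ᴹ -ᴹ (x′ +ᴹ y′)         ≈⟨ +ᴹ-congˡ (-ᴹ-+ᴹ-comm x′ y′) ⟨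
      (x +ᴹ y) +ᴹ (-ᴹ x′ +ᴹ -ᴹ y′)      ≈⟨ interchange x y (-ᴹ x′) (-ᴹ y′) ⟩
      (x +ᴹ -ᴹ x′) +ᴹ (y +ᴹ -ᴹ y′)      ∎

    sub-trans : ∀ x y z → (x +ᴹ -ᴹ y) +ᴹ (y +ᴹ -ᴹ z) ≈ᴹ x +ᴹ -ᴹ z
    sub-trans x y z = begin
      (x +ᴹ -ᴹ y) +ᴹ (y +ᴹ -ᴹ z)   ≈⟨ +ᴹ-assoc x (-ᴹ y) _ ⟩
      x +ᴹ (-ᴹ y +ᴹ (y +ᴹ -ᴹ z))   ≈⟨ +ᴹ-congˡ (+ᴹ-assoc (-ᴹ y) y _) ⟨
      x +ᴹ ((-ᴹ y +ᴹ y) +ᴹ -ᴹ z)   ≈⟨ +ᴹ-congˡ (+ᴹ-congʳ (-ᴹ‿inverseˡ y)) ⟩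
      x +ᴹ (0ᴹ +ᴹ -ᴹ z)            ≈⟨ +ᴹ-congˡ (+ᴹ-identityˡ _) ⟩
      x +ᴹ -ᴹ z                    ∎

    *ₗ-neg : ∀ r x → r *ₗ (-ᴹ x) ≈ᴹ -ᴹ (r *ₗ x)
    *ₗ-neg r x = -ᴹ-unique (r *ₗ x) (r *ₗ (-ᴹ x)) (begin
      r *ₗ x +ᴹ r *ₗ (-ᴹ x)  ≈⟨ *ₗ-distribˡ r x (-ᴹ x) ⟨
      r *ₗ (x +ᴹ -ᴹ x)       ≈⟨ *ₗ-congˡ (-ᴹ‿inverseʳ x) ⟩
      r *ₗ 0ᴹ                ≈⟨ *ₗ-zeroʳ r ⟩
      0ᴹ                     ∎)

module _ (R : CommutativeRing a ℓa) where
  open LeftModuleMorphisms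

  record LinearMap (M : Mod R b ℓb) (N : Mod R c ℓc) : Set (a ⊔ b ⊔ c ⊔ ℓb ⊔ ℓc) where
    field
      ⟦_⟧      : LeftModule.Carrierᴹ M → LeftModule.Carrierᴹ N
      isLinear : IsLeftModuleHomomorphism (LeftModule.rawLeftModule M) (LeftModule.rawLeftModule N) ⟦_⟧

    open IsLeftModuleHomomorphism isLinear public

  infix 4 _≅_
  _≅_ : Mod R b ℓb → Mod R c ℓc → Set (a ⊔ b ⊔ c ⊔ ℓb ⊔ ℓc)
  M ≅ N = ∃ (IsLeftModuleIsomorphism (LeftModule.rawLeftModule M) (LeftModule.rawLeftModule N))

  linear : (M : Mod R b ℓb) (N : Mod R c ℓc) → let open LeftModule in
    (f : Carrierᴹ M → Carrierᴹ N) →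
    (∀ {x y} → _≈ᴹ_ M x y → _≈ᴹ_ N (f x) (f y)) →
    (∀ x y → _≈ᴹ_ N (f (_+ᴹ_ M x y)) (_+ᴹ_ N (f x) (f y))) →
    (∀ r x → _≈ᴹ_ N (f (_*ₗ_ M r x)) (_*ₗ_ N r (f x))) →
    LinearMap M N
  linear M N f f-cong f-+ f-* = record
    { ⟦_⟧ = f
    ; isLinear = record
      { +ᴹ-isGroupHomomorphism = record
        { isMonoidHomomorphism = record
          { isMagmaHomomorphism = record
            { isRelHomomorphism = record { cong = f-cong }
            ; homo = f-+
            }
          ; ε-homo = f-0
          }
        ; ⁻¹-homo = λ x → N.-ᴹ-unique (f x) (f (M.-ᴹ x))
            (N.≈ᴹ-trans (N.≈ᴹ-sym (f-+ x (M.-ᴹ x))) (N.≈ᴹ-trans (f-cong (M.-ᴹ‿inverseʳ x)) f-0))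
        }
      ; *ₗ-homo = f-*
      }
    }
    where
    module M = LeftModule M
    module N = Lemmas R N
    open CommutativeRing R using (0#)
    f-0 : f M.0ᴹ N.≈ᴹ N.0ᴹ
    f-0 = N.≈ᴹ-trans (f-cong (M.≈ᴹ-sym (M.*ₗ-zeroˡ M.0ᴹ)))
            (N.≈ᴹ-trans (f-* 0# M.0ᴹ) (N.*ₗ-zeroˡ (f M.0ᴹ)))

module _ {R : CommutativeRing a ℓa} where
  open LinearMap using (⟦_⟧)

  identity-minus : {M : Mod R b ℓb} → LinearMap R M M → LinearMap R M M
  identity-minus {M = M} f = linear R M M (λ x → x +ᴹ -ᴹ ⟦ f ⟧ x)
    (λ h → +ᴹ-cong h (-ᴹ‿cong (f.⟦⟧-cong h)))
    (λ x y → ≈ᴹ-trans (+ᴹ-congˡ (-ᴹ‿cong (f.+ᴹ-homo x y))) (sub-+ x y (⟦ f ⟧ x) (⟦ f ⟧ y)))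
    (λ r x → ≈ᴹ-trans (+ᴹ-congˡ (-ᴹ‿cong (f.*ₗ-homo r x)))
       (≈ᴹ-trans (+ᴹ-congˡ (≈ᴹ-sym (*ₗ-neg r (⟦ f ⟧ x)))) (≈ᴹ-sym (*ₗ-distribˡ r x (-ᴹ ⟦ f ⟧ x)))))
    where
    open Lemmas R M
    module f = LinearMap f

  module _ {M : Mod R b ℓb} {N : Mod R c ℓc} (f : LinearMap R M N) where
    private
      module M = LeftModule M
      module N = Lemmas R N
      module f = LinearMap f
    open LeftModule N

    record CokerEq (x y : Carrierᴹ) : Set (b ⊔ ℓc) where
      constructor by
      field
        {preimage} : LeftModule.Carrierᴹ M
        difference : x +ᴹ -ᴹ y ≈ᴹ ⟦ f ⟧ preimage

    private
      from≈ : ∀ {x y} → x ≈ᴹ y → CokerEq x y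
      from≈ x≈y = by (≈ᴹ-trans (N.x≈y⇒x-y≈0 x≈y) (≈ᴹ-sym f.0ᴹ-homo))

      coker-neg : ∀ {x y} → CokerEq x y → CokerEq (-ᴹ x) (-ᴹ y)
      coker-neg {x} {y} (by h) =
        by (≈ᴹ-trans (N.-ᴹ-+ᴹ-comm x (-ᴹ y)) (≈ᴹ-trans (-ᴹ‿cong h) (≈ᴹ-sym (f.-ᴹ-homo _))))

      coker-sym : ∀ {x y} → CokerEq x y → CokerEq y x
      coker-sym {x} {y} (by h) = by (≈ᴹ-trans (≈ᴹ-sym (N.-ᴹ-anti x y)) (≈ᴹ-trans (-ᴹ‿cong h) (≈ᴹ-sym (f.-ᴹ-homo _))))

      coker-trans : ∀ {x y z} → CokerEq x y → CokerEq y z → CokerEq x z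
      coker-trans {x} {y} {z} (by h) (by h′) =
        by (≈ᴹ-trans (≈ᴹ-sym (N.sub-trans x y z)) (≈ᴹ-trans (+ᴹ-cong h h′) (≈ᴹ-sym (f.+ᴹ-homo _ _))))

      coker-+ : ∀ {x y x′ y′} → CokerEq x y → CokerEq x′ y′ → CokerEq (x +ᴹ x′) (y +ᴹ y′)
      coker-+ (by h) (by h′) =
        by (≈ᴹ-trans (N.sub-+ _ _ _ _) (≈ᴹ-trans (+ᴹ-cong h h′) (≈ᴹ-sym (f.+ᴹ-homo _ _))))

      coker-*ˡ : ∀ r {x y} → CokerEq x y → CokerEq (r *ₗ x) (r *ₗ y)
      coker-*ˡ r {x} {y} (by h) =
        by (≈ᴹ-trans (+ᴹ-congˡ (≈ᴹ-sym (N.*ₗ-neg r y)))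
           (≈ᴹ-trans (≈ᴹ-sym (*ₗ-distribˡ r x (-ᴹ y))) (≈ᴹ-trans (*ₗ-congˡ h) (≈ᴹ-sym (f.*ₗ-homo r _)))))

    coker : Mod R c (b ⊔ ℓc)
    coker = record
      { Carrierᴹ = Carrierᴹ
      ; _≈ᴹ_ = CokerEq
      ; _+ᴹ_ = _+ᴹ_
      ; _*ₗ_ = _*ₗ_
      ; 0ᴹ = 0ᴹ
      ; -ᴹ_ = -ᴹ_
      ; isLeftModule = record
        { isLeftSemimodule = record
          { +ᴹ-isCommutativeMonoid = record
            { isMonoid = record
              { isSemigroup = record
                { isMagma = record
                  { isEquivalence = record
                    { refl = from≈ ≈ᴹ-refl ; sym = coker-sym ; trans = coker-trans }
                  ; ∙-cong = coker-+
                  }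
                ; assoc = λ x y z → from≈ (+ᴹ-assoc x y z)
                }
              ; identity = (λ x → from≈ (+ᴹ-identityˡ x)) , (λ x → from≈ (+ᴹ-identityʳ x))
              }
            ; comm = λ x y → from≈ (+ᴹ-comm x y)
            }
          ; isPreleftSemimodule = record
            { *ₗ-cong = λ {r} {s} r≈s h → coker-trans (coker-*ˡ r h) (from≈ (*ₗ-congʳ r≈s))
            ; *ₗ-zeroˡ = λ x → from≈ (*ₗ-zeroˡ x)
            ; *ₗ-distribʳ = λ x r s → from≈ (*ₗ-distribʳ x r s)
            ; *ₗ-identityˡ = λ x → from≈ (*ₗ-identityˡ x)
            ; *ₗ-assoc = λ r s x → from≈ (*ₗ-assoc r s x)
            ; *ₗ-zeroʳ = λ r → from≈ (*ₗ-zeroʳ r)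
            ; *ₗ-distribˡ = λ r x y → from≈ (*ₗ-distribˡ r x y)
            }
          }
        ; -ᴹ‿cong = coker-neg
        ; -ᴹ‿inverse = (λ x → from≈ (-ᴹ‿inverseˡ x)) , (λ x → from≈ (-ᴹ‿inverseʳ x))
        }
      }

    image : Mod R (b ⊔ c ⊔ ℓc) ℓc
    image = record
      { Carrierᴹ = Σ Carrierᴹ (λ y → ∃ λ x → y ≈ᴹ ⟦ f ⟧ x)
      ; _≈ᴹ_ = λ (x , _) (y , _) → x ≈ᴹ y
      ; _+ᴹ_ = λ (x , x′ , h) (y , y′ , h′) →
          x +ᴹ y , x′ M.+ᴹ y′ , ≈ᴹ-trans (+ᴹ-cong h h′) (≈ᴹ-sym (f.+ᴹ-homo x′ y′))
      ; _*ₗ_ = λ r (x , x′ , h) →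
          r *ₗ x , r M.*ₗ x′ , ≈ᴹ-trans (*ₗ-congˡ h) (≈ᴹ-sym (f.*ₗ-homo r x′))
      ; 0ᴹ = 0ᴹ , M.0ᴹ , ≈ᴹ-sym f.0ᴹ-homo
      ; -ᴹ_ = λ (x , x′ , h) → -ᴹ x , M.-ᴹ x′ , ≈ᴹ-trans (-ᴹ‿cong h) (≈ᴹ-sym (f.-ᴹ-homo x′))
      ; isLeftModule = record
        { isLeftSemimodule = record
          { +ᴹ-isCommutativeMonoid = record
            { isMonoid = record
              { isSemigroup = record
                { isMagma = record
                  { isEquivalence = record { refl = ≈ᴹ-refl ; sym = ≈ᴹ-sym ; trans = ≈ᴹ-trans }
                  ; ∙-cong = +ᴹ-cong
                  }
                ; assoc = λ _ _ _ → +ᴹ-assoc _ _ _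
                }
              ; identity = (λ _ → +ᴹ-identityˡ _) , (λ _ → +ᴹ-identityʳ _)
              }
            ; comm = λ _ _ → +ᴹ-comm _ _
            }
          ; isPreleftSemimodule = record
            { *ₗ-cong = *ₗ-cong
            ; *ₗ-zeroˡ = λ _ → *ₗ-zeroˡ _
            ; *ₗ-distribʳ = λ _ → *ₗ-distribʳ _
            ; *ₗ-identityˡ = λ _ → *ₗ-identityˡ _
            ; *ₗ-assoc = λ r s _ → *ₗ-assoc r s _
            ; *ₗ-zeroʳ = *ₗ-zeroʳ
            ; *ₗ-distribˡ = λ r _ _ → *ₗ-distribˡ r _ _
            }
          }
        ; -ᴹ‿cong = -ᴹ‿cong
        ; -ᴹ‿inverse = (λ _ → -ᴹ‿inverseˡ _) , (λ _ → -ᴹ‿inverseʳ _)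
        }
      }

_/⟨_⟩ : (R : CommutativeRing a ℓa) → CommutativeRing.Carrier R → Mod R a (a ⊔ ℓa)
R /⟨ a ⟩ = coker {M = regular R} {N = regular R} (linear R (regular R) (regular R) (a *_) *-congˡ (distribˡ a) a*rx≈r*ax)
  where
  open CommutativeRing R
  a*rx≈r*ax : ∀ r x → a * (r * x) ≈ r * (a * x)
  a*rx≈r*ax r x = trans (sym (*-assoc a r x)) (trans (*-congʳ (*-comm a r)) (*-assoc r a x))

module _ (R : CommutativeRing a ℓa) (X : Setoid b ℓb) where
  private
    module R = CommutativeRing R
    module X = Setoid X

  infixl 6 _⊕_
  infixr 7 _⊙_
  infixr 8 ⊖_

  data FreeTerm : Set (a ⊔ b) where
    [_] : X.Carrier → FreeTerm
    𝟘   : FreeTerm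
    _⊕_ : FreeTerm → FreeTerm → FreeTerm
    ⊖_  : FreeTerm → FreeTerm
    _⊙_ : R.Carrier → FreeTerm → FreeTerm

  infix 4 _≋_
  data _≋_ : FreeTerm → FreeTerm → Set (a ⊔ ℓa ⊔ b ⊔ ℓb) where
    []-cong     : ∀ {x y} → x X.≈ y → [ x ] ≋ [ y ]
    ≋-refl      : ∀ {t} → t ≋ t
    ≋-sym       : ∀ {t u} → t ≋ u → u ≋ t
    ≋-trans     : ∀ {t u w} → t ≋ u → u ≋ w → t ≋ w
    ⊕-cong      : ∀ {t u t′ u′} → t ≋ u → t′ ≋ u′ → t ⊕ t′ ≋ u ⊕ u′
    ⊕-assoc     : ∀ t u w → (t ⊕ u) ⊕ w ≋ t ⊕ (u ⊕ w)
    ⊕-comm      : ∀ t u → t ⊕ u ≋ u ⊕ t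
    ⊕-identity  : ∀ t → 𝟘 ⊕ t ≋ t
    ⊖-cong      : ∀ {t u} → t ≋ u → ⊖ t ≋ ⊖ u
    ⊖-inverse   : ∀ t → ⊖ t ⊕ t ≋ 𝟘
    ⊙-cong      : ∀ {r s t u} → r R.≈ s → t ≋ u → r ⊙ t ≋ s ⊙ u
    ⊙-distribˡ  : ∀ r t u → r ⊙ (t ⊕ u) ≋ r ⊙ t ⊕ r ⊙ u
    ⊙-distribʳ  : ∀ t r s → (r R.+ s) ⊙ t ≋ r ⊙ t ⊕ s ⊙ t
    ⊙-assoc     : ∀ r s t → (r R.* s) ⊙ t ≋ r ⊙ (s ⊙ t)
    ⊙-identity  : ∀ t → R.1# ⊙ t ≋ t

  private
    ⊕-identityʳ : ∀ t → t ⊕ 𝟘 ≋ t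
    ⊕-identityʳ t = ≋-trans (⊕-comm t 𝟘) (⊕-identity t)

    idempotent⇒𝟘 : ∀ {t} → t ⊕ t ≋ t → t ≋ 𝟘
    idempotent⇒𝟘 {t} h = ≋-trans (≋-sym (⊕-identity t)) (≋-trans (⊕-cong (≋-sym (⊖-inverse t)) ≋-refl)
      (≋-trans (⊕-assoc (⊖ t) t t) (≋-trans (⊕-cong ≋-refl h) (⊖-inverse t))))

  Free : Mod R (a ⊔ b) (a ⊔ ℓa ⊔ b ⊔ ℓb)
  Free = record
    { Carrierᴹ = FreeTerm
    ; _≈ᴹ_ = _≋_
    ; _+ᴹ_ = _⊕_
    ; _*ₗ_ = _⊙_
    ; 0ᴹ = 𝟘
    ; -ᴹ_ = ⊖_
    ; isLeftModule = record
      { isLeftSemimodule = record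
        { +ᴹ-isCommutativeMonoid = record
          { isMonoid = record
            { isSemigroup = record
              { isMagma = record
                { isEquivalence = record { refl = ≋-refl ; sym = ≋-sym ; trans = ≋-trans }
                ; ∙-cong = ⊕-cong
                }
              ; assoc = ⊕-assoc
              }
            ; identity = ⊕-identity , ⊕-identityʳ
            }
          ; comm = ⊕-comm
          }
        ; isPreleftSemimodule = record
          { *ₗ-cong = ⊙-cong
          ; *ₗ-zeroˡ = λ t → idempotent⇒𝟘 (≋-trans (≋-sym (⊙-distribʳ t R.0# R.0#)) (⊙-cong (R.+-identityˡ R.0#) ≋-refl))
          ; *ₗ-distribʳ = ⊙-distribʳ
          ; *ₗ-identityˡ = ⊙-identity
          ; *ₗ-assoc = ⊙-assoc
          ; *ₗ-zeroʳ = λ r → idempotent⇒𝟘 (≋-trans (≋-sym (⊙-distribˡ r 𝟘 𝟘)) (⊙-cong R.refl (⊕-identity 𝟘)))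
          ; *ₗ-distribˡ = ⊙-distribˡ
          }
        }
      ; -ᴹ‿cong = ⊖-cong
      ; -ᴹ‿inverse = ⊖-inverse , λ t → ≋-trans (⊕-comm t (⊖ t)) (⊖-inverse t)
      }
    }

  module _ (M : Mod R c ℓc) where
    open LeftModule M

    extend : (X.Carrier → Carrierᴹ) → FreeTerm → Carrierᴹ
    extend f [ x ]   = f x
    extend f 𝟘       = 0ᴹ
    extend f (t ⊕ u) = extend f t +ᴹ extend f u
    extend f (⊖ t)   = -ᴹ extend f t
    extend f (r ⊙ t) = r *ₗ extend f t

    lift : (f : X.Carrier → Carrierᴹ) → (∀ {x y} → x X.≈ y → f x ≈ᴹ f y) → LinearMap R Free M
    lift f f-cong = linear R Free M (extend f) respects (λ _ _ → ≈ᴹ-refl) (λ _ _ → ≈ᴹ-refl)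
      where
      respects : ∀ {t u} → t ≋ u → extend f t ≈ᴹ extend f u
      respects ([]-cong h) = f-cong h
      respects ≋-refl = ≈ᴹ-refl
      respects (≋-sym h) = ≈ᴹ-sym (respects h)
      respects (≋-trans h h′) = ≈ᴹ-trans (respects h) (respects h′)
      respects (⊕-cong h h′) = +ᴹ-cong (respects h) (respects h′)
      respects (⊕-assoc t u w) = +ᴹ-assoc _ _ _
      respects (⊕-comm t u) = +ᴹ-comm _ _
      respects (⊕-identity t) = +ᴹ-identityˡ _
      respects (⊖-cong h) = -ᴹ‿cong (respects h)
      respects (⊖-inverse t) = -ᴹ‿inverseˡ _
      respects (⊙-cong r≈s h) = *ₗ-cong r≈s (respects h)
      respects (⊙-distribˡ r t u) = *ₗ-distribˡ r _ _
      respects (⊙-distribʳ t r s) = *ₗ-distribʳ _ r s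
      respects (⊙-assoc r s t) = *ₗ-assoc r s _
      respects (⊙-identity t) = *ₗ-identityˡ _

-- The group ring R[G], of which only the R-module structure and the action on
-- R[G]-modules are needed.
_[_]ᴳ : (R : CommutativeRing a ℓa) (G : Group b ℓb) → Mod R (a ⊔ b) (a ⊔ ℓa ⊔ b ⊔ ℓb)
R [ G ]ᴳ = Free R (Group.setoid G)

-- An R[G]-module, given as an R-module with a linear action of G.
record GModule (R : CommutativeRing a ℓa) (G : Group b ℓb) c ℓc : Set (a ⊔ ℓa ⊔ b ⊔ ℓb ⊔ lsuc (c ⊔ ℓc)) where
  private
    module R = CommutativeRing R
    module G = Group G

  field
    underlying : Mod R c ℓc

  open LeftModule underlying public

  infixr 7 _∙_
  field
    _∙_        : G.Carrier → Carrierᴹ → Carrierᴹ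
    ∙-cong     : ∀ {g h x y} → g G.≈ h → x ≈ᴹ y → g ∙ x ≈ᴹ h ∙ y
    ∙-+        : ∀ g x y → g ∙ (x +ᴹ y) ≈ᴹ g ∙ x +ᴹ g ∙ y
    ∙-*ₗ       : ∀ g r x → g ∙ (r *ₗ x) ≈ᴹ r *ₗ (g ∙ x)
    ∙-identity : ∀ x → G.ε ∙ x ≈ᴹ x
    ∙-assoc    : ∀ g h x → (g G.∙ h) ∙ x ≈ᴹ g ∙ (h ∙ x)

  action : G.Carrier → LinearMap R underlying underlying
  action g = linear R underlying underlying (g ∙_) (∙-cong G.refl) (∙-+ g) (∙-*ₗ g)

  infixr 7 _·_
  _·_ : FreeTerm R G.setoid → Carrierᴹ → Carrierᴹ
  [ g ] · x   = g ∙ x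
  𝟘 · x       = 0ᴹ
  (t ⊕ u) · x = t · x +ᴹ u · x
  (⊖ t) · x   = -ᴹ (t · x)
  (r ⊙ t) · x = r *ₗ (t · x)

  multiplication : FreeTerm R G.setoid → LinearMap R underlying underlying
  multiplication t = linear R underlying underlying (t ·_) (·-cong t) (·-+ t) (·-*ₗ t)
    where
    open CommutativeSemigroupProperties
      (AbelianGroup.commutativeSemigroup +ᴹ-abelianGroup)
      using (interchange)
    open AbelianGroupProperties +ᴹ-abelianGroup using (⁻¹-∙-comm)
    open GroupProperties +ᴹ-group using (inverseʳ-unique)

    ·-cong : ∀ t {x y} → x ≈ᴹ y → t · x ≈ᴹ t · y
    ·-cong [ g ] h   = ∙-cong G.refl h
    ·-cong 𝟘 h       = ≈ᴹ-refl
    ·-cong (t ⊕ u) h = +ᴹ-cong (·-cong t h) (·-cong u h)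
    ·-cong (⊖ t) h   = -ᴹ‿cong (·-cong t h)
    ·-cong (r ⊙ t) h = *ₗ-congˡ (·-cong t h)

    ·-+ : ∀ t x y → t · (x +ᴹ y) ≈ᴹ t · x +ᴹ t · y
    ·-+ [ g ] x y   = ∙-+ g x y
    ·-+ 𝟘 x y       = ≈ᴹ-sym (+ᴹ-identityˡ 0ᴹ)
    ·-+ (t ⊕ u) x y = ≈ᴹ-trans (+ᴹ-cong (·-+ t x y) (·-+ u x y)) (interchange _ _ _ _)
    ·-+ (⊖ t) x y   = ≈ᴹ-trans (-ᴹ‿cong (·-+ t x y)) (≈ᴹ-sym (⁻¹-∙-comm _ _))
    ·-+ (r ⊙ t) x y = ≈ᴹ-trans (*ₗ-congˡ (·-+ t x y)) (*ₗ-distribˡ r _ _)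

    *ₗ-swap : ∀ r s x → r *ₗ s *ₗ x ≈ᴹ s *ₗ r *ₗ x
    *ₗ-swap r s x = ≈ᴹ-trans (≈ᴹ-sym (*ₗ-assoc r s x)) (≈ᴹ-trans (*ₗ-congʳ (R.*-comm r s)) (*ₗ-assoc s r x))

    ·-*ₗ : ∀ t r x → t · (r *ₗ x) ≈ᴹ r *ₗ (t · x)
    ·-*ₗ [ g ] r x   = ∙-*ₗ g r x
    ·-*ₗ 𝟘 r x       = ≈ᴹ-sym (*ₗ-zeroʳ r)
    ·-*ₗ (t ⊕ u) r x = ≈ᴹ-trans (+ᴹ-cong (·-*ₗ t r x) (·-*ₗ u r x)) (≈ᴹ-sym (*ₗ-distribˡ r _ _))
    ·-*ₗ (⊖ t) r x   = ≈ᴹ-trans (-ᴹ‿cong (·-*ₗ t r x)) (≈ᴹ-sym (inverseʳ-unique _ _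
      (≈ᴹ-trans (≈ᴹ-sym (*ₗ-distribˡ r _ _)) (≈ᴹ-trans (*ₗ-congˡ (-ᴹ‿inverseʳ (t · x))) (*ₗ-zeroʳ r)))))
    ·-*ₗ (s ⊙ t) r x = ≈ᴹ-trans (*ₗ-congˡ (·-*ₗ t r x)) (*ₗ-swap s r (t · x))

module _ {R : CommutativeRing a ℓa} {G : Group b ℓb} (M : GModule R G c ℓc) where
  open GModule M

  cokerᴳ : (f : LinearMap R underlying underlying) →
           (∀ g x → g ∙ LinearMap.⟦_⟧ f x ≈ᴹ LinearMap.⟦_⟧ f (g ∙ x)) → GModule R G c (c ⊔ ℓc)
  cokerᴳ f equivariant = record
    { underlying = coker f
    ; _∙_ = _∙_
    ; ∙-cong = λ {g} {h} {x} {y} g≈h x∼y → C.≈ᴹ-trans (respects g x∼y) (from≈ (∙-cong g≈h ≈ᴹ-refl))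
    ; ∙-+ = λ g x y → from≈ (∙-+ g x y)
    ; ∙-*ₗ = λ g r x → from≈ (∙-*ₗ g r x)
    ; ∙-identity = λ x → from≈ (∙-identity x)
    ; ∙-assoc = λ g h x → from≈ (∙-assoc g h x)
    }
    where
    module C = LeftModule (coker f)
    module f = LinearMap f
    open GroupProperties +ᴹ-group using (x≈y⇒x∙y⁻¹≈ε)
    from≈ : ∀ {x y} → x ≈ᴹ y → x C.≈ᴹ y
    from≈ x≈y = by (≈ᴹ-trans (x≈y⇒x∙y⁻¹≈ε x≈y) (≈ᴹ-sym f.0ᴹ-homo))
    respects : ∀ g {x y} → x C.≈ᴹ y → g ∙ x C.≈ᴹ g ∙ y
    respects g {x} {y} (by h) = by (≈ᴹ-trans (+ᴹ-congˡ (≈ᴹ-sym (LinearMap.-ᴹ-homo (action g) y)))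
      (≈ᴹ-trans (≈ᴹ-sym (∙-+ g x (-ᴹ y))) (≈ᴹ-trans (∙-cong (Group.refl G) h) (equivariant g _))))

module _ (R : CommutativeRing a ℓa) (S : CommutativeRing b ℓb) (φ : R ⟶ʳ S) (M : Mod R c ℓc) where
  private
    module R = CommutativeRing R
    module S = CommutativeRing S
    module M = LeftModule M
    open RingHomomorphism φ using () renaming (⟦_⟧ to embed)

  infixl 6 _⊞_
  infix  7 _⊗_
  infixr 8 ⊟_

  data Tensor : Set (b ⊔ c) where
    _⊗_ : S.Carrier → M.Carrierᴹ → Tensor
    𝕆   : Tensor
    _⊞_ : Tensor → Tensor → Tensor
    ⊟_  : Tensor → Tensor

  infix 4 _≃_
  data _≃_ : Tensor → Tensor → Set (a ⊔ b ⊔ ℓb ⊔ c ⊔ ℓc) where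
    ⊗-cong     : ∀ {s s′ m m′} → s S.≈ s′ → m M.≈ᴹ m′ → s ⊗ m ≃ s′ ⊗ m′
    ⊗-distribˡ : ∀ s m m′ → s ⊗ (m M.+ᴹ m′) ≃ s ⊗ m ⊞ s ⊗ m′
    ⊗-distribʳ : ∀ m s s′ → (s S.+ s′) ⊗ m ≃ s ⊗ m ⊞ s′ ⊗ m
    ⊗-balanced : ∀ s r m → (s S.* embed r) ⊗ m ≃ s ⊗ (r M.*ₗ m)
    ≃-refl     : ∀ {t} → t ≃ t
    ≃-sym      : ∀ {t u} → t ≃ u → u ≃ t
    ≃-trans    : ∀ {t u w} → t ≃ u → u ≃ w → t ≃ w
    ⊞-cong     : ∀ {t u t′ u′} → t ≃ u → t′ ≃ u′ → t ⊞ t′ ≃ u ⊞ u′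
    ⊞-assoc    : ∀ t u w → (t ⊞ u) ⊞ w ≃ t ⊞ (u ⊞ w)
    ⊞-comm     : ∀ t u → t ⊞ u ≃ u ⊞ t
    ⊞-identity : ∀ t → 𝕆 ⊞ t ≃ t
    ⊟-cong     : ∀ {t u} → t ≃ u → ⊟ t ≃ ⊟ u
    ⊟-inverse  : ∀ t → ⊟ t ⊞ t ≃ 𝕆

  infixr 7 _⊡_
  _⊡_ : S.Carrier → Tensor → Tensor
  s ⊡ (s′ ⊗ m) = (s S.* s′) ⊗ m
  s ⊡ 𝕆        = 𝕆
  s ⊡ (t ⊞ u)  = s ⊡ t ⊞ s ⊡ u
  s ⊡ (⊟ t)    = ⊟ (s ⊡ t)

  private
    ⊞-identityʳ : ∀ t → t ⊞ 𝕆 ≃ t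
    ⊞-identityʳ t = ≃-trans (⊞-comm t 𝕆) (⊞-identity t)

    ⊟-inverseʳ : ∀ t → t ⊞ ⊟ t ≃ 𝕆
    ⊟-inverseʳ t = ≃-trans (⊞-comm t (⊟ t)) (⊟-inverse t)

    tensorGroup : AbelianGroup (b ⊔ c) (a ⊔ b ⊔ ℓb ⊔ c ⊔ ℓc)
    tensorGroup = record
      { Carrier = Tensor ; _≈_ = _≃_ ; _∙_ = _⊞_ ; ε = 𝕆 ; _⁻¹ = ⊟_
      ; isAbelianGroup = record
        { isGroup = record
          { isMonoid = record
            { isSemigroup = record
              { isMagma = record
                { isEquivalence = record { refl = ≃-refl ; sym = ≃-sym ; trans = ≃-trans }
                ; ∙-cong = ⊞-cong
                }
              ; assoc = ⊞-assoc
              }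
            ; identity = ⊞-identity , ⊞-identityʳ
            }
          ; inverse = ⊟-inverse , ⊟-inverseʳ
          ; ⁻¹-cong = ⊟-cong
          }
        ; comm = ⊞-comm
        }
      }

    open AbelianGroupProperties tensorGroup using (⁻¹-∙-comm)
    open GroupProperties (AbelianGroup.group tensorGroup) using (identityʳ-unique; ε⁻¹≈ε)
    open CommutativeSemigroupProperties (AbelianGroup.commutativeSemigroup tensorGroup) using (interchange)

    ⊡-congˡ : ∀ s {t u} → t ≃ u → s ⊡ t ≃ s ⊡ u
    ⊡-congˡ s (⊗-cong h h′) = ⊗-cong (S.*-congˡ h) h′
    ⊡-congˡ s (⊗-distribˡ s′ m m′) = ⊗-distribˡ (s S.* s′) m m′
    ⊡-congˡ s (⊗-distribʳ m s′ s″) =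
      ≃-trans (⊗-cong (S.distribˡ s s′ s″) M.≈ᴹ-refl) (⊗-distribʳ m (s S.* s′) (s S.* s″))
    ⊡-congˡ s (⊗-balanced s′ r m) =
      ≃-trans (⊗-cong (S.sym (S.*-assoc s s′ (embed r))) M.≈ᴹ-refl) (⊗-balanced (s S.* s′) r m)
    ⊡-congˡ s ≃-refl = ≃-refl
    ⊡-congˡ s (≃-sym h) = ≃-sym (⊡-congˡ s h)
    ⊡-congˡ s (≃-trans h h′) = ≃-trans (⊡-congˡ s h) (⊡-congˡ s h′)
    ⊡-congˡ s (⊞-cong h h′) = ⊞-cong (⊡-congˡ s h) (⊡-congˡ s h′)
    ⊡-congˡ s (⊞-assoc t u w) = ⊞-assoc _ _ _
    ⊡-congˡ s (⊞-comm t u) = ⊞-comm _ _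
    ⊡-congˡ s (⊞-identity t) = ⊞-identity _
    ⊡-congˡ s (⊟-cong h) = ⊟-cong (⊡-congˡ s h)
    ⊡-congˡ s (⊟-inverse t) = ⊟-inverse _

    ⊡-congʳ : ∀ {s s′} → s S.≈ s′ → ∀ t → s ⊡ t ≃ s′ ⊡ t
    ⊡-congʳ h (_ ⊗ _) = ⊗-cong (S.*-congʳ h) M.≈ᴹ-refl
    ⊡-congʳ h 𝕆 = ≃-refl
    ⊡-congʳ h (t ⊞ u) = ⊞-cong (⊡-congʳ h t) (⊡-congʳ h u)
    ⊡-congʳ h (⊟ t) = ⊟-cong (⊡-congʳ h t)

    ⊡-distribʳ : ∀ t s s′ → (s S.+ s′) ⊡ t ≃ s ⊡ t ⊞ s′ ⊡ t
    ⊡-distribʳ (s″ ⊗ m) s s′ = ≃-trans (⊗-cong (S.distribʳ s″ s s′) M.≈ᴹ-refl) (⊗-distribʳ m _ _)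
    ⊡-distribʳ 𝕆 s s′ = ≃-sym (⊞-identity 𝕆)
    ⊡-distribʳ (t ⊞ u) s s′ = ≃-trans (⊞-cong (⊡-distribʳ t s s′) (⊡-distribʳ u s s′)) (interchange _ _ _ _)
    ⊡-distribʳ (⊟ t) s s′ = ≃-trans (⊟-cong (⊡-distribʳ t s s′)) (≃-sym (⁻¹-∙-comm _ _))

    ⊡-assoc : ∀ s s′ t → (s S.* s′) ⊡ t ≃ s ⊡ (s′ ⊡ t)
    ⊡-assoc s s′ (s″ ⊗ m) = ⊗-cong (S.*-assoc s s′ s″) M.≈ᴹ-refl
    ⊡-assoc s s′ 𝕆 = ≃-refl
    ⊡-assoc s s′ (t ⊞ u) = ⊞-cong (⊡-assoc s s′ t) (⊡-assoc s s′ u)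
    ⊡-assoc s s′ (⊟ t) = ⊟-cong (⊡-assoc s s′ t)

    ⊡-identity : ∀ t → S.1# ⊡ t ≃ t
    ⊡-identity (s ⊗ m) = ⊗-cong (S.*-identityˡ s) M.≈ᴹ-refl
    ⊡-identity 𝕆 = ≃-refl
    ⊡-identity (t ⊞ u) = ⊞-cong (⊡-identity t) (⊡-identity u)
    ⊡-identity (⊟ t) = ⊟-cong (⊡-identity t)

    ⊡-zeroˡ : ∀ t → S.0# ⊡ t ≃ 𝕆
    ⊡-zeroˡ t = identityʳ-unique (S.0# ⊡ t) (S.0# ⊡ t)
      (≃-trans (≃-sym (⊡-distribʳ t S.0# S.0#)) (⊡-congʳ (S.+-identityˡ S.0#) t))

  tensor : Mod S (b ⊔ c) (a ⊔ b ⊔ ℓb ⊔ c ⊔ ℓc)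
  tensor = record
    { Carrierᴹ = Tensor
    ; _≈ᴹ_ = _≃_
    ; _+ᴹ_ = _⊞_
    ; _*ₗ_ = _⊡_
    ; 0ᴹ = 𝕆
    ; -ᴹ_ = ⊟_
    ; isLeftModule = record
      { isLeftSemimodule = record
        { +ᴹ-isCommutativeMonoid = AbelianGroup.isCommutativeMonoid tensorGroup
        ; isPreleftSemimodule = record
          { *ₗ-cong = λ {s} {s′} {t} {u} h h′ → ≃-trans (⊡-congʳ h t) (⊡-congˡ s′ h′)
          ; *ₗ-zeroˡ = ⊡-zeroˡ
          ; *ₗ-distribʳ = ⊡-distribʳ
          ; *ₗ-identityˡ = ⊡-identity
          ; *ₗ-assoc = ⊡-assoc
          ; *ₗ-zeroʳ = λ _ → ≃-refl
          ; *ₗ-distribˡ = λ _ _ _ → ≃-refl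
          }
        }
      ; -ᴹ‿cong = ⊟-cong
      ; -ᴹ‿inverse = ⊟-inverse , ⊟-inverseʳ
      }
    }

tensorᴳ : (R : CommutativeRing a ℓa) (S : CommutativeRing b ℓb) (φ : R ⟶ʳ S) {G : Group c ℓc} →
          GModule R G d ℓd → GModule S G (b ⊔ d) (a ⊔ b ⊔ ℓb ⊔ d ⊔ ℓd)
tensorᴳ R S φ {G = G} N = record
  { underlying = tensor R S φ underlying
  ; _∙_ = act
  ; ∙-cong = λ {g} {h} {t} {u} g≈h t≃u → ≃-trans (act-congʳ g≈h t) (act-congˡ h t≃u)
  ; ∙-+ = λ _ _ _ → ≃-refl
  ; ∙-*ₗ = act-⊡
  ; ∙-identity = act-identity
  ; ∙-assoc = act-assoc
  }
  where
  open GModule N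
  module S = CommutativeRing S
  module G = Group G

  act : G.Carrier → Tensor R S φ underlying → Tensor R S φ underlying
  act g (s ⊗ m) = s ⊗ (g ∙ m)
  act g 𝕆       = 𝕆
  act g (t ⊞ u) = act g t ⊞ act g u
  act g (⊟ t)   = ⊟ act g t

  infix 4 _∼_
  _∼_ = _≃_ R S φ underlying

  act-congʳ : ∀ {g h} → g G.≈ h → ∀ t → act g t ∼ act h t
  act-congʳ g≈h (s ⊗ m) = ⊗-cong S.refl (∙-cong g≈h ≈ᴹ-refl)
  act-congʳ g≈h 𝕆       = ≃-refl
  act-congʳ g≈h (t ⊞ u) = ⊞-cong (act-congʳ g≈h t) (act-congʳ g≈h u)
  act-congʳ g≈h (⊟ t)   = ⊟-cong (act-congʳ g≈h t)

  act-congˡ : ∀ g {t u} → t ∼ u → act g t ∼ act g u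
  act-congˡ g (⊗-cong h h′) = ⊗-cong h (∙-cong G.refl h′)
  act-congˡ g (⊗-distribˡ s m m′) = ≃-trans (⊗-cong S.refl (∙-+ g m m′)) (⊗-distribˡ s _ _)
  act-congˡ g (⊗-distribʳ m s s′) = ⊗-distribʳ _ s s′
  act-congˡ g (⊗-balanced s r m) = ≃-trans (⊗-balanced s r _) (⊗-cong S.refl (≈ᴹ-sym (∙-*ₗ g r m)))
  act-congˡ g ≃-refl = ≃-refl
  act-congˡ g (≃-sym h) = ≃-sym (act-congˡ g h)
  act-congˡ g (≃-trans h h′) = ≃-trans (act-congˡ g h) (act-congˡ g h′)
  act-congˡ g (⊞-cong h h′) = ⊞-cong (act-congˡ g h) (act-congˡ g h′)
  act-congˡ g (⊞-assoc t u w) = ⊞-assoc _ _ _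
  act-congˡ g (⊞-comm t u) = ⊞-comm _ _
  act-congˡ g (⊞-identity t) = ⊞-identity _
  act-congˡ g (⊟-cong h) = ⊟-cong (act-congˡ g h)
  act-congˡ g (⊟-inverse t) = ⊟-inverse _

  act-⊡ : ∀ g s t → act g (_⊡_ R S φ underlying s t) ∼ _⊡_ R S φ underlying s (act g t)
  act-⊡ g s (s′ ⊗ m) = ≃-refl
  act-⊡ g s 𝕆        = ≃-refl
  act-⊡ g s (t ⊞ u)  = ⊞-cong (act-⊡ g s t) (act-⊡ g s u)
  act-⊡ g s (⊟ t)    = ⊟-cong (act-⊡ g s t)

  act-identity : ∀ t → act G.ε t ∼ t
  act-identity (s ⊗ m) = ⊗-cong S.refl (∙-identity m)
  act-identity 𝕆       = ≃-refl
  act-identity (t ⊞ u) = ⊞-cong (act-identity t) (act-identity u)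
  act-identity (⊟ t)   = ⊟-cong (act-identity t)

  act-assoc : ∀ g h t → act (g G.∙ h) t ∼ act g (act h t)
  act-assoc g h (s ⊗ m) = ⊗-cong S.refl (∙-assoc g h m)
  act-assoc g h 𝕆       = ≃-refl
  act-assoc g h (t ⊞ u) = ⊞-cong (act-assoc g h t) (act-assoc g h u)
  act-assoc g h (⊟ t)   = ⊟-cong (act-assoc g h t)

-- The edges leaving a vertex w are finite in number and listed, without
-- repetition, by out w.
record Digraph a ℓa b ℓb : Set (lsuc (a ⊔ ℓa ⊔ b ⊔ ℓb)) where
  field
    V : Setoid a ℓa
    E : Setoid b ℓb
    o : Func E V
    t : Func E V

  module V = Setoid V
  module E = Setoid E
  open Func o public using () renaming (to to o⟨_⟩; cong to o-cong)
  open Func t public using () renaming (to to t⟨_⟩; cong to t-cong)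

  field
    deg           : V.Carrier → ℕ
    out           : ∀ w → Vector E.Carrier (deg w)
    out-origin    : ∀ w k → o⟨ out w k ⟩ V.≈ w
    out-injective : ∀ w {k l} → out w k E.≈ out w l → k ≡ l
    out-complete  : ∀ {w ε} → o⟨ ε ⟩ V.≈ w → ∃ λ k → out w k E.≈ ε

ℤ-ring : CommutativeRing 0ℓ 0ℓ
ℤ-ring = ℤ.+-*-commutativeRing

module _ (Y : Digraph a ℓa b ℓb) where
  open Digraph Y

  private
    module ℤ[V] = LeftModule (Free ℤ-ring V)
    module Sums = SumProperties ℤ[V].+ᴹ-commutativeMonoid

    neighbours : V.Carrier → FreeTerm ℤ-ring V
    neighbours w = Sums.sum (λ k → [ t⟨ out w k ⟩ ])

    neighbours-cong : ∀ {w w′} → w V.≈ w′ → _≋_ ℤ-ring V (neighbours w) (neighbours w′)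
    neighbours-cong {w} {w′} w≈w′ = ≋-sym (≋-trans
      (Sums.sum-permute (λ k → [ t⟨ out w′ k ⟩ ]) π)
      (Sums.sum-cong-≋ (λ k → []-cong (t-cong (proj₂ (match w≈w′ k))))))
      where
      match : ∀ {w w′} → w V.≈ w′ → ∀ k → ∃ λ l → out w′ l E.≈ out w k
      match h k = out-complete (V.trans (out-origin _ k) h)
      back : ∀ {w w′} (h : w V.≈ w′) (h′ : w′ V.≈ w) k → proj₁ (match h (proj₁ (match h′ k))) ≡ k
      back h h′ k = out-injective _ (E.trans (proj₂ (match h _)) (proj₂ (match h′ k)))
      π : Permutation (deg w) (deg w′)
      π = permutation (λ k → proj₁ (match w≈w′ k)) (λ k → proj₁ (match (V.sym w≈w′) k))
            (back w≈w′ (V.sym w≈w′)) (back (V.sym w≈w′) w≈w′)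

  𝒜 : LinearMap ℤ-ring (Free ℤ-ring V) (Free ℤ-ring V)
  𝒜 = lift ℤ-ring V (Free ℤ-ring V) neighbours neighbours-cong

module Derived (X : Digraph a ℓa b ℓb) (G : Group c ℓc) (α : Func (Digraph.E X) (Group.setoid G)) where
  open Digraph X
  private
    module G = Group G

  derived : Digraph (a ⊔ c) (ℓa ⊔ ℓc) (b ⊔ c) (ℓb ⊔ ℓc)
  derived = record
    { V = ×-setoid V G.setoid
    ; E = ×-setoid E G.setoid
    ; o = record
      { to = λ (e , σ) → o⟨ e ⟩ , σ
      ; cong = λ (h , h′) → o-cong h , h′
      }
    ; t = record
      { to = λ (e , σ) → t⟨ e ⟩ , σ G.∙ Func.to α e
      ; cong = λ (h , h′) → t-cong h , G.∙-cong h′ (Func.cong α h)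
      }
    ; deg = λ (v , _) → deg v
    ; out = λ (v , σ) k → out v k , σ
    ; out-origin = λ (v , σ) k → out-origin v k , G.refl
    ; out-injective = λ (v , σ) (h , _) → out-injective v h
    ; out-complete = λ (h , h′) → proj₁ (out-complete h) , proj₂ (out-complete h) , G.sym h′
    }

  private
    V×G = Digraph.V derived
    ℤ[V×G] = Free ℤ-ring V×G
    module Sums = SumProperties (LeftModule.+ᴹ-commutativeMonoid ℤ[V×G])

    translate : G.Carrier → LinearMap ℤ-ring ℤ[V×G] ℤ[V×G]
    translate g = lift ℤ-ring V×G ℤ[V×G] (λ (v , σ) → [ v , g G.∙ σ ])
      (λ (h , h′) → []-cong (h , G.∙-congˡ h′))

    open LinearMap using (⟦_⟧)

    infix 4 _∼_
    _∼_ = _≋_ ℤ-ring V×G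

    translate-cong : ∀ {g h} → g G.≈ h → ∀ x → ⟦ translate g ⟧ x ∼ ⟦ translate h ⟧ x
    translate-cong g≈h [ v , σ ] = []-cong (Setoid.refl V , G.∙-congʳ g≈h)
    translate-cong g≈h 𝟘         = ≋-refl
    translate-cong g≈h (x ⊕ y)   = ⊕-cong (translate-cong g≈h x) (translate-cong g≈h y)
    translate-cong g≈h (⊖ x)     = ⊖-cong (translate-cong g≈h x)
    translate-cong g≈h (r ⊙ x)   = ⊙-cong refl (translate-cong g≈h x)

    translate-identity : ∀ x → ⟦ translate G.ε ⟧ x ∼ x
    translate-identity [ v , σ ] = []-cong (Setoid.refl V , G.identityˡ σ)
    translate-identity 𝟘         = ≋-refl
    translate-identity (x ⊕ y)   = ⊕-cong (translate-identity x) (translate-identity y)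
    translate-identity (⊖ x)     = ⊖-cong (translate-identity x)
    translate-identity (r ⊙ x)   = ⊙-cong refl (translate-identity x)

    translate-∙ : ∀ g h x → ⟦ translate (g G.∙ h) ⟧ x ∼ ⟦ translate g ⟧ (⟦ translate h ⟧ x)
    translate-∙ g h [ v , σ ] = []-cong (Setoid.refl V , G.assoc g h σ)
    translate-∙ g h 𝟘         = ≋-refl
    translate-∙ g h (x ⊕ y)   = ⊕-cong (translate-∙ g h x) (translate-∙ g h y)
    translate-∙ g h (⊖ x)     = ⊖-cong (translate-∙ g h x)
    translate-∙ g h (r ⊙ x)   = ⊙-cong refl (translate-∙ g h x)

    translate-sum : ∀ g {n} (f : Vector (FreeTerm ℤ-ring V×G) n) →
                    ⟦ translate g ⟧ (Sums.sum f) ∼ Sums.sum (⟦ translate g ⟧ ∘ f)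
    translate-sum g {zero}  f = ≋-refl
    translate-sum g {suc n} f = ⊕-cong ≋-refl (translate-sum g (f ∘ suc))

    translate-𝒜 : ∀ g x → ⟦ translate g ⟧ (⟦ 𝒜 derived ⟧ x) ∼ ⟦ 𝒜 derived ⟧ (⟦ translate g ⟧ x)
    translate-𝒜 g [ v , σ ] = ≋-trans
      (translate-sum g (λ k → [ t⟨ out v k ⟩ , σ G.∙ Func.to α (out v k) ]))
      (Sums.sum-cong-≋ (λ k → []-cong (Setoid.refl V , G.sym (G.assoc g σ (Func.to α (out v k))))))
    translate-𝒜 g 𝟘         = ≋-refl
    translate-𝒜 g (x ⊕ y)   = ⊕-cong (translate-𝒜 g x) (translate-𝒜 g y)
    translate-𝒜 g (⊖ x)     = ⊖-cong (translate-𝒜 g x)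
    translate-𝒜 g (r ⊙ x)   = ⊙-cong refl (translate-𝒜 g x)

  permutationModule : GModule ℤ-ring G (a ⊔ c) (a ⊔ ℓa ⊔ c ⊔ ℓc)
  permutationModule = record
    { underlying = ℤ[V×G]
    ; _∙_ = λ g → ⟦ translate g ⟧
    ; ∙-cong = λ {g} {h} {x} g≈h x≈y → ≋-trans (translate-cong g≈h x) (LinearMap.⟦⟧-cong (translate h) x≈y)
    ; ∙-+ = λ _ _ _ → ≋-refl
    ; ∙-*ₗ = λ _ _ _ → ≋-refl
    ; ∙-identity = translate-identity
    ; ∙-assoc = translate-∙
    }

  BF : GModule ℤ-ring G (a ⊔ c) (a ⊔ ℓa ⊔ c ⊔ ℓc)
  BF = cokerᴳ permutationModule (identity-minus (𝒜 derived))
    (λ g x → ⊕-cong ≋-refl (⊖-cong (translate-𝒜 g x)))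

-- e i k is the loop e_{i+1,k+1}; thus 1 ≤ k+1 ≤ i+1 ≤ n.
data Loop (n : ℕ) : Set where
  e₀ : Loop n
  e  : (i : Fin n) → Fin (suc (toℕ i)) → Loop n

record Enumeration (A : Set) : Set where
  field
    size     : ℕ
    element  : Fin size → A
    unique   : ∀ {k l} → element k ≡ element l → k ≡ l
    complete : ∀ a → ∃ λ k → element k ≡ a

pairs : ∀ {n} (f : Fin n → ℕ) → Enumeration (Σ (Fin n) (Fin ∘ f))
pairs {zero}  f = record { size = 0 ; element = λ () ; unique = λ { {()} } ; complete = λ () }
pairs {suc n} f = record
  { size = f zero ℕ.+ R.size
  ; element = from ∘ splitAt (f zero)
  ; unique = λ {k} {l} h → splitAt-injective k l (from-injective _ _ h)
  ; complete = λ
    { (zero , k)  → k ↑ˡ R.size , ≡.cong from (Fin.splitAt-↑ˡ (f zero) k R.size)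
    ; (suc i , k) → f zero ↑ʳ proj₁ (R.complete (i , k)) ,
        ≡.trans (≡.cong from (Fin.splitAt-↑ʳ (f zero) R.size (proj₁ (R.complete (i , k)))))
                (≡.cong shift (proj₂ (R.complete (i , k))))
    }
  }
  where
  module R = Enumeration (pairs (f ∘ suc))
  shift : Σ (Fin n) (Fin ∘ f ∘ suc) → Σ (Fin (suc n)) (Fin ∘ f)
  shift (i , k) = suc i , k
  from : Fin (f zero) ⊎ Fin R.size → Σ (Fin (suc n)) (Fin ∘ f)
  from (inj₁ k) = zero , k
  from (inj₂ k) = shift (R.element k)
  shift-injective : ∀ {u w} → shift u ≡ shift w → u ≡ w
  shift-injective refl = refl
  from-injective : ∀ u w → from u ≡ from w → u ≡ w
  from-injective (inj₁ k) (inj₁ .k) refl = refl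
  from-injective (inj₂ k) (inj₂ l)  h    = ≡.cong inj₂ (R.unique (shift-injective h))
  splitAt-injective : ∀ k l → splitAt (f zero) {R.size} k ≡ splitAt (f zero) l → k ≡ l
  splitAt-injective k l h = ≡.trans (≡.sym (Fin.join-splitAt (f zero) R.size k))
    (≡.trans (≡.cong (join (f zero) R.size) h) (Fin.join-splitAt (f zero) R.size l))

loops : ∀ n → Enumeration (Loop n)
loops n = record
  { size = suc P.size
  ; element = element
  ; unique = λ {k} {l} → unique k l
  ; complete = λ
    { e₀      → zero , refl
    ; (e i k) → suc (proj₁ (P.complete (i , k))) , ≡.cong (uncurry e) (proj₂ (P.complete (i , k)))
    }
  }
  where
  module P = Enumeration (pairs {n} (suc ∘ toℕ))
  element : Fin (suc P.size) → Loop n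
  element zero    = e₀
  element (suc k) = uncurry e (P.element k)
  e-injective : ∀ {u w : Σ (Fin n) (Fin ∘ suc ∘ toℕ)} → uncurry e u ≡ uncurry e w → u ≡ w
  e-injective refl = refl
  unique : ∀ k l → element k ≡ element l → k ≡ l
  unique zero    zero    h = refl
  unique (suc k) (suc l) h = ≡.cong suc (P.unique (e-injective h))

bouquet : ℕ → Digraph 0ℓ 0ℓ 0ℓ 0ℓ
bouquet n = record
  { V = ≡.setoid ⊤
  ; E = ≡.setoid (Loop n)
  ; o = record { to = λ _ → tt ; cong = λ _ → refl }
  ; t = record { to = λ _ → tt ; cong = λ _ → refl }
  ; deg = λ _ → size
  ; out = λ _ → element
  ; out-origin = λ _ _ → refl
  ; out-injective = λ _ → unique
  ; out-complete = λ {_} {ε} _ → complete ε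
  }
  where open Enumeration (loops n)

units : CommutativeRing a ℓa → Group (a ⊔ ℓa) ℓa
units R = record
  { Carrier = Σ Carrier (λ u → ∃ λ w → u * w ≈ 1#)
  ; _≈_ = λ (u , _) (u′ , _) → u ≈ u′
  ; _∙_ = λ (u , w , h) (u′ , w′ , h′) → u * u′ , w * w′ ,
      trans (interchange u u′ w w′) (trans (*-cong h h′) (*-identityˡ 1#))
  ; ε = 1# , 1# , *-identityˡ 1#
  ; _⁻¹ = λ (u , w , h) → w , u , trans (*-comm w u) h
  ; isGroup = record
    { isMonoid = record
      { isSemigroup = record
        { isMagma = record
          { isEquivalence = record { refl = CommutativeRing.refl R ; sym = sym ; trans = trans }
          ; ∙-cong = *-cong
          }
        ; assoc = λ _ _ _ → *-assoc _ _ _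
        }
      ; identity = (λ _ → *-identityˡ _) , (λ _ → *-identityʳ _)
      }
    ; inverse = (λ (u , w , h) → trans (*-comm w u) h) , (λ (u , w , h) → h)
    ; ⁻¹-cong = λ {(u , w , h)} {(u′ , w′ , h′)} u≈u′ →
        trans (sym (*-identityʳ w)) (trans (*-congˡ (sym h′)) (trans (sym (*-assoc w u′ w′))
        (trans (*-congʳ (trans (*-congˡ (sym u≈u′)) (trans (*-comm w u) h))) (*-identityˡ w′))))
    }
  }
  where
  open CommutativeRing R hiding (refl)
  open CommutativeSemigroupProperties *-commutativeSemigroup using (interchange)

-- Linear extension R[G] → S of a map G → S, along φ : R → S.
evaluate : (R : CommutativeRing a ℓa) (S : CommutativeRing b ℓb) → R ⟶ʳ S → (G : Group c ℓc) →
           (Group.Carrier G → CommutativeRing.Carrier S) → FreeTerm R (Group.setoid G) → CommutativeRing.Carrier S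
evaluate R S φ G f = go
  where
  open CommutativeRing S
  go : FreeTerm R (Group.setoid G) → Carrier
  go [ g ]   = f g
  go 𝟘       = 0#
  go (t ⊕ u) = go t + go u
  go (⊖ t)   = - go t
  go (r ⊙ t) = RingHomomorphism.⟦_⟧ φ r * go t

-- The automorphisms σᵢ : ζ ↦ ζⁱ for i prime to p; they are determined by
-- this property, since ζ generates the field.
record PowerAutomorphisms {p : ℕ} {F : HeytingField a b d} (L : Cyclotomic F p c ℓ₁ ℓ₂) : Set (a ⊔ c ⊔ ℓ₁) where
  open Cyclotomic L
  open Galois extension
  field
    σ   : ∀ i → ¬ (p ℕ.∣ i) → Auto
    σ-ζ : ∀ i p∤i → Auto.apply (σ i p∤i) ζ ≈ ζ ^ i

below : ∀ p (i : Fin (p ℕ.∸ 1)) → ¬ (p ℕ.∣ suc (toℕ i))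
below (suc n) i = ℕ.>⇒∤ (s≤s (Fin.toℕ<n i))

pred-prime : ∀ {p} → Prime p → ¬ (p ℕ.∣ p ℕ.∸ 1)
pred-prime {zero}        p-prime = contradiction p-prime ℕ.¬prime[0]
pred-prime {suc zero}    p-prime = contradiction p-prime ℕ.¬prime[1]
pred-prime {suc (suc n)} p-prime = ℕ.>⇒∤ (ℕ.n<1+n (suc n))

module CyclotomicGraph (p : ℕ) (L : Cyclotomic ℚ.heytingField p a ℓa b) (S : PowerAutomorphisms L) where
  open Cyclotomic L using (extension)
  open PowerAutomorphisms S

  Δ : Group (a ⊔ ℓa) (a ⊔ ℓa)
  Δ = Galois.Gal extension

  open Group Δ using (_⁻¹)

  -- σ[ i ] is the automorphism ζ ↦ ζ^{i+1}.
  σ[_] : Fin (p ℕ.∸ 1) → Group.Carrier Δ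
  σ[ i ] = σ (suc (toℕ i)) (below p i)

  sumᴳ : (R : CommutativeRing c ℓc) → Vector (FreeTerm R (Group.setoid Δ)) (p ℕ.∸ 1) → FreeTerm R (Group.setoid Δ)
  sumᴳ R = SumProperties.sum (LeftModule.+ᴹ-commutativeMonoid (R [ Δ ]ᴳ))

  pθ : FreeTerm ℤ-ring (Group.setoid Δ)
  pθ = ⊖ sumᴳ ℤ-ring (λ i → + suc (toℕ i) ⊙ [ σ[ i ] ⁻¹ ])

  σ₁ : Prime p → Group.Carrier Δ
  σ₁ p-prime = σ 1 (λ p∣1 → ℕ.¬prime[1] (≡.subst Prime (ℕ.∣1⇒≡1 p∣1) p-prime))

  -- σ₋₁ = σ_{p-1}
  j : Prime p → Group.Carrier Δ
  j p-prime = σ (p ℕ.∸ 1) (pred-prime p-prime)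

  X : Digraph 0ℓ 0ℓ 0ℓ 0ℓ
  X = bouquet (p ℕ.∸ 1)

  module _ (p-prime : Prime p) where

    α : Func (Digraph.E X) (Group.setoid Δ)
    α = record { to = voltage ; cong = λ { {k} refl → Group.refl Δ {voltage k} } }
      where
      voltage : Loop (p ℕ.∸ 1) → Group.Carrier Δ
      voltage e₀      = σ₁ p-prime
      voltage (e i k) = σ[ i ] ⁻¹

    Y : Digraph (a ⊔ ℓa) (a ⊔ ℓa) (a ⊔ ℓa) (a ⊔ ℓa)
    Y = Derived.derived X Δ α

    BF-Y : GModule ℤ-ring Δ (a ⊔ ℓa) (a ⊔ ℓa)
    BF-Y = Derived.BF X Δ α

module Setting
  (p ℓ : ℕ) (p-prime : Prime p) (ℓ-prime : Prime ℓ) (ℓ∤p-1 : ¬ (ℓ ℕ.∣ p ℕ.∸ 1))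
  (L : Cyclotomic ℚ.heytingField p a ℓa b) (S : PowerAutomorphisms L)
  (Qℓ : FractionField (ℤ-adicRing ℓ) c ℓc d)
  {e₁ e₂ e₃ : Level} (K : Cyclotomic (FractionField.Frac Qℓ) (p ℕ.∸ 1) e₁ e₂ e₃)
  (V : ℓ-adicValuation Qℓ K)
  where

  open CyclotomicGraph p L S public

  𝒪 : CommutativeRing (e₁ ⊔ e₃) e₂
  𝒪 = ValuationRing.𝒪 (ℓ-adicValuation.valuation V)

  ℤℓ→𝒪 : ℤ-adicRing ℓ ⟶ʳ 𝒪
  ℤℓ→𝒪 = ℤ-adic→𝒪 Qℓ K V

  BF-𝒪 : GModule 𝒪 Δ (a ⊔ ℓa ⊔ e₁ ⊔ e₃) (a ⊔ ℓa ⊔ e₁ ⊔ e₂ ⊔ e₃)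
  BF-𝒪 = tensorᴳ (ℤ-adicRing ℓ) 𝒪 ℤℓ→𝒪 (tensorᴳ ℤ-ring (ℤ-adicRing ℓ) (ℤ→ℤ-adic ℓ) (BF-Y p-prime))

  Character : Set (a ⊔ ℓa ⊔ e₁ ⊔ e₂ ⊔ e₃)
  Character = GroupHomomorphism (Group.rawGroup Δ) (Group.rawGroup (units 𝒪))

  module _ (ψ : Character) where
    private
      module 𝒪 = CommutativeRing 𝒪

    ψ⟨_⟩ : Group.Carrier Δ → 𝒪.Carrier
    ψ⟨ τ ⟩ = proj₁ (GroupHomomorphism.⟦_⟧ ψ τ)

    Even : Set e₂
    Even = ψ⟨ j p-prime ⟩ 𝒪.≈ 𝒪.1#

    Nontrivial : Set (a ⊔ ℓa ⊔ e₂)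
    Nontrivial = ¬ (∀ τ → ψ⟨ τ ⟩ 𝒪.≈ 𝒪.1#)

    ψ⟨pθ⟩ : 𝒪.Carrier
    ψ⟨pθ⟩ = evaluate ℤ-ring 𝒪 (_∘ʳ_ {R = ℤ-ring} {S = ℤ-adicRing ℓ} {T = 𝒪} ℤℓ→𝒪 (ℤ→ℤ-adic ℓ)) Δ ψ⟨_⟩ pθ

    1/p-1 : 𝒪.Carrier
    1/p-1 = RingHomomorphism.⟦_⟧ ℤℓ→𝒪 (proj₁ (inverse ℓ ℓ-prime ℓ∤p-1))

    -- Every element of Δ is exactly one of σ₁, …, σ_{p-1}.
    idempotent : FreeTerm 𝒪 (Group.setoid Δ)
    idempotent = 1/p-1 ⊙ sumᴳ 𝒪 (λ i → ψ⟨ σ[ i ] ⟩ ⊙ [ Group._⁻¹ Δ σ[ i ] ])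

    component : Mod 𝒪 (a ⊔ ℓa ⊔ e₁ ⊔ e₂ ⊔ e₃) (a ⊔ ℓa ⊔ e₁ ⊔ e₂ ⊔ e₃)
    component = image (GModule.multiplication BF-𝒪 idempotent)

-- The Δ-equivariant evaluation [σ] ↦ ψ(σ) sends (I − 𝒜)[σ] to (1 − Σ_e ψ(α(e))) ψ(σ) = ψ(pθ) ψ(σ), because α(e₀) = 1
-- and σᵢ⁻¹ is the voltage of exactly i loops. Hence it induces Φ : BF_𝒪 → 𝒪/ψ(pθ)𝒪. Conversely ψ(pθ) kills
-- w = e_ψ (1 ⊗ 1 ⊗ [1]), so c ↦ c w defines Ψ in the other direction; Φ ∘ Ψ = id and e_ψ = Ψ ∘ Φ, so Φ restricts to an
-- isomorphism on the image of e_ψ. If ψ is even and nontrivial, pairing σᵢ with σ_{p−i} gives 2 ψ(pθ) = − p Σ ψ(σᵢ⁻¹) = 0,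
-- and 2 is invertible because it divides p − 1.
module Submission where

open import Level using (Level; 0ℓ; _⊔_)
open import Algebra.Apartness.Bundles using (HeytingField)
open import Algebra.Bundles using (CommutativeMonoid; CommutativeRing; Group)
open import Algebra.Module.Bundles using (LeftModule)
open import Algebra.Morphism.Bundles using (GroupHomomorphism; RingHomomorphism)
import Algebra.Apartness.Properties.HeytingCommutativeRing as HCR
import Algebra.Module.Morphism.Construct.Composition as ModuleComposition
import Algebra.Properties.AbelianGroup as AbelianGroupProperties
import Algebra.Properties.CommutativeMonoid.Sum as SumProperties
import Algebra.Properties.CommutativeSemiring.Exp as Exp
import Algebra.Properties.Group as GroupProperties
import Algebra.Properties.Monoid.Mult as Mult
import Algebra.Properties.Ring as RingProperties
import Algebra.Properties.Semiring.Sum as SemiringSum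
open import Data.Fin.Base using (Fin; zero; suc; toℕ; opposite; _↑ˡ_; _↑ʳ_)
open import Data.Fin.Permutation using (Permutation; permutation; reverse; _⟨$⟩ʳ_)
import Data.Fin.Properties as Fin
open import Data.Integer.Base using (+_)
open import Data.Nat.Base as ℕ using (ℕ; zero; suc; s≤s; z≤n; _∸_)
open import Data.Nat.Divisibility using (_∣_)
import Data.Nat.Divisibility as ℕ
open import Data.Nat.Primality using (Prime)
import Data.Nat.Primality as ℕ
import Data.Nat.Properties as ℕ
open import Data.Product.Base using (Σ; ∃; _×_; _,_; proj₁; proj₂; uncurry)
import Data.Rational.Base as ℚ
import Data.Rational.Properties as ℚ
open import Data.Rational.Properties using () renaming (heytingField to ℚ-field)
open import Data.Sum.Base using (_⊎_; inj₁; inj₂)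
open import Data.Unit.Base using (tt)
open import Data.Vec.Functional using (Vector)
open import Function.Base using (_∘_; id)
open import Function.Bundles using (Func)
open import Relation.Binary.Bundles using (Setoid)
open import Relation.Binary.Definitions using (tri<; tri≈; tri>)
open import Relation.Binary.PropositionalEquality as ≡ using (_≡_; _≢_)
import Relation.Binary.Reasoning.Setoid as ≈-Reasoning
open import Relation.Nullary using (¬_; yes; no; contradiction)
open import Defs

-- The delicate point is the sum defining e_ψ. It runs over the listed σ₁, ..., σ_{p-1}, while the
-- rule e_ψ g = ψ(g) e_ψ needs translation by an arbitrary automorphism to permute that list. So
-- every automorphism must be shown to be some σᵢ, that is, every p-th root of unity in ℚ(ζₚ) must
-- be found among the powers of ζₚ, in a field whose equality is not decidable. Cotransitivity of
-- apartness singles out one candidate exponent, and geometric sums, together with the invertibility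
-- of p in characteristic zero, show that it is the right one. The same obstacle returns for Σ
-- ψ(σᵢ⁻¹) = 0, where nontriviality is only the negation of ψ being constantly 1. Both directions
-- between BF_𝒪 and the quotient rest on one computation, `K-I-𝒜`: for the evaluation on the free
-- module it yields descent to the cokernel, and for multiplication by e_ψ it yields ψ(pθ) w = 0.
-- Since BF_𝒪 is a cokernel tensored twice, maps on it are compared through universal properties,
-- down to the generators [v, τ].

private
  variable
    a b c d ℓa ℓb ℓc ℓd ℓ₁ ℓ₂ : Level

-- Linear maps, cokernels, free modules and change of rings.

module _ {R : CommutativeRing a ℓa} where
  infixr 9 _∘ˡ_
  _∘ˡ_ : {M : Mod R b ℓb} {N : Mod R c ℓc} {P : Mod R d ℓd} →
         LinearMap R N P → LinearMap R M N → LinearMap R M P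
  _∘ˡ_ {P = P} g f = record
    { isLinear = ModuleComposition.isLeftModuleHomomorphism (LeftModule.≈ᴹ-trans P)
        (LinearMap.isLinear f) (LinearMap.isLinear g)
    }

module _ (R : CommutativeRing a ℓa) (M : Mod R b ℓb) where
  open LeftModule M

  *ₗ-comm : ∀ r s x → r *ₗ (s *ₗ x) ≈ᴹ s *ₗ (r *ₗ x)
  *ₗ-comm r s x = ≈ᴹ-trans (≈ᴹ-sym (*ₗ-assoc r s x))
    (≈ᴹ-trans (*ₗ-congʳ (CommutativeRing.*-comm R r s)) (*ₗ-assoc s r x))

  -‿*ₗ : ∀ r x → (CommutativeRing.-_ R r) *ₗ x ≈ᴹ -ᴹ (r *ₗ x)
  -‿*ₗ r x = GroupProperties.inverseʳ-unique +ᴹ-group (r *ₗ x) _ (≈ᴹ-trans (≈ᴹ-sym (*ₗ-distribʳ x r _))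
    (≈ᴹ-trans (*ₗ-congʳ (CommutativeRing.-‿inverseʳ R r)) (*ₗ-zeroˡ x)))

  scale : CommutativeRing.Carrier R → LinearMap R M M
  scale s = linear R M M (s *ₗ_) *ₗ-congˡ (*ₗ-distribˡ s) (*ₗ-comm s)

  zero-map : (N : Mod R c ℓc) → LinearMap R N M
  zero-map N = linear R N M (λ _ → 0ᴹ) (λ _ → ≈ᴹ-refl) (λ _ _ → ≈ᴹ-sym (+ᴹ-identityˡ 0ᴹ))
    (λ r _ → ≈ᴹ-sym (*ₗ-zeroʳ r))

  sumᴹ : ∀ {n} → Vector Carrierᴹ n → Carrierᴹ
  sumᴹ = SumProperties.sum +ᴹ-commutativeMonoid

  *ₗ-distribʳ-sum : ∀ {n} (v : Vector (CommutativeRing.Carrier R) n) x →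
                    SemiringSum.sum (CommutativeRing.semiring R) v *ₗ x ≈ᴹ sumᴹ (λ k → v k *ₗ x)
  *ₗ-distribʳ-sum {zero}  v x = *ₗ-zeroˡ x
  *ₗ-distribʳ-sum {suc n} v x = ≈ᴹ-trans (*ₗ-distribʳ x _ _) (+ᴹ-congˡ (*ₗ-distribʳ-sum (v ∘ suc) x))

module _ {R : CommutativeRing a ℓa} where
  sumᴹ-homo : {M : Mod R b ℓb} {N : Mod R c ℓc} (f : LinearMap R M N) {n : ℕ} (v : Vector (LeftModule.Carrierᴹ M) n) →
              LeftModule._≈ᴹ_ N (LinearMap.⟦_⟧ f (sumᴹ R M v)) (sumᴹ R N (LinearMap.⟦_⟧ f ∘ v))
  sumᴹ-homo {N = N} f {zero}  v = LinearMap.0ᴹ-homo f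
  sumᴹ-homo {N = N} f {suc n} v = ≈ᴹ-trans (LinearMap.+ᴹ-homo f _ _) (+ᴹ-congˡ (sumᴹ-homo f (v ∘ suc)))
    where open LeftModule N

  module _ {M : Mod R b ℓb} {N : Mod R c ℓc} (f : LinearMap R M N) where
    open LeftModule N
    private
      module f = LinearMap f

    ≈⇒CokerEq : ∀ {x y} → x ≈ᴹ y → CokerEq f x y
    ≈⇒CokerEq x≈y = by (≈ᴹ-trans (GroupProperties.x≈y⇒x∙y⁻¹≈ε +ᴹ-group x≈y) (≈ᴹ-sym f.0ᴹ-homo))

    projection : LinearMap R N (coker f)
    projection = linear R N (coker f) (λ x → x) ≈⇒CokerEq (λ _ _ → ≈⇒CokerEq ≈ᴹ-refl) (λ _ _ → ≈⇒CokerEq ≈ᴹ-refl)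

    coker-lift : {P : Mod R d ℓd} (g : LinearMap R N P) →
                 (∀ x → LeftModule._≈ᴹ_ P (LinearMap.⟦_⟧ g (f.⟦_⟧ x)) (LeftModule.0ᴹ P)) → LinearMap R (coker f) P
    coker-lift {P = P} g g∘f≈0 = linear R (coker f) P g.⟦_⟧ respects g.+ᴹ-homo g.*ₗ-homo
      where
      module g = LinearMap g
      module P = LeftModule P
      respects : ∀ {x y} → CokerEq f x y → g.⟦_⟧ x P.≈ᴹ g.⟦_⟧ y
      respects {x} {y} (by {preimage = z} h) = GroupProperties.x∙y⁻¹≈ε⇒x≈y P.+ᴹ-group _ _
        (P.≈ᴹ-trans (P.+ᴹ-congˡ (P.≈ᴹ-sym (g.-ᴹ-homo y)))
        (P.≈ᴹ-trans (P.≈ᴹ-sym (g.+ᴹ-homo x (-ᴹ y))) (P.≈ᴹ-trans (g.⟦⟧-cong h) (g∘f≈0 z))))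

  module _ {X : Setoid b ℓb} (P : Mod R c ℓc) (f g : LinearMap R (Free R X) P) where
    open LeftModule P
    private
      module f = LinearMap f
      module g = LinearMap g

    free-ext : (∀ x → f.⟦_⟧ [ x ] ≈ᴹ g.⟦_⟧ [ x ]) → ∀ t → f.⟦_⟧ t ≈ᴹ g.⟦_⟧ t
    free-ext f≈g [ x ]   = f≈g x
    free-ext f≈g 𝟘       = ≈ᴹ-trans f.0ᴹ-homo (≈ᴹ-sym g.0ᴹ-homo)
    free-ext f≈g (t ⊕ u) = ≈ᴹ-trans (f.+ᴹ-homo t u)
      (≈ᴹ-trans (+ᴹ-cong (free-ext f≈g t) (free-ext f≈g u)) (≈ᴹ-sym (g.+ᴹ-homo t u)))
    free-ext f≈g (⊖ t)   = ≈ᴹ-trans (f.-ᴹ-homo t) (≈ᴹ-trans (-ᴹ‿cong (free-ext f≈g t)) (≈ᴹ-sym (g.-ᴹ-homo t)))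
    free-ext f≈g (r ⊙ t) = ≈ᴹ-trans (f.*ₗ-homo r t) (≈ᴹ-trans (*ₗ-congˡ (free-ext f≈g t)) (≈ᴹ-sym (g.*ₗ-homo r t)))

  module _ {M : Mod R b ℓb} {P : Mod R c ℓc} (h : LinearMap R M M) (Φ : LinearMap R M P) (Ψ : LinearMap R P M) where
    private
      module M = LeftModule M
      module P = LeftModule P
      module h = LinearMap h
      module Φ = LinearMap Φ
      module Ψ = LinearMap Ψ

    -- Together the two hypotheses make `Ψ ∘ Φ` the identity on the image of `h`: for
    -- `y = h x = Ψ (Φ x)`, applying `Ψ ∘ Φ` again collapses the middle `Φ ∘ Ψ`. Hence `Φ` is
    -- injective there.
    split-image : (∀ x → h.⟦_⟧ x M.≈ᴹ Ψ.⟦_⟧ (Φ.⟦_⟧ x)) → (∀ y → Φ.⟦_⟧ (Ψ.⟦_⟧ y) P.≈ᴹ y) → _≅_ R (image h) P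
    split-image h≈ΨΦ ΦΨ≈id = Φ.⟦_⟧ ∘ proj₁ , record
      { isLeftModuleMonomorphism = record
        { isLeftModuleHomomorphism = LinearMap.isLinear (linear R (image h) P (Φ.⟦_⟧ ∘ proj₁) Φ.⟦⟧-cong
            (λ _ _ → Φ.+ᴹ-homo _ _) (λ r _ → Φ.*ₗ-homo r _))
        ; injective = λ {(y , x , y≈hx)} {(y′ , x′ , y′≈hx′)} Φy≈Φy′ →
            M.≈ᴹ-trans (ΨΦ y≈hx) (M.≈ᴹ-trans (Ψ.⟦⟧-cong Φy≈Φy′) (M.≈ᴹ-sym (ΨΦ y′≈hx′)))
        }
      ; surjective = λ y → (h.⟦_⟧ (Ψ.⟦_⟧ y) , Ψ.⟦_⟧ y , M.≈ᴹ-refl) , λ z≈ →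
          P.≈ᴹ-trans (Φ.⟦⟧-cong z≈) (P.≈ᴹ-trans (Φ.⟦⟧-cong (h≈ΨΦ (Ψ.⟦_⟧ y))) (P.≈ᴹ-trans (ΦΨ≈id _) (ΦΨ≈id y)))
      }
      where
      ΨΦ : ∀ {y x} → y M.≈ᴹ h.⟦_⟧ x → y M.≈ᴹ Ψ.⟦_⟧ (Φ.⟦_⟧ y)
      ΨΦ {y} {x} y≈hx = M.≈ᴹ-trans y≈ΨΦx
        (Ψ.⟦⟧-cong (P.≈ᴹ-sym (P.≈ᴹ-trans (Φ.⟦⟧-cong y≈ΨΦx) (ΦΨ≈id (Φ.⟦_⟧ x)))))
        where y≈ΨΦx = M.≈ᴹ-trans y≈hx (h≈ΨΦ x)

module _ (R : CommutativeRing a ℓa) (S : CommutativeRing b ℓb) (φ : R ⟶ʳ S) where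
  private
    module R = CommutativeRing R
    module S = CommutativeRing S
    module φ = RingHomomorphism φ

  -- Restriction of scalars, the right adjoint of `tensor`; `unit` and `tensor-lift` are its two
  -- halves. Through them a map out of the twice-tensored BF is handled as a ℤ-linear map.
  restrict : Mod S c ℓc → Mod R c ℓc
  restrict N = record
    { Carrierᴹ = Carrierᴹ
    ; _≈ᴹ_ = _≈ᴹ_
    ; _+ᴹ_ = _+ᴹ_
    ; _*ₗ_ = λ r x → φ.⟦_⟧ r *ₗ x
    ; 0ᴹ = 0ᴹ
    ; -ᴹ_ = -ᴹ_
    ; isLeftModule = record
      { isLeftSemimodule = record
        { +ᴹ-isCommutativeMonoid = +ᴹ-isCommutativeMonoid
        ; isPreleftSemimodule = record
          { *ₗ-cong = λ r≈s x≈y → *ₗ-cong (φ.⟦⟧-cong r≈s) x≈y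
          ; *ₗ-zeroˡ = λ x → ≈ᴹ-trans (*ₗ-congʳ φ.0#-homo) (*ₗ-zeroˡ x)
          ; *ₗ-distribʳ = λ x r s → ≈ᴹ-trans (*ₗ-congʳ (φ.+-homo r s)) (*ₗ-distribʳ x _ _)
          ; *ₗ-identityˡ = λ x → ≈ᴹ-trans (*ₗ-congʳ φ.1#-homo) (*ₗ-identityˡ x)
          ; *ₗ-assoc = λ r s x → ≈ᴹ-trans (*ₗ-congʳ (φ.*-homo r s)) (*ₗ-assoc _ _ x)
          ; *ₗ-zeroʳ = λ r → *ₗ-zeroʳ _
          ; *ₗ-distribˡ = λ r → *ₗ-distribˡ _
          }
        }
      ; -ᴹ‿cong = -ᴹ‿cong
      ; -ᴹ‿inverse = -ᴹ‿inverse
      }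
    }
    where open LeftModule N

  restrict-map : {M : Mod S c ℓc} {N : Mod S d ℓd} → LinearMap S M N → LinearMap R (restrict M) (restrict N)
  restrict-map {M = M} {N = N} f = linear R (restrict M) (restrict N) f.⟦_⟧ f.⟦⟧-cong f.+ᴹ-homo (λ r → f.*ₗ-homo (φ.⟦_⟧ r))
    where module f = LinearMap f

  module _ {M : Mod R c ℓc} where
    private
      module M = LeftModule M

    unit : LinearMap R M (restrict (tensor R S φ M))
    unit = linear R M (restrict (tensor R S φ M)) (S.1# ⊗_) (⊗-cong S.refl) (⊗-distribˡ S.1#)
      (λ r x → ≃-trans (≃-sym (⊗-balanced S.1# r x)) (⊗-cong (S.*-comm S.1# (φ.⟦_⟧ r)) M.≈ᴹ-refl))

    module _ (N : Mod S d ℓd) where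
      open LeftModule N

      tensor-ext : (f g : LinearMap S (tensor R S φ M) N) →
                   (∀ m → LinearMap.⟦_⟧ f (S.1# ⊗ m) ≈ᴹ LinearMap.⟦_⟧ g (S.1# ⊗ m)) →
                   ∀ t → LinearMap.⟦_⟧ f t ≈ᴹ LinearMap.⟦_⟧ g t
      tensor-ext f g f≈g = go
        where
        module f = LinearMap f
        module g = LinearMap g
        go : ∀ t → f.⟦_⟧ t ≈ᴹ g.⟦_⟧ t
        go (s ⊗ m) = ≈ᴹ-trans (f.⟦⟧-cong s⊗m) (≈ᴹ-trans (f.*ₗ-homo s _)
          (≈ᴹ-trans (*ₗ-congˡ (f≈g m)) (≈ᴹ-trans (≈ᴹ-sym (g.*ₗ-homo s _)) (≈ᴹ-sym (g.⟦⟧-cong s⊗m)))))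
          where s⊗m = ⊗-cong (S.sym (S.*-identityʳ s)) M.≈ᴹ-refl
        go 𝕆       = ≈ᴹ-trans f.0ᴹ-homo (≈ᴹ-sym g.0ᴹ-homo)
        go (t ⊞ u) = ≈ᴹ-trans (f.+ᴹ-homo t u) (≈ᴹ-trans (+ᴹ-cong (go t) (go u)) (≈ᴹ-sym (g.+ᴹ-homo t u)))
        go (⊟ t)   = ≈ᴹ-trans (f.-ᴹ-homo t) (≈ᴹ-trans (-ᴹ‿cong (go t)) (≈ᴹ-sym (g.-ᴹ-homo t)))

      tensor-lift : LinearMap R M (restrict N) → LinearMap S (tensor R S φ M) N
      tensor-lift f = linear S (tensor R S φ M) N go respects (λ _ _ → ≈ᴹ-refl) go-*
        where
        module f = LinearMap f
        go : Tensor R S φ M → Carrierᴹ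
        go (s ⊗ m) = s *ₗ f.⟦_⟧ m
        go 𝕆       = 0ᴹ
        go (t ⊞ u) = go t +ᴹ go u
        go (⊟ t)   = -ᴹ go t
        respects : ∀ {t u} → _≃_ R S φ M t u → go t ≈ᴹ go u
        respects (⊗-cong s≈s′ m≈m′) = *ₗ-cong s≈s′ (f.⟦⟧-cong m≈m′)
        respects (⊗-distribˡ s m m′) = ≈ᴹ-trans (*ₗ-congˡ (f.+ᴹ-homo m m′)) (*ₗ-distribˡ s _ _)
        respects (⊗-distribʳ m s s′) = *ₗ-distribʳ _ s s′
        respects (⊗-balanced s r m) = ≈ᴹ-trans (*ₗ-assoc s _ _) (*ₗ-congˡ (≈ᴹ-sym (f.*ₗ-homo r m)))
        respects ≃-refl = ≈ᴹ-refl
        respects (≃-sym h) = ≈ᴹ-sym (respects h)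
        respects (≃-trans h h′) = ≈ᴹ-trans (respects h) (respects h′)
        respects (⊞-cong h h′) = +ᴹ-cong (respects h) (respects h′)
        respects (⊞-assoc t u w) = +ᴹ-assoc _ _ _
        respects (⊞-comm t u) = +ᴹ-comm _ _
        respects (⊞-identity t) = +ᴹ-identityˡ _
        respects (⊟-cong h) = -ᴹ‿cong (respects h)
        respects (⊟-inverse t) = -ᴹ‿inverseˡ _
        go-* : ∀ s t → go (_⊡_ R S φ M s t) ≈ᴹ s *ₗ go t
        go-* s (s′ ⊗ m) = *ₗ-assoc s s′ _
        go-* s 𝕆       = ≈ᴹ-sym (*ₗ-zeroʳ s)
        go-* s (t ⊞ u) = ≈ᴹ-trans (+ᴹ-cong (go-* s t) (go-* s u)) (≈ᴹ-sym (*ₗ-distribˡ s _ _))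
        go-* s (⊟ t)   = ≈ᴹ-trans (-ᴹ‿cong (go-* s t)) (≈ᴹ-sym (LinearMap.-ᴹ-homo (scale S N s) (go t)))

-- Cyclic quotients of a ring.

module _ (R : CommutativeRing a ℓa) (x : CommutativeRing.Carrier R) where
  open CommutativeRing R
  private
    module R/x = LeftModule (R /⟨ x ⟩)

  ≈⇒≈/ : ∀ {y z} → y ≈ z → y R/x.≈ᴹ z
  ≈⇒≈/ y≈z = by {preimage = 0#} (trans (GroupProperties.x≈y⇒x∙y⁻¹≈ε +-group y≈z) (sym (zeroʳ x)))

  x*y≈/0 : ∀ y → x * y R/x.≈ᴹ 0#
  x*y≈/0 y = by {preimage = y} (trans (+-congˡ (RingProperties.-0#≈0# ring)) (+-identityʳ _))

  /-lift : (M : Mod R b ℓb) (w : LeftModule.Carrierᴹ M) →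
           LeftModule._≈ᴹ_ M (LeftModule._*ₗ_ M x w) (LeftModule.0ᴹ M) → LinearMap R (R /⟨ x ⟩) M
  /-lift M w x*w≈0 = linear R (R /⟨ x ⟩) M (_*ₗ w) respects (*ₗ-distribʳ w) (λ r s → *ₗ-assoc r s w)
    where
    open LeftModule M
    respects : ∀ {y z} → y R/x.≈ᴹ z → y *ₗ w ≈ᴹ z *ₗ w
    respects {y} {z} (by {preimage = t} y-z≈xt) = GroupProperties.x∙y⁻¹≈ε⇒x≈y +ᴹ-group _ _
      (≈ᴹ-trans (+ᴹ-congˡ (≈ᴹ-sym (-‿*ₗ R M z w))) (≈ᴹ-trans (≈ᴹ-sym (*ₗ-distribʳ w y (- z)))
      (≈ᴹ-trans (*ₗ-congʳ (trans y-z≈xt (*-comm x t))) (≈ᴹ-trans (*ₗ-assoc t x w)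
      (≈ᴹ-trans (*ₗ-congˡ x*w≈0) (*ₗ-zeroʳ t))))))

-- The ψ-component of BF over a voltage graph with one vertex.

module Isotypic
  (T : CommutativeRing b ℓb) (G : Group c ℓc)
  (ψ : GroupHomomorphism (Group.rawGroup G) (Group.rawGroup (units T)))
  {n : ℕ} (σ : Fin n → Group.Carrier G) (π : Group.Carrier G → Permutation n n)
  (σ-π : ∀ g i → Group._≈_ G (σ (π g ⟨$⟩ʳ i)) (Group._∙_ G (Group._⁻¹ G g) (σ i)))
  where

  private
    module T = CommutativeRing T
    module G = Group G
    module ψ = GroupHomomorphism ψ
    module ΣT = SemiringSum T.semiring

  ψ₁ : G.Carrier → T.Carrier
  ψ₁ g = proj₁ (ψ.⟦_⟧ g)

  ψ₁-inverse : ∀ g → ψ₁ g T.* ψ₁ (g G.⁻¹) T.≈ T.1#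
  ψ₁-inverse g = T.trans (T.sym (ψ.homo g (g G.⁻¹))) (T.trans (ψ.⟦⟧-cong (G.inverseʳ g)) ψ.ε-homo)

  σ-shift : ∀ g i → g G.∙ σ (π g ⟨$⟩ʳ i) G.≈ σ i
  σ-shift g i = G.trans (G.∙-congˡ (σ-π g i)) (GroupProperties.\\-leftDividesˡ G g (σ i))

  -- Sums over the `σ i ⁻¹` absorb a right factor `g` by reindexing along `π g`; both the
  -- equivariance of e_ψ and the vanishing of Σ ψ(σᵢ⁻¹) depend on this.
  σ⁻¹-shift : ∀ g i → σ (π g ⟨$⟩ʳ i) G.⁻¹ G.≈ σ i G.⁻¹ G.∙ g
  σ⁻¹-shift g i = G.trans (G.⁻¹-cong (σ-π g i)) (G.trans (GroupProperties.⁻¹-anti-homo-∙ G (g G.⁻¹) (σ i))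
    (G.∙-congˡ (GroupProperties.⁻¹-involutive G g)))

  unnormalised : FreeTerm T G.setoid
  unnormalised = sumᴹ T (T [ G ]ᴳ) (λ i → ψ₁ (σ i) ⊙ [ σ i G.⁻¹ ])

  e-ψ : T.Carrier → FreeTerm T G.setoid
  e-ψ 1/n = 1/n ⊙ unnormalised

  module _ (M : GModule T G d ℓd) where
    open GModule M
    private
      module ΣM = SumProperties +ᴹ-commutativeMonoid

    sum-· : ∀ {m} (t : Vector (FreeTerm T G.setoid) m) x → sumᴹ T (T [ G ]ᴳ) t · x ≡ ΣM.sum (λ k → t k · x)
    sum-· {zero}  t x = ≡.refl
    sum-· {suc m} t x = ≡.cong (t zero · x +ᴹ_) (sum-· (t ∘ suc) x)

    summand : Carrierᴹ → Fin n → Carrierᴹ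
    summand x i = ψ₁ (σ i) *ₗ σ i G.⁻¹ ∙ x

    unnormalised-· : ∀ x → unnormalised · x ≡ ΣM.sum (summand x)
    unnormalised-· = sum-· (λ i → ψ₁ (σ i) ⊙ [ σ i G.⁻¹ ])

    -- With i′ the index `π g` assigns to i, σᵢ = g σᵢ′, so ψ(σᵢ) = ψ(g) ψ(σᵢ′) and σᵢ⁻¹ g = σᵢ′⁻¹.
    -- The i-th summand at g x is therefore ψ(g) times the i′-th at x, and i ↦ i′ is a permutation.
    unnormalised-∙ : ∀ g x → unnormalised · (g ∙ x) ≈ᴹ ψ₁ g *ₗ unnormalised · x
    unnormalised-∙ g x = begin
      unnormalised · (g ∙ x)                                ≡⟨ unnormalised-· (g ∙ x) ⟩
      ΣM.sum (summand (g ∙ x))                              ≈⟨ ΣM.sum-cong-≋ shift ⟩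
      ΣM.sum (λ i → ψ₁ g *ₗ summand x (π g ⟨$⟩ʳ i))
        ≈⟨ sumᴹ-homo (scale T underlying (ψ₁ g)) (summand x ∘ (π g ⟨$⟩ʳ_)) ⟨
      ψ₁ g *ₗ ΣM.sum (summand x ∘ (π g ⟨$⟩ʳ_))               ≈⟨ *ₗ-congˡ (ΣM.sum-permute (summand x) (π g)) ⟨
      ψ₁ g *ₗ ΣM.sum (summand x)                            ≡⟨ ≡.cong (ψ₁ g *ₗ_) (unnormalised-· x) ⟨
      ψ₁ g *ₗ unnormalised · x                              ∎
      where
      open ≈-Reasoning ≈ᴹ-setoid
      shift : ∀ i → summand (g ∙ x) i ≈ᴹ ψ₁ g *ₗ summand x (π g ⟨$⟩ʳ i)
      shift i = begin
        ψ₁ (σ i) *ₗ σ i G.⁻¹ ∙ (g ∙ x)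
          ≈⟨ *ₗ-cong (T.trans (ψ.⟦⟧-cong (G.sym (σ-shift g i))) (ψ.homo g _))
               (≈ᴹ-trans (≈ᴹ-sym (∙-assoc _ g x)) (∙-cong (G.sym (σ⁻¹-shift g i)) ≈ᴹ-refl)) ⟩
        (ψ₁ g T.* ψ₁ (σ (π g ⟨$⟩ʳ i))) *ₗ σ (π g ⟨$⟩ʳ i) G.⁻¹ ∙ x
          ≈⟨ *ₗ-assoc _ _ _ ⟩
        ψ₁ g *ₗ summand x (π g ⟨$⟩ʳ i) ∎

    e-ψ-∙ : ∀ 1/n g x → e-ψ 1/n · (g ∙ x) ≈ᴹ ψ₁ g *ₗ e-ψ 1/n · x
    e-ψ-∙ 1/n g x = ≈ᴹ-trans (*ₗ-congˡ (unnormalised-∙ g x)) (*ₗ-comm T underlying 1/n (ψ₁ g) _)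

    module _ {1/n : T.Carrier} (1/n*n≈1 : 1/n T.* ΣT.sum {n} (λ _ → T.1#) T.≈ T.1#)
             {ℓd′ d′} {P : Mod T d′ ℓd′} (f : LinearMap T underlying P) (x : Carrierᴹ) where
      open LinearMap f
      private
        module P = LeftModule P
        module ΣP = SumProperties P.+ᴹ-commutativeMonoid

      -- The i-th summand contributes ψ(σᵢ) ψ(σᵢ⁻¹) = 1 times the value at `x`, so `1/n` averages n
      -- equal terms. Applied to the evaluation map, this says that `w` goes to 1.
      e-ψ-eigenvector : (∀ g → ⟦_⟧ (g ∙ x) P.≈ᴹ ψ₁ g P.*ₗ ⟦_⟧ x) → ⟦_⟧ (e-ψ 1/n · x) P.≈ᴹ ⟦_⟧ x
      e-ψ-eigenvector h = begin
        ⟦_⟧ (1/n *ₗ unnormalised · x)                        ≈⟨ *ₗ-homo 1/n _ ⟩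
        1/n P.*ₗ ⟦_⟧ (unnormalised · x)                      ≡⟨ ≡.cong (λ y → 1/n P.*ₗ ⟦_⟧ y) (unnormalised-· x) ⟩
        1/n P.*ₗ ⟦_⟧ (ΣM.sum (summand x))                    ≈⟨ P.*ₗ-congˡ (sumᴹ-homo f (summand x)) ⟩
        1/n P.*ₗ ΣP.sum (⟦_⟧ ∘ summand x)                    ≈⟨ P.*ₗ-congˡ (ΣP.sum-cong-≋ collapse) ⟩
        1/n P.*ₗ ΣP.sum {n} (λ _ → T.1# P.*ₗ ⟦_⟧ x)          ≈⟨ P.*ₗ-congˡ (*ₗ-distribʳ-sum T P {n} (λ _ → T.1#) (⟦_⟧ x)) ⟨
        1/n P.*ₗ (ΣT.sum {n} (λ _ → T.1#) P.*ₗ ⟦_⟧ x)        ≈⟨ P.*ₗ-assoc 1/n _ _ ⟨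
        (1/n T.* ΣT.sum {n} (λ _ → T.1#)) P.*ₗ ⟦_⟧ x         ≈⟨ P.*ₗ-congʳ 1/n*n≈1 ⟩
        T.1# P.*ₗ ⟦_⟧ x                                      ≈⟨ P.*ₗ-identityˡ _ ⟩
        ⟦_⟧ x                                               ∎
        where
        open ≈-Reasoning P.≈ᴹ-setoid
        collapse : ∀ i → ⟦_⟧ (summand x i) P.≈ᴹ T.1# P.*ₗ ⟦_⟧ x
        collapse i = begin
          ⟦_⟧ (ψ₁ (σ i) *ₗ σ i G.⁻¹ ∙ x)                     ≈⟨ *ₗ-homo (ψ₁ (σ i)) _ ⟩
          ψ₁ (σ i) P.*ₗ ⟦_⟧ (σ i G.⁻¹ ∙ x)                   ≈⟨ P.*ₗ-congˡ (h (σ i G.⁻¹)) ⟩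
          ψ₁ (σ i) P.*ₗ (ψ₁ (σ i G.⁻¹) P.*ₗ ⟦_⟧ x)           ≈⟨ P.*ₗ-assoc _ _ _ ⟨
          (ψ₁ (σ i) T.* ψ₁ (σ i G.⁻¹)) P.*ₗ ⟦_⟧ x            ≈⟨ P.*ₗ-congʳ (ψ₁-inverse (σ i)) ⟩
          T.1# P.*ₗ ⟦_⟧ x                                    ∎

  module _
    {a₁ a₂ a₃ a₄ d₁ d₂ : Level} (X : Digraph a₁ a₂ a₃ a₄) (α : Func (Digraph.E X) (Group.setoid G))
    (S : CommutativeRing d₁ d₂) (φ : ℤ-ring ⟶ʳ S) (χ : S ⟶ʳ T)
    (v₀ : Digraph.V.Carrier X) (v≈v₀ : ∀ v → Digraph.V._≈_ X v v₀)
    (1/n : T.Carrier) (1/n*n≈1 : 1/n T.* ΣT.sum {n} (λ _ → T.1#) T.≈ T.1#)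
    (a : T.Carrier) (a≈ : a T.≈ T.1# T.- ΣT.sum (λ k → ψ₁ (Func.to α (Digraph.out X v₀ k))))
    where

    private
      module X = Digraph X
      module S = CommutativeRing S
      module χ = RingHomomorphism χ

    open Derived X G α

    V×G : Setoid (a₁ ⊔ c) (a₂ ⊔ ℓc)
    V×G = Digraph.V derived

    module BF-T = GModule (tensorᴳ S T χ (tensorᴳ ℤ-ring S φ BF))

    T/a : Mod T _ _
    T/a = T /⟨ a ⟩

    -- Images of the basis of ℤ[V × G]; in the cokernel they generate but may satisfy relations.
    basis : X.V.Carrier → G.Carrier → BF-T.Carrierᴹ
    basis v τ = T.1# ⊗ (S.1# ⊗ [ v , τ ])

    I-𝒜 : LinearMap ℤ-ring (Free ℤ-ring V×G) (Free ℤ-ring V×G)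
    I-𝒜 = identity-minus (𝒜 derived)

    restrict² : Mod T d ℓd → Mod ℤ-ring d ℓd
    restrict² P = restrict ℤ-ring S φ (restrict S T χ P)

    module _ (P : Mod T d ℓd) where
      private
        module P = LeftModule P

      from-generators : LinearMap T BF-T.underlying P → LinearMap ℤ-ring (Free ℤ-ring V×G) (restrict² P)
      from-generators f = restrict-map ℤ-ring S φ (restrict-map S T χ f ∘ˡ unit S T χ)
                            ∘ˡ unit ℤ-ring S φ ∘ˡ projection I-𝒜

      -- Pure tensors 1 ⊗ m span each tensor product, the cokernel is a quotient of a free module,
      -- and every vertex equals `v₀`, so the classes of `[ v₀ , τ ]` generate over `T`.
      basis-ext : (f g : LinearMap T BF-T.underlying P) →
                  (∀ τ → LinearMap.⟦_⟧ f (basis v₀ τ) P.≈ᴹ LinearMap.⟦_⟧ g (basis v₀ τ)) →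
                  ∀ x → LinearMap.⟦_⟧ f x P.≈ᴹ LinearMap.⟦_⟧ g x
      basis-ext f g f≈g = tensor-ext S T χ P f g
        (tensor-ext ℤ-ring S φ (restrict S T χ P) (restrict-map S T χ f ∘ˡ unit S T χ) (restrict-map S T χ g ∘ˡ unit S T χ)
          (free-ext (restrict² P) (from-generators f) (from-generators g) generators))
        where
        [v,τ]≈[v₀,τ] : ∀ f v τ → LinearMap.⟦_⟧ (from-generators f) [ v , τ ] P.≈ᴹ LinearMap.⟦_⟧ f (basis v₀ τ)
        [v,τ]≈[v₀,τ] f v τ = LinearMap.⟦⟧-cong (from-generators f) ([]-cong (v≈v₀ v , G.refl))
        generators : ∀ x → LinearMap.⟦_⟧ (from-generators f) [ x ] P.≈ᴹ LinearMap.⟦_⟧ (from-generators g) [ x ]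
        generators (v , τ) = P.≈ᴹ-trans ([v,τ]≈[v₀,τ] f v τ) (P.≈ᴹ-trans (f≈g τ) (P.≈ᴹ-sym ([v,τ]≈[v₀,τ] g v τ)))

    module _ (P : Mod T d ℓd) (K : LinearMap ℤ-ring (Free ℤ-ring V×G) (restrict² P)) (w : LeftModule.Carrierᴹ P) where
      private
        module P = LeftModule P
        module ΣP = SumProperties P.+ᴹ-commutativeMonoid
        module K = LinearMap K

      -- The neighbours of `[ v₀ , τ ]` are translates by the voltages, and on each of them `K`
      -- gains a factor ψ(α(e)). Subtracting their sum leaves the factor 1 - Σ ψ(α(e)), which is
      -- `a`.
      K-I-𝒜 : (∀ v τ → K.⟦_⟧ [ v , τ ] P.≈ᴹ ψ₁ τ P.*ₗ w) →
                          ∀ v τ → K.⟦_⟧ (LinearMap.⟦_⟧ I-𝒜 [ v , τ ]) P.≈ᴹ a P.*ₗ (ψ₁ τ P.*ₗ w)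
      K-I-𝒜 h v τ = begin
        K.⟦_⟧ (LinearMap.⟦_⟧ I-𝒜 [ v , τ ])          ≈⟨ K.⟦⟧-cong [v]≈[v₀] ⟩
        K.⟦_⟧ ([ v₀ , τ ] ⊕ ⊖ neighbours)            ≈⟨ K.+ᴹ-homo [ v₀ , τ ] (⊖ neighbours) ⟩
        K.⟦_⟧ [ v₀ , τ ] P.+ᴹ K.⟦_⟧ (⊖ neighbours)   ≈⟨ P.+ᴹ-cong (h v₀ τ) K-neighbours ⟩
        u P.+ᴹ P.-ᴹ (s P.*ₗ u)                       ≈⟨ 1-s ⟩
        a P.*ₗ u                                     ∎
        where
        open ≈-Reasoning P.≈ᴹ-setoid
        u : P.Carrierᴹ
        u = ψ₁ τ P.*ₗ w
        αₖ : Fin (X.deg v₀) → G.Carrier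
        αₖ k = Func.to α (X.out v₀ k)
        s : T.Carrier
        s = ΣT.sum (ψ₁ ∘ αₖ)
        neighbour : Fin (X.deg v₀) → FreeTerm ℤ-ring V×G
        neighbour k = [ X.t⟨ X.out v₀ k ⟩ , τ G.∙ αₖ k ]
        neighbours : FreeTerm ℤ-ring V×G
        neighbours = sumᴹ ℤ-ring (Free ℤ-ring V×G) neighbour
        -- Passing to `v₀` first makes the neighbour sum run over the edge list in terms of which
        -- `a` is given.
        [v]≈[v₀] : _≋_ ℤ-ring V×G (LinearMap.⟦_⟧ I-𝒜 [ v , τ ]) ([ v₀ , τ ] ⊕ ⊖ neighbours)
        [v]≈[v₀] = LinearMap.⟦⟧-cong I-𝒜 {[ v , τ ]} {[ v₀ , τ ]} ([]-cong (v≈v₀ v , G.refl))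
        value : ∀ k → K.⟦_⟧ (neighbour k) P.≈ᴹ ψ₁ (αₖ k) P.*ₗ u
        value k = P.≈ᴹ-trans (h (X.t⟨ X.out v₀ k ⟩) (τ G.∙ αₖ k)) (P.≈ᴹ-trans
          (P.*ₗ-congʳ (T.trans (ψ.homo τ (αₖ k)) (T.*-comm (ψ₁ τ) (ψ₁ (αₖ k)))))
          (P.*ₗ-assoc (ψ₁ (αₖ k)) (ψ₁ τ) w))
        K-sum : K.⟦_⟧ neighbours P.≈ᴹ ΣP.sum (K.⟦_⟧ ∘ neighbour)
        K-sum = sumᴹ-homo K neighbour
        K-neighbours : K.⟦_⟧ (⊖ neighbours) P.≈ᴹ P.-ᴹ (s P.*ₗ u)
        K-neighbours = P.≈ᴹ-trans (K.-ᴹ-homo neighbours) (P.-ᴹ‿cong (P.≈ᴹ-trans K-sum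
          (P.≈ᴹ-trans (ΣP.sum-cong-≋ value) (P.≈ᴹ-sym (*ₗ-distribʳ-sum T P (ψ₁ ∘ αₖ) u)))))
        1-s : u P.+ᴹ P.-ᴹ (s P.*ₗ u) P.≈ᴹ a P.*ₗ u
        1-s = P.≈ᴹ-trans (P.+ᴹ-cong (P.≈ᴹ-sym (P.*ₗ-identityˡ u)) (P.≈ᴹ-sym (-‿*ₗ T P s u)))
          (P.≈ᴹ-trans (P.≈ᴹ-sym (P.*ₗ-distribʳ u T.1# (T.- s))) (P.*ₗ-congʳ (T.sym a≈)))

    module _ (P : Mod T d ℓd) (w : LeftModule.Carrierᴹ P) where
      private
        module P = LeftModule P

      free-lift : LinearMap ℤ-ring (Free ℤ-ring V×G) (restrict² P)
      free-lift = lift ℤ-ring V×G (restrict² P) (λ (_ , τ) → ψ₁ τ P.*ₗ w) (λ (_ , h) → P.*ₗ-congʳ (ψ.⟦⟧-cong h))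

      module _ (a*w≈0 : a P.*ₗ w P.≈ᴹ P.0ᴹ) where
        free-lift-I-𝒜 : ∀ x → LinearMap.⟦_⟧ free-lift (LinearMap.⟦_⟧ I-𝒜 x) P.≈ᴹ P.0ᴹ
        free-lift-I-𝒜 = free-ext (restrict² P) (free-lift ∘ˡ I-𝒜)
          (zero-map ℤ-ring (restrict² P) (Free ℤ-ring V×G)) generators
          where
          generators : ∀ x → LinearMap.⟦_⟧ free-lift (LinearMap.⟦_⟧ I-𝒜 [ x ]) P.≈ᴹ P.0ᴹ
          generators (v , τ) = P.≈ᴹ-trans (K-I-𝒜 P free-lift w (λ _ _ → P.≈ᴹ-refl) v τ)
            (P.≈ᴹ-trans (*ₗ-comm T P a (ψ₁ τ) w) (P.≈ᴹ-trans (P.*ₗ-congˡ a*w≈0) (P.*ₗ-zeroʳ (ψ₁ τ))))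

        BF-lift : LinearMap T BF-T.underlying P
        BF-lift = tensor-lift S T χ P (tensor-lift ℤ-ring S φ (restrict S T χ P)
          (coker-lift I-𝒜 {P = restrict² P} free-lift free-lift-I-𝒜))

        BF-lift-basis : ∀ v τ → LinearMap.⟦_⟧ BF-lift (basis v τ) P.≈ᴹ ψ₁ τ P.*ₗ w
        BF-lift-basis v τ = P.≈ᴹ-trans (P.*ₗ-identityˡ _)
          (P.≈ᴹ-trans (P.*ₗ-congʳ χ.1#-homo) (P.*ₗ-identityˡ _))

    w : BF-T.Carrierᴹ
    w = e-ψ 1/n BF-T.· basis v₀ G.ε

    e-basis : ∀ v τ → e-ψ 1/n BF-T.· basis v τ BF-T.≈ᴹ ψ₁ τ BF-T.*ₗ w
    e-basis v τ = BF-T.≈ᴹ-trans (LinearMap.⟦⟧-cong (BF-T.multiplication (e-ψ 1/n)) basis≈)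
      (e-ψ-∙ (tensorᴳ S T χ (tensorᴳ ℤ-ring S φ BF)) 1/n τ (basis v₀ G.ε))
      where
      basis≈ : basis v τ BF-T.≈ᴹ τ BF-T.∙ basis v₀ G.ε
      basis≈ = ⊗-cong T.refl (⊗-cong S.refl
        (≈⇒CokerEq I-𝒜 ([]-cong (v≈v₀ v , G.sym (G.identityʳ τ)))))

    a*w≈0 : a BF-T.*ₗ w BF-T.≈ᴹ BF-T.0ᴹ
    a*w≈0 = begin
      a BF-T.*ₗ w                        ≈⟨ BF-T.*ₗ-congˡ (BF-T.≈ᴹ-trans (BF-T.*ₗ-congʳ ψ.ε-homo) (BF-T.*ₗ-identityˡ w)) ⟨
      a BF-T.*ₗ (ψ₁ G.ε BF-T.*ₗ w)        ≈⟨ K-I-𝒜 BF-T.underlying K w e-basis v₀ G.ε ⟨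
      K.⟦_⟧ (LinearMap.⟦_⟧ I-𝒜 [ v₀ , G.ε ]) ≈⟨ K′.⟦⟧-cong coboundary≈𝟘 ⟩
      K.⟦_⟧ 𝟘                            ≈⟨ K.0ᴹ-homo ⟩
      BF-T.0ᴹ ∎
      where
      open ≈-Reasoning BF-T.≈ᴹ-setoid
      K = from-generators BF-T.underlying (BF-T.multiplication (e-ψ 1/n))
      module K = LinearMap K
      -- The same map read on the cokernel, where the class of `I-𝒜 [ v₀ , ε ]` is zero; `K` itself
      -- starts from the free module.
      module K′ = LinearMap (restrict-map ℤ-ring S φ (restrict-map S T χ (BF-T.multiplication (e-ψ 1/n)) ∘ˡ unit S T χ)
                            ∘ˡ unit ℤ-ring S φ)
      coboundary≈𝟘 : CokerEq I-𝒜 (LinearMap.⟦_⟧ I-𝒜 [ v₀ , G.ε ]) 𝟘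
      coboundary≈𝟘 = by (Free.≈ᴹ-trans (Free.+ᴹ-congˡ (GroupProperties.ε⁻¹≈ε Free.+ᴹ-group)) (Free.+ᴹ-identityʳ _))
        where module Free = LeftModule (Free ℤ-ring V×G)

    module T/a = LeftModule T/a

    evaluation : LinearMap T BF-T.underlying T/a
    evaluation = BF-lift T/a T.1# (x*y≈/0 T a T.1#)

    evaluation-basis : ∀ v τ → LinearMap.⟦_⟧ evaluation (basis v τ) T/a.≈ᴹ ψ₁ τ
    evaluation-basis v τ = T/a.≈ᴹ-trans (BF-lift-basis T/a T.1# (x*y≈/0 T a T.1#) v τ) (≈⇒≈/ T a (T.*-identityʳ (ψ₁ τ)))

    section : LinearMap T T/a BF-T.underlying
    section = /-lift T a BF-T.underlying w a*w≈0

    e-ψ≈section∘evaluation : ∀ x →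
      e-ψ 1/n BF-T.· x BF-T.≈ᴹ LinearMap.⟦_⟧ section (LinearMap.⟦_⟧ evaluation x)
    e-ψ≈section∘evaluation = basis-ext BF-T.underlying (BF-T.multiplication (e-ψ 1/n)) (section ∘ˡ evaluation)
      λ τ → BF-T.≈ᴹ-trans (e-basis v₀ τ) (LinearMap.⟦⟧-cong section (T/a.≈ᴹ-sym (evaluation-basis v₀ τ)))

    evaluation-w : LinearMap.⟦_⟧ evaluation w T/a.≈ᴹ T.1#
    evaluation-w = T/a.≈ᴹ-trans (e-ψ-eigenvector (tensorᴳ S T χ (tensorᴳ ℤ-ring S φ BF)) 1/n*n≈1 evaluation (basis v₀ G.ε) eigen)
        eval-ε
      where
      eval-ε : LinearMap.⟦_⟧ evaluation (basis v₀ G.ε) T/a.≈ᴹ T.1#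
      eval-ε = T/a.≈ᴹ-trans (evaluation-basis v₀ G.ε) (≈⇒≈/ T a ψ.ε-homo)
      eigen : ∀ g → LinearMap.⟦_⟧ evaluation (g BF-T.∙ basis v₀ G.ε) T/a.≈ᴹ
                    ψ₁ g T.* LinearMap.⟦_⟧ evaluation (basis v₀ G.ε)
      eigen g = T/a.≈ᴹ-trans (evaluation-basis v₀ (g G.∙ G.ε)) (T/a.≈ᴹ-trans
        (≈⇒≈/ T a (T.trans (ψ.⟦⟧-cong (G.identityʳ g)) (T.sym (T.*-identityʳ (ψ₁ g)))))
        (T/a.*ₗ-congˡ {ψ₁ g} (T/a.≈ᴹ-sym eval-ε)))

    isotypic-BF : _≅_ T (image (BF-T.multiplication (e-ψ 1/n))) T/a
    isotypic-BF = split-image (BF-T.multiplication (e-ψ 1/n)) evaluation section e-ψ≈section∘evaluation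
      λ c → T/a.≈ᴹ-trans (LinearMap.*ₗ-homo evaluation c w) (T/a.≈ᴹ-trans (T/a.*ₗ-congˡ {c} evaluation-w)
        (≈⇒≈/ T a (T.*-identityʳ c)))

-- Integer multiples, 2-torsion and the weighted sum.

module _ (R : CommutativeRing a ℓa) where
  open CommutativeRing R hiding (zero)
  open SemiringSum semiring
  open Mult +-monoid using (×-assocˡ; ×-homo-+; ×-congʳ; ×-congˡ) renaming (_×_ to _⊠_)
  open ≈-Reasoning setoid

  n×1*x : ∀ n x → sum {n} (λ _ → 1#) * x ≈ n ⊠ x
  n×1*x n x = trans (*-distribʳ-sum {n} x (λ _ → 1#)) (trans (sum-cong-≋ {n} (λ _ → *-identityˡ x)) (sum-replicate n))

  n⊠0≈0 : ∀ n → n ⊠ 0# ≈ 0#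
  n⊠0≈0 n = trans (sym (sum-replicate n)) (sum-replicate-zero n)

  -- If n = 2m is invertible, then x = (1/n) m (x + x).
  2-torsion-free : ∀ {1/n} m → 1/n * sum {m ℕ.* 2} (λ _ → 1#) ≈ 1# → ∀ {x} → x + x ≈ 0# → x ≈ 0#
  2-torsion-free {1/n} m 1/n*n≈1 {x} x+x≈0 = begin
    x                                      ≈⟨ *-identityˡ x ⟨
    1# * x                                 ≈⟨ *-congʳ 1/n*n≈1 ⟨
    1/n * sum {m ℕ.* 2} (λ _ → 1#) * x     ≈⟨ *-assoc 1/n _ x ⟩
    1/n * (sum {m ℕ.* 2} (λ _ → 1#) * x)   ≈⟨ *-congˡ (n×1*x (m ℕ.* 2) x) ⟩
    1/n * ((m ℕ.* 2) ⊠ x)                  ≈⟨ *-congˡ (×-assocˡ x m 2) ⟨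
    1/n * (m ⊠ (2 ⊠ x))                    ≈⟨ *-congˡ (×-congʳ m (trans (+-congˡ (+-identityʳ x)) x+x≈0)) ⟩
    1/n * (m ⊠ 0#)                         ≈⟨ *-congˡ (n⊠0≈0 m) ⟩
    1/n * 0#                               ≈⟨ zeroʳ 1/n ⟩
    0#                                     ∎

  -- The index i stands for i + 1, so i and opposite i have total weight n + 1.
  weighted-sum-doubled : ∀ {n} (u : Fin n → Carrier) → (∀ i → u (opposite i) ≈ u i) → sum u ≈ 0# →
    sum (λ i → suc (toℕ i) ⊠ u i) + sum (λ i → suc (toℕ i) ⊠ u i) ≈ 0#
  weighted-sum-doubled {n} u even Σu≈0 = begin
    sum t + sum t                                 ≈⟨ +-congˡ (sum-permute t reverse) ⟩
    sum t + sum (t ∘ opposite)                    ≈⟨ ∑-distrib-+ t (t ∘ opposite) ⟨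
    sum (λ i → t i + t (opposite i))              ≈⟨ sum-cong-≋ pair ⟩
    -- Each pair contributes n + 1 copies of `u i`; written as a constant sum, they let an exchange
    -- of summations bring out `sum u`.
    sum (λ i → sum {suc n} (λ _ → u i))           ≈⟨ ∑-comm {n} {suc n} (λ i _ → u i) ⟩
    sum {suc n} (λ _ → sum u)                     ≈⟨ sum-cong-≋ {suc n} (λ _ → Σu≈0) ⟩
    sum {suc n} (λ _ → 0#)                        ≈⟨ sum-replicate-zero (suc n) ⟩
    0#                                            ∎
    where
    t : Fin n → Carrier
    t i = suc (toℕ i) ⊠ u i
    total : ∀ i → suc (toℕ i) ℕ.+ suc (toℕ (opposite i)) ≡ suc n
    total i = ≡.trans (ℕ.+-suc (suc (toℕ i)) (toℕ (opposite i))) (≡.cong suc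
      (≡.trans (≡.cong (suc (toℕ i) ℕ.+_) (Fin.opposite-prop i)) (ℕ.m+[n∸m]≡n (Fin.toℕ<n i))))
    pair : ∀ i → t i + t (opposite i) ≈ sum {suc n} (λ _ → u i)
    pair i = begin
      t i + t (opposite i)                                ≈⟨ +-congˡ (×-congʳ (suc (toℕ (opposite i))) (even i)) ⟩
      suc (toℕ i) ⊠ u i + suc (toℕ (opposite i)) ⊠ u i    ≈⟨ ×-homo-+ (u i) (suc (toℕ i)) (suc (toℕ (opposite i))) ⟨
      (suc (toℕ i) ℕ.+ suc (toℕ (opposite i))) ⊠ u i      ≈⟨ ×-congˡ (total i) ⟩
      suc n ⊠ u i                                         ≈⟨ sum-replicate (suc n) ⟨
      sum {suc n} (λ _ → u i)                             ∎

  R/0≅R : ∀ {x} → x ≈ 0# → _≅_ R (R /⟨ x ⟩) (regular R)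
  R/0≅R {x} x≈0 = id , record
    { isLeftModuleMonomorphism = record
      { isLeftModuleHomomorphism = LinearMap.isLinear (linear R (R /⟨ x ⟩) (regular R) id respects (λ _ _ → refl) (λ _ _ → refl))
      ; injective = ≈⇒≈/ R x
      }
    ; surjective = λ y → y , respects
    }
    where
    respects : ∀ {y z} → LeftModule._≈ᴹ_ (R /⟨ x ⟩) y z → y ≈ z
    respects {y} {z} (by {preimage = t} h) = GroupProperties.x∙y⁻¹≈ε⇒x≈y +-group y z
      (trans h (trans (*-congʳ x≈0) (zeroˡ t)))

module _ (R : CommutativeRing a ℓa) (θ : ℤ-ring ⟶ʳ R) where
  open CommutativeRing R
  open Mult +-monoid using () renaming (_×_ to _⊠_)
  private
    module θ = RingHomomorphism θ

  ℤ-homo-⊠ : ∀ n x → θ.⟦_⟧ (+ n) * x ≈ n ⊠ x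
  ℤ-homo-⊠ zero    x = trans (*-congʳ θ.0#-homo) (zeroˡ x)
  ℤ-homo-⊠ (suc n) x = trans (*-congʳ (trans (θ.+-homo (+ 1) (+ n)) (+-congʳ θ.1#-homo)))
    (trans (distribʳ x _ _) (+-cong (*-identityˡ x) (ℤ-homo-⊠ n x)))

module _ (R : CommutativeRing a ℓa) (S : CommutativeRing b ℓb) (φ : R ⟶ʳ S) (G : Group c ℓc)
         (f : Group.Carrier G → CommutativeRing.Carrier S) where
  evaluate-sum : ∀ {n} (t : Vector (FreeTerm R (Group.setoid G)) n) →
    evaluate R S φ G f (sumᴹ R (R [ G ]ᴳ) t) ≡ SemiringSum.sum (CommutativeRing.semiring S) (evaluate R S φ G f ∘ t)
  evaluate-sum {zero}  t = ≡.refl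
  evaluate-sum {suc n} t = ≡.cong (CommutativeRing._+_ S (evaluate R S φ G f (t zero))) (evaluate-sum (t ∘ suc))

-- Sums over the loops of the bouquet.

module _ (M : CommutativeMonoid a ℓa) where
  open CommutativeMonoid M
  open SumProperties M

  sum-↑ : ∀ m {n} (f : Fin (m ℕ.+ n) → Carrier) →
           sum f ≈ sum (λ i → f (i ↑ˡ n)) ∙ sum (λ j → f (m ↑ʳ j))
  sum-↑ zero    f = sym (identityˡ _)
  sum-↑ (suc m) f = trans (∙-congˡ (sum-↑ m (f ∘ suc))) (sym (assoc _ _ _))

  -- Follows the recursion of `pairs`, which lists the fibre over `zero` and then, shifted, the
  -- fibres over the remaining indices.
  sum-pairs : ∀ {n} (f : Fin n → ℕ) (h : Σ (Fin n) (Fin ∘ f) → Carrier) →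
              sum (h ∘ Enumeration.element (pairs f)) ≈ sum (λ i → sum (λ k → h (i , k)))
  sum-pairs {zero}  f h = refl
  sum-pairs {suc n} f h = trans (sum-↑ (f zero) (h ∘ Enumeration.element (pairs f)))
    (∙-cong (sum-cong-≋ (λ k → reflexive (≡.cong h (first k))))
      (trans (sum-cong-≋ (λ k → reflexive (≡.cong h (rest k)))) (sum-pairs (f ∘ suc) (λ (i , k) → h (suc i , k)))))
    where
    module R = Enumeration (pairs (f ∘ suc))
    first : ∀ k → Enumeration.element (pairs f) (k ↑ˡ R.size) ≡ (zero , k)
    first k rewrite Fin.splitAt-↑ˡ (f zero) k R.size = ≡.refl
    rest : ∀ k → Enumeration.element (pairs f) (f zero ↑ʳ k) ≡ (suc (proj₁ (R.element k)) , proj₂ (R.element k))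
    rest k rewrite Fin.splitAt-↑ʳ (f zero) R.size k = ≡.refl

  sum-loops : ∀ n (h : Loop n → Carrier) →
              sum (h ∘ Enumeration.element (loops n)) ≈ h e₀ ∙ sum (λ i → sum (λ k → h (e i k)))
  sum-loops n h = ∙-congˡ (sum-pairs (suc ∘ toℕ) (h ∘ uncurry e))

-- The bouquet: ψ(pθ) and its vanishing for even ψ.

module Bouquet {a b c ℓa ℓb ℓc : Level}
  (T : CommutativeRing b ℓb) (G : Group c ℓc)
  (ψ : GroupHomomorphism (Group.rawGroup G) (Group.rawGroup (units T)))
  {n : ℕ} (σ : Fin n → Group.Carrier G) (π : Group.Carrier G → Permutation n n)
  (σ-π : ∀ g i → Group._≈_ G (σ (π g ⟨$⟩ʳ i)) (Group._∙_ G (Group._⁻¹ G g) (σ i)))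
  (S : CommutativeRing a ℓa) (φ : ℤ-ring ⟶ʳ S) (χ : S ⟶ʳ T)
  where

  open Isotypic T G ψ σ π σ-π
  private
    module S = CommutativeRing S
    module T = CommutativeRing T
    module G = Group G
    module ψ = GroupHomomorphism ψ
    module φ = RingHomomorphism φ
    module χ = RingHomomorphism χ
    open SemiringSum T.semiring
    open Mult T.+-monoid using () renaming (_×_ to _⊠_)
    open ≈-Reasoning T.setoid

    θ : ℤ-ring ⟶ʳ T
    θ = _∘ʳ_ {R = ℤ-ring} {S = S} {T = T} χ φ

  inverse-n : ∀ {s} → φ.⟦_⟧ (+ n) S.* s S.≈ S.1# → χ.⟦_⟧ s T.* sum {n} (λ _ → T.1#) T.≈ T.1#
  inverse-n {s} φn*s≈1 = begin
    χ.⟦_⟧ s T.* sum {n} (λ _ → T.1#)          ≈⟨ T.*-congˡ (sum-replicate n) ⟩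
    χ.⟦_⟧ s T.* (n ⊠ T.1#)                    ≈⟨ T.*-congˡ (ℤ-homo-⊠ T θ n T.1#) ⟨
    χ.⟦_⟧ s T.* (χ.⟦_⟧ (φ.⟦_⟧ (+ n)) T.* T.1#) ≈⟨ T.*-congˡ (T.*-identityʳ _) ⟩
    χ.⟦_⟧ s T.* χ.⟦_⟧ (φ.⟦_⟧ (+ n))           ≈⟨ T.*-comm _ _ ⟩
    χ.⟦_⟧ (φ.⟦_⟧ (+ n)) T.* χ.⟦_⟧ s           ≈⟨ χ.*-homo _ _ ⟨
    χ.⟦_⟧ (φ.⟦_⟧ (+ n) S.* s)                 ≈⟨ χ.⟦⟧-cong φn*s≈1 ⟩
    χ.⟦_⟧ S.1#                               ≈⟨ χ.1#-homo ⟩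
    T.1#                                     ∎

  u : Fin n → T.Carrier
  u i = ψ₁ (σ i G.⁻¹)

  weighted : Fin n → T.Carrier
  weighted i = suc (toℕ i) ⊠ u i

  -- ψ(pθ) for an abstract group, spelled exactly as in `pθ` so that it agrees with `ψ⟨pθ⟩` by
  -- unfolding.
  stickelberger : T.Carrier
  stickelberger = evaluate ℤ-ring T θ G ψ₁ (⊖ sumᴹ ℤ-ring (ℤ-ring [ G ]ᴳ) (λ i → + suc (toℕ i) ⊙ [ σ i G.⁻¹ ]))

  stickelberger≈ : stickelberger T.≈ T.- sum weighted
  stickelberger≈ = T.-‿cong (T.trans (T.reflexive (evaluate-sum ℤ-ring T θ G ψ₁ (λ i → + suc (toℕ i) ⊙ [ σ i G.⁻¹ ])))
    (sum-cong-≋ (λ i → ℤ-homo-⊠ T θ (suc (toℕ i)) (u i))))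

  module _ (α : Func (Digraph.E (bouquet n)) G.setoid) (α-e₀ : Func.to α e₀ G.≈ G.ε)
           (α-e : ∀ i k → Func.to α (e i k) G.≈ σ i G.⁻¹) where
    private
      ψα : Loop n → T.Carrier
      ψα k = ψ₁ (Func.to α k)

    sum-ψα : sum (ψα ∘ Enumeration.element (loops n)) T.≈ T.1# T.+ sum weighted
    sum-ψα = T.trans (sum-loops T.+-commutativeMonoid n ψα) (T.+-cong (T.trans (ψ.⟦⟧-cong α-e₀) ψ.ε-homo)
      (sum-cong-≋ (λ i → T.trans (sum-cong-≋ (λ k → ψ.⟦⟧-cong (α-e i k))) (sum-replicate (suc (toℕ i))))))

    -- This is what the extra loop `e₀` of trivial voltage is for: it cancels the identity in I - 𝒜,
    -- as 1 - (1 + W) = -W.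
    stickelberger≈1-ψα : stickelberger T.≈ T.1# T.- sum (ψα ∘ Enumeration.element (loops n))
    stickelberger≈1-ψα = begin
      stickelberger                 ≈⟨ stickelberger≈ ⟩
      T.- W                         ≈⟨ GroupProperties.\\-leftDividesˡ T.+-group T.1# (T.- W) ⟨
      T.1# T.+ (T.- T.1# T.- W)     ≈⟨ T.+-congˡ (AbelianGroupProperties.⁻¹-∙-comm T.+-abelianGroup T.1# W) ⟩
      T.1# T.- (T.1# T.+ W)         ≈⟨ T.+-congˡ (T.-‿cong sum-ψα) ⟨
      T.1# T.- sum (ψα ∘ Enumeration.element (loops n)) ∎
      where W = sum weighted

  -- The modules enter through equations so that their definitions are unfolded one at a time: comparing them directly
  -- compares all the nested proofs of their laws.
  isotypic-component-≅ : {X : Digraph 0ℓ 0ℓ 0ℓ 0ℓ} (bouquet≡X : bouquet n ≡ X) (α : Func (Digraph.E X) G.setoid) →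
    let loop = ≡.subst Digraph.E.Carrier bouquet≡X in
    Func.to α (loop e₀) G.≈ G.ε → (∀ i k → Func.to α (loop (e i k)) G.≈ σ i G.⁻¹) →
    {B : GModule ℤ-ring G _ _} → Derived.BF X G α ≡ B → {M : GModule T G _ _} → tensorᴳ S T χ (tensorᴳ ℤ-ring S φ B) ≡ M →
    {1/n : T.Carrier} → 1/n T.* sum {n} (λ _ → T.1#) T.≈ T.1# → {t : FreeTerm T G.setoid} → e-ψ 1/n ≡ t →
    {N : Mod T _ _} → image (GModule.multiplication M t) ≡ N → {a : T.Carrier} → a T.≈ stickelberger → _≅_ T N (T /⟨ a ⟩)
  isotypic-component-≅ ≡.refl α α-e₀ α-e ≡.refl ≡.refl {1/n} 1/n*n≈1 ≡.refl ≡.refl {a} a≈ =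
    isotypic-BF (bouquet n) α S φ χ tt (λ _ → ≡.refl)
      1/n 1/n*n≈1 a (T.trans a≈ (stickelberger≈1-ψα α α-e₀ α-e))

  module _ (j : G.Carrier) (σ-opposite : ∀ i → σ (opposite i) G.≈ j G.∙ σ i) (ψj≈1 : ψ₁ j T.≈ T.1#) where
    ψj⁻¹≈1 : ψ₁ (j G.⁻¹) T.≈ T.1#
    ψj⁻¹≈1 = T.trans (T.sym (T.trans (T.*-congʳ ψj≈1) (T.*-identityˡ _))) (ψ₁-inverse j)

    u-even : ∀ i → u (opposite i) T.≈ u i
    u-even i = begin
      ψ₁ (σ (opposite i) G.⁻¹)        ≈⟨ ψ.⟦⟧-cong (G.⁻¹-cong (σ-opposite i)) ⟩
      ψ₁ ((j G.∙ σ i) G.⁻¹)           ≈⟨ ψ.⟦⟧-cong (GroupProperties.⁻¹-anti-homo-∙ G j (σ i)) ⟩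
      ψ₁ (σ i G.⁻¹ G.∙ j G.⁻¹)        ≈⟨ ψ.homo (σ i G.⁻¹) (j G.⁻¹) ⟩
      u i T.* ψ₁ (j G.⁻¹)             ≈⟨ T.*-congˡ ψj⁻¹≈1 ⟩
      u i T.* T.1#                    ≈⟨ T.*-identityʳ (u i) ⟩
      u i                             ∎

    stickelberger≈0 : ∀ {1/n} m → n ≡ m ℕ.* 2 → 1/n T.* sum {n} (λ _ → T.1#) T.≈ T.1# → sum u T.≈ T.0# → stickelberger T.≈ T.0#
    stickelberger≈0 {1/n} m n≡m*2 1/n*n≈1 Σu≈0 = T.trans stickelberger≈ (T.trans (T.-‿cong W≈0) (RingProperties.-0#≈0# T.ring))
      where
      W≈0 : sum weighted T.≈ T.0#
      W≈0 = 2-torsion-free T {1/n} m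
        (≡.subst (λ k → 1/n T.* sum {k} (λ _ → T.1#) T.≈ T.1#) n≡m*2 1/n*n≈1)
        (weighted-sum-doubled T u u-even Σu≈0)

  -- Multiplication by ψ(g) only permutes the terms. It gives (ψ(g) - 1) Σ ψ(σᵢ⁻¹) = 0 for every g,
  -- the source of orthogonality.
  ψ-fixes-sum : ∀ g → ψ₁ g T.* sum u T.≈ sum u
  ψ-fixes-sum g = begin
    ψ₁ g T.* sum u                    ≈⟨ T.*-comm _ _ ⟩
    sum u T.* ψ₁ g                    ≈⟨ *-distribʳ-sum (ψ₁ g) u ⟩
    sum (λ i → u i T.* ψ₁ g)          ≈⟨ sum-cong-≋ shift ⟩
    sum (λ i → u (π g ⟨$⟩ʳ i))        ≈⟨ sum-permute u (π g) ⟨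
    sum u                             ∎
    where
    shift : ∀ i → u i T.* ψ₁ g T.≈ u (π g ⟨$⟩ʳ i)
    shift i = T.trans (T.sym (ψ.homo (σ i G.⁻¹) g)) (T.sym (ψ.⟦⟧-cong (σ⁻¹-shift g i)))

-- Roots of unity in a Heyting field.

module RootsOfUnity {c ℓ₁ ℓ₂} (F : HeytingField c ℓ₁ ℓ₂) where
  private
    ring : CommutativeRing c ℓ₁
    ring = fieldRing F
    module F = HeytingField F
  open F using (_#_)
  open CommutativeRing ring hiding (ring; zero)
  open HCR F.heytingCommutativeRing using (invertibleˡ⇒#; #-congʳ; #-congˡ)
  open RingProperties (CommutativeRing.ring ring) using (x[y-z]≈xy-xz; [y-z]x≈yx-zx; +-cancelʳ; x∙y⁻¹≈ε⇒x≈y)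
  open Exp commutativeSemiring using (_^_; ^-distrib-*; ^-assocʳ; ^-congˡ; ^-congʳ; ^-homo-*)
  open SemiringSum semiring using (sum; sum-cong-≋; *-distribˡ-sum; ∑-comm; sum-remove; sum-replicate-zero)
  open ≈-Reasoning setoid

  #-cancel : ∀ {x y z} → x # y → x * z ≈ y * z → z ≈ 0#
  #-cancel {x} {y} {z} x#y xz≈yz with F.#⇒invertible x#y
  ... | t , t[x-y]≈1 , _ = begin
    z                 ≈⟨ *-identityˡ z ⟨
    1# * z            ≈⟨ *-congʳ t[x-y]≈1 ⟨
    t * (x - y) * z   ≈⟨ *-assoc t (x - y) z ⟩
    t * ((x - y) * z) ≈⟨ *-congˡ ([y-z]x≈yx-zx z x y) ⟩
    t * (x * z - y * z) ≈⟨ *-congˡ (trans (+-congʳ xz≈yz) (-‿inverseʳ (y * z))) ⟩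
    t * 0#            ≈⟨ zeroʳ t ⟩
    0#                ∎

  -- Here (x - 1) s = 0 and s can be cancelled. It serves a contradiction: if Σ ψ(σᵢ⁻¹) were apart
  -- from 0, ψ would be trivial.
  fixed⇒1 : ∀ {x s} → s # 0# → x * s ≈ s → x ≈ 1#
  fixed⇒1 {x} {s} s#0 xs≈s = x∙y⁻¹≈ε⇒x≈y x 1# (#-cancel s#0 (begin
    s * (x - 1#)      ≈⟨ *-comm s (x - 1#) ⟩
    (x - 1#) * s      ≈⟨ [y-z]x≈yx-zx s x 1# ⟩
    x * s - 1# * s    ≈⟨ +-cong xs≈s (-‿cong (*-identityˡ s)) ⟩
    s - s             ≈⟨ -‿inverseʳ s ⟩
    0#                ≈⟨ zeroˡ (x - 1#) ⟨
    0# * (x - 1#)     ∎))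

  *-#-* : ∀ {u v x y} → v * u ≈ 1# → x # y → u * x # u * y
  *-#-* {u} {v} {x} {y} vu≈1 x#y with F.#⇒invertible x#y
  ... | t , t[x-y]≈1 , _ = invertibleˡ⇒# (t * v , (begin
    t * v * (u * x - u * y) ≈⟨ *-congˡ (x[y-z]≈xy-xz u x y) ⟨
    t * v * (u * (x - y))   ≈⟨ *-assoc t v _ ⟩
    t * (v * (u * (x - y))) ≈⟨ *-congˡ (trans (sym (*-assoc v u _)) (trans (*-congʳ vu≈1) (*-identityˡ _))) ⟩
    t * (x - y)             ≈⟨ t[x-y]≈1 ⟩
    1#                      ∎))

  geometric : ∀ n → Carrier → Carrier
  geometric n x = sum {n} (λ k → x ^ toℕ k)

  geometric-suc : ∀ n x → geometric (suc n) x ≈ 1# + x * geometric n x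
  geometric-suc n x = +-congˡ (sym (*-distribˡ-sum {n} x (λ k → x ^ toℕ k)))

  -- The identity (x - 1)(1 + ... + xⁿ⁻¹) = xⁿ - 1, with all terms moved to positive sign.
  geometric-telescopes : ∀ n x → x * geometric n x + 1# ≈ geometric n x + x ^ n
  geometric-telescopes zero    x = +-congʳ (zeroʳ x)
  geometric-telescopes (suc n) x = begin
    x * geometric (suc n) x + 1#            ≈⟨ +-congʳ (*-congˡ (trans (geometric-suc n x) (+-comm _ _))) ⟩
    x * (x * geometric n x + 1#) + 1#       ≈⟨ +-congʳ (*-congˡ (geometric-telescopes n x)) ⟩
    x * (geometric n x + x ^ n) + 1#        ≈⟨ trans (+-congʳ (distribˡ x _ _)) (+-comm _ _) ⟩
    1# + (x * geometric n x + x ^ suc n)    ≈⟨ +-assoc 1# _ _ ⟨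
    1# + x * geometric n x + x ^ suc n      ≈⟨ +-congʳ (geometric-suc n x) ⟨
    geometric (suc n) x + x ^ suc n         ∎

  geometric-fixed : ∀ n {x} → x ^ n ≈ 1# → x * geometric n x ≈ geometric n x
  geometric-fixed n {x} xⁿ≈1 = +-cancelʳ 1# _ _ (trans (geometric-telescopes n x) (+-congˡ xⁿ≈1))

  geometric-root : ∀ n {x} → x ^ n ≈ 1# → x # 1# → geometric n x ≈ 0#
  geometric-root n xⁿ≈1 x#1 = #-cancel x#1 (trans (geometric-fixed n xⁿ≈1) (sym (*-identityˡ _)))

  1^n≈1 : ∀ n → 1# ^ n ≈ 1#
  1^n≈1 zero    = refl
  1^n≈1 (suc n) = trans (*-identityˡ _) (1^n≈1 n)

  -- Equality with c is undecidable; cotransitivity still locates the only index at which it can hold.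
  apart-from-others : ∀ {m} (f : Fin (suc m) → Carrier) → (∀ {i j} → i ≢ j → f i # f j) → ∀ c →
                      ∃ λ i → ∀ j → j ≢ i → f j # c
  apart-from-others {zero}  f apart c = zero , λ { zero 0≢0 → contradiction ≡.refl 0≢0 }
  apart-from-others {suc m} f apart c
    with apart-from-others (f ∘ suc) (λ i≢j → apart (i≢j ∘ Fin.suc-injective)) c
  -- Only `f (suc i)` in the tail and `f zero` can still equal `c`. These two are apart, so `c` is
  -- apart from one of them, and the other remains as the candidate.
  ... | i , others with F.#-cotrans (apart {zero} {suc i} λ ()) c
  ...   | inj₁ f₀#c = suc i , λ { zero _ → f₀#c ; (suc j) j≢i → others j (j≢i ∘ ≡.cong suc) }
  ...   | inj₂ c#fᵢ = zero , tail
    where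
    tail : ∀ j → j ≢ zero → f j # c
    tail zero    0≢0 = contradiction ≡.refl 0≢0
    tail (suc j) _   with j Fin.≟ i
    ... | yes ≡.refl = F.#-sym c#fᵢ
    ... | no  j≢i    = others j j≢i

  sum-single : ∀ {n} (f : Fin n → Carrier) i → (∀ j → j ≢ i → f j ≈ 0#) → sum f ≈ f i
  sum-single {suc n} f zero    h = trans (+-congˡ (trans (sum-cong-≋ {n} (λ j → h (suc j) λ ())) (sum-replicate-zero n))) (+-identityʳ _)
  sum-single {suc n} f (suc i) h = trans (+-cong (h zero λ ()) (sum-single (f ∘ suc) i (λ j j≢i → h (suc j) (j≢i ∘ Fin.suc-injective))))
    (+-identityˡ _)

  module _ (m : ℕ) (ζ : Carrier) (ζⁿ≈1 : ζ ^ suc m ≈ 1#)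
           (ζ-primitive : ∀ {i} → 0 ℕ.< i → i ℕ.< suc m → ζ ^ i # 1#) where
    private
      n = suc m

    ^-root : ∀ {x} k → x ^ n ≈ 1# → (x ^ k) ^ n ≈ 1#
    ^-root {x} k xⁿ≈1 = begin
      (x ^ k) ^ n   ≈⟨ ^-assocʳ x k n ⟩
      x ^ (k ℕ.* n) ≈⟨ ^-congʳ x (ℕ.*-comm k n) ⟩
      x ^ (n ℕ.* k) ≈⟨ ^-assocʳ x n k ⟨
      (x ^ n) ^ k   ≈⟨ ^-congˡ k xⁿ≈1 ⟩
      1# ^ k        ≈⟨ 1^n≈1 k ⟩
      1#            ∎

    root-inverse : ∀ {x} → x ^ n ≈ 1# → x ^ m * x ≈ 1#
    root-inverse xⁿ≈1 = trans (*-comm _ _) xⁿ≈1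

    -- Write ζʲ = ζⁱ ζʲ⁻ⁱ: the second factor is apart from 1 by primitivity, and multiplying by the
    -- unit ζⁱ preserves apartness.
    powers-apart-< : ∀ {i j} → i ℕ.< j → j ℕ.< n → ζ ^ j # ζ ^ i
    powers-apart-< {i} {j} i<j j<n = #-congˡ (*-identityʳ (ζ ^ i)) (#-congʳ split
      (*-#-* (root-inverse (^-root i ζⁿ≈1)) (ζ-primitive (ℕ.m<n⇒0<n∸m i<j) (ℕ.≤-<-trans (ℕ.m∸n≤m j i) j<n))))
      where
      split : ζ ^ i * ζ ^ (j ℕ.∸ i) ≈ ζ ^ j
      split = trans (sym (^-homo-* ζ i (j ℕ.∸ i))) (^-congʳ ζ (ℕ.m+[n∸m]≡n (ℕ.<⇒≤ i<j)))

    powers-apart : ∀ {i j : Fin n} → i ≢ j → ζ ^ toℕ i # ζ ^ toℕ j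
    powers-apart {i} {j} i≢j with ℕ.<-cmp (toℕ i) (toℕ j)
    ... | tri< i<j _ _ = F.#-sym (powers-apart-< i<j (Fin.toℕ<n j))
    ... | tri≈ _ i≡j _ = contradiction (Fin.toℕ-injective i≡j) i≢j
    ... | tri> _ _ j<i = powers-apart-< j<i (Fin.toℕ<n i)

    powers-injective : ∀ {i j : Fin n} → ζ ^ toℕ i ≈ ζ ^ toℕ j → i ≡ j
    powers-injective {i} {j} h with i Fin.≟ j
    ... | yes i≡j = i≡j
    ... | no  i≢j = contradiction (powers-apart i≢j) (F.#-irrefl h)

    -- After exchanging the sums, the inner one is wᵏ times the geometric sum of ζᵏ. It vanishes for
    -- k ≠ 0, and k = 0 contributes n.
    sum-geometric : ∀ w → sum {n} (λ j → geometric n (w * ζ ^ toℕ j)) ≈ sum {n} (λ _ → 1#)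
    sum-geometric w = begin
      sum {n} (λ j → sum {n} (λ k → (w * ζ ^ toℕ j) ^ toℕ k))      ≈⟨ sum-cong-≋ {n} (λ j → sum-cong-≋ {n} (λ k → swap (toℕ j) (toℕ k))) ⟩
      sum {n} (λ j → sum {n} (λ k → w ^ toℕ k * (ζ ^ toℕ k) ^ toℕ j)) ≈⟨ ∑-comm {n} {n} (λ j k → w ^ toℕ k * (ζ ^ toℕ k) ^ toℕ j) ⟩
      sum {n} (λ k → sum {n} (λ j → w ^ toℕ k * (ζ ^ toℕ k) ^ toℕ j)) ≈⟨ sum-single {n} _ zero vanish ⟩
      sum {n} (λ j → 1# * 1# ^ toℕ j)                             ≈⟨ sum-cong-≋ {n} (λ j → trans (*-identityˡ _) (1^n≈1 (toℕ j))) ⟩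
      sum {n} (λ _ → 1#)                                          ∎
      where
      swap : ∀ j k → (w * ζ ^ j) ^ k ≈ w ^ k * (ζ ^ k) ^ j
      swap j k = trans (^-distrib-* w (ζ ^ j) k) (*-congˡ (trans (^-assocʳ ζ j k)
        (trans (^-congʳ ζ (ℕ.*-comm j k)) (sym (^-assocʳ ζ k j)))))
      vanish : ∀ k → k ≢ zero → sum {n} (λ j → w ^ toℕ k * (ζ ^ toℕ k) ^ toℕ j) ≈ 0#
      vanish k k≢0 = trans (sym (*-distribˡ-sum {n} (w ^ toℕ k) (λ j → (ζ ^ toℕ k) ^ toℕ j)))
        (trans (*-congˡ (geometric-root n (^-root (toℕ k) ζⁿ≈1) (powers-apart k≢0))) (zeroʳ _))

    -- With w = v⁻¹, each Sⱼ = Σₖ (w ζʲ)ᵏ satisfies v Sⱼ = ζʲ Sⱼ, so it vanishes when ζʲ is apart from v. As Σⱼ Sⱼ = n, the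
    -- remaining Sᵢ is n, which can be cancelled from v Sᵢ = ζⁱ Sᵢ.
    root-is-power : ∀ {1/n} → sum {n} (λ _ → 1#) * 1/n ≈ 1# →
                    ∀ v → v ^ n ≈ 1# → ∃ λ (i : Fin n) → v ≈ ζ ^ toℕ i
    root-is-power {1/n} n*1/n≈1 v vⁿ≈1 with apart-from-others {m} (λ i → ζ ^ toℕ i) powers-apart v
    ... | i , others = i , (begin
      v                        ≈⟨ cancel-S v ⟩
      v * S i * 1/n            ≈⟨ *-congʳ (vS≈ζS i) ⟩
      ζ ^ toℕ i * S i * 1/n    ≈⟨ cancel-S (ζ ^ toℕ i) ⟨
      ζ ^ toℕ i                ∎)
      where
      w = v ^ m
      S : Fin n → Carrier
      S j = geometric n (w * ζ ^ toℕ j)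
      [wζʲ]ⁿ≈1 : ∀ j → (w * ζ ^ j) ^ n ≈ 1#
      [wζʲ]ⁿ≈1 j = trans (^-distrib-* w (ζ ^ j) n) (trans (*-cong (^-root m vⁿ≈1) (^-root j ζⁿ≈1)) (*-identityˡ 1#))
      vS≈ζS : ∀ j → v * S j ≈ ζ ^ toℕ j * S j
      vS≈ζS j = begin
        v * S j                        ≈⟨ *-congˡ (geometric-fixed n ([wζʲ]ⁿ≈1 (toℕ j))) ⟨
        v * (w * ζ ^ toℕ j * S j)      ≈⟨ *-congˡ (*-assoc w _ _) ⟩
        v * (w * (ζ ^ toℕ j * S j))    ≈⟨ *-assoc v w _ ⟨
        v * w * (ζ ^ toℕ j * S j)      ≈⟨ *-congʳ vⁿ≈1 ⟩
        1# * (ζ ^ toℕ j * S j)         ≈⟨ *-identityˡ _ ⟩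
        ζ ^ toℕ j * S j                ∎
      Sᵢ≈n : S i ≈ sum {n} (λ _ → 1#)
      Sᵢ≈n = trans (sym (sum-single S i (λ j j≢i → #-cancel (others j j≢i) (sym (vS≈ζS j))))) (sum-geometric w)
      cancel-S : ∀ x → x ≈ x * S i * 1/n
      cancel-S x = sym (trans (*-assoc x _ _) (trans (*-congˡ (trans (*-congʳ Sᵢ≈n) n*1/n≈1)) (*-identityʳ x)))

-- The Galois group of the cyclotomic field.

module _ {F : HeytingField a b d} {n : ℕ} (L : Cyclotomic F n c ℓ₁ ℓ₂) where
  open Cyclotomic L
  open Galois extension
  private
    module K = CommutativeRing (fieldRing K)

  Auto-ext : (σ τ : Auto) → Auto.apply σ ζ ≈ Auto.apply τ ζ → ∀ x → Auto.apply σ x ≈ Auto.apply τ x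
  Auto-ext σ τ σζ≈τζ x = go (generated x)
    where
    module σ = Auto σ
    module τ = Auto τ
    apply-inverse : ∀ (ρ : Auto) {x y} → x * y ≈ 1# → Auto.apply ρ x * Auto.apply ρ y ≈ 1#
    apply-inverse ρ xy≈1 = K.trans (K.sym (Auto.*-homo ρ _ _)) (K.trans (Auto.⟦⟧-cong ρ xy≈1) (Auto.1#-homo ρ))
    go : ∀ {x} → Adjoin extension ζ x → σ.apply x ≈ τ.apply x
    go (base q)       = K.trans (σ.fixes q) (K.sym (τ.fixes q))
    go generator      = σζ≈τζ
    go (add h h′)     = K.trans (σ.+-homo _ _) (K.trans (K.+-cong (go h) (go h′)) (K.sym (τ.+-homo _ _)))
    go (multiply h h′) = K.trans (σ.*-homo _ _) (K.trans (K.*-cong (go h) (go h′)) (K.sym (τ.*-homo _ _)))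
    go (negate h)     = K.trans (σ.-‿homo _) (K.trans (K.-‿cong (go h)) (K.sym (τ.-‿homo _)))
    -- Uniqueness of inverses: `σ y` and `τ y` are both inverse to the common value of `σ x` and
    -- `τ x`.
    go (invert {x} {y} xy≈1 h) = begin
      σ.apply y                              ≈⟨ K.*-identityʳ _ ⟨
      σ.apply y * 1#                         ≈⟨ K.*-congˡ (apply-inverse τ xy≈1) ⟨
      σ.apply y * (τ.apply x * τ.apply y)    ≈⟨ K.*-assoc _ _ _ ⟨
      σ.apply y * τ.apply x * τ.apply y      ≈⟨ K.*-congʳ (K.*-congˡ (go h)) ⟨
      σ.apply y * σ.apply x * τ.apply y      ≈⟨ K.*-congʳ (K.trans (K.*-comm _ _) (apply-inverse σ xy≈1)) ⟩
      1# * τ.apply y                         ≈⟨ K.*-identityˡ _ ⟩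
      τ.apply y                              ∎
      where open ≈-Reasoning K.setoid
    go (resp x≈y h)   = K.trans (σ.⟦⟧-cong (K.sym x≈y)) (K.trans (go h) (τ.⟦⟧-cong x≈y))

  Auto-^ : (σ : Auto) → ∀ x k → Auto.apply σ (x ^ k) ≈ Auto.apply σ x ^ k
  Auto-^ σ x zero    = Auto.1#-homo σ
  Auto-^ σ x (suc k) = K.trans (Auto.*-homo σ _ _) (K.*-congˡ (Auto-^ σ x k))

module _ {R : CommutativeRing a ℓa} {S : CommutativeRing b ℓb} (φ : R ⟶ʳ S) where
  private
    module R = CommutativeRing R
    module S = CommutativeRing S
    module φ = RingHomomorphism φ
    module ΣR = SemiringSum R.semiring
    module ΣS = SemiringSum S.semiring

  homo-n×1 : ∀ n → φ.⟦_⟧ (ΣR.sum {n} (λ _ → R.1#)) S.≈ ΣS.sum {n} (λ _ → S.1#)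
  homo-n×1 zero    = φ.0#-homo
  homo-n×1 (suc n) = S.trans (φ.+-homo _ _) (S.+-cong φ.1#-homo (homo-n×1 n))

module _ {c ℓ₁ ℓ₂} (E : Extension ℚ-field c ℓ₁ ℓ₂) where
  private
    module K = CommutativeRing (fieldRing (Extension.K E))
    module ι = RingHomomorphism (Extension.ι E)
    module Σℚ = SemiringSum (CommutativeRing.semiring (fieldRing ℚ-field))
    module ΣK = SemiringSum K.semiring

    mutual
      n×1≥0 : ∀ m → ℚ.0ℚ ℚ.≤ Σℚ.sum {m} (λ _ → ℚ.1ℚ)
      n×1≥0 zero    = ℚ.≤-refl
      n×1≥0 (suc m) = ℚ.<⇒≤ (n×1>0 m)

      n×1>0 : ∀ m → ℚ.0ℚ ℚ.< Σℚ.sum {suc m} (λ _ → ℚ.1ℚ)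
      n×1>0 m = ≡.subst (ℚ._< Σℚ.sum {suc m} (λ _ → ℚ.1ℚ)) (ℚ.+-identityʳ ℚ.0ℚ)
        (ℚ.+-mono-<-≤ (ℚ.positive⁻¹ ℚ.1ℚ) (n×1≥0 m))

  -- Characteristic zero: in ℚ a nonempty sum of ones is positive, hence invertible, and the
  -- embedding carries its inverse over. This supplies the `1/n` of `root-is-power`.
  n×1-invertible : ∀ m → ∃ λ y → ΣK.sum {suc m} (λ _ → K.1#) K.* y K.≈ K.1#
  n×1-invertible m = ι.⟦_⟧ (ℚ.1/ q) , K.trans (K.*-congʳ (K.sym (homo-n×1 {R = fieldRing ℚ-field} {S = fieldRing (Extension.K E)} (Extension.ι E) (suc m))))
    (K.trans (K.sym (ι.*-homo q (ℚ.1/ q))) (K.trans (ι.⟦⟧-cong (ℚ.*-inverseʳ q)) ι.1#-homo))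
    where
    q = Σℚ.sum {suc m} (λ _ → ℚ.1ℚ)
    instance
      q≢0 : ℚ.NonZero q
      q≢0 = ℚ.pos⇒nonZero q {{ℚ.positive (n×1>0 m)}}

module _ (G : Group a ℓa) {n : ℕ} (σ : Fin n → Group.Carrier G)
         (σ-injective : ∀ {i j} → Group._≈_ G (σ i) (σ j) → i ≡ j)
         (σ-surjective : ∀ g → ∃ λ i → Group._≈_ G (σ i) g) where
  open Group G

  private
    index : ∀ g → Fin n → Fin n
    index g i = proj₁ (σ-surjective (g ∙ σ i))

    σ-index : ∀ g i → σ (index g i) ≈ g ∙ σ i
    σ-index g i = proj₂ (σ-surjective (g ∙ σ i))

    index-inverse : ∀ {g h} → g ∙ h ≈ ε → ∀ i → index g (index h i) ≡ i
    index-inverse {g} {h} gh≈ε i = σ-injective (trans (σ-index g _) (trans (∙-congˡ (σ-index h i))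
      (trans (sym (assoc g h _)) (trans (∙-congʳ gh≈ε) (identityˡ _)))))

  -- Translation is by `g ⁻¹`, the convention under which `σ i` is `g` times the element at the new
  -- index.
  translation : Carrier → Permutation n n
  translation g = permutation (index (g ⁻¹)) (index g) (index-inverse (inverseˡ g)) (index-inverse (inverseʳ g))

  σ-translation : ∀ g i → σ (translation g ⟨$⟩ʳ i) ≈ g ⁻¹ ∙ σ i
  σ-translation g = σ-index (g ⁻¹)

module GaloisGroup {n : ℕ} (p-prime : Prime (suc n)) (L : Cyclotomic ℚ-field (suc n) a b c) (S : PowerAutomorphisms L) where
  open Cyclotomic L
  open Galois extension
  open PowerAutomorphisms S
  open CyclotomicGraph (suc n) L S using (Δ; σ[_]; j)
  private
    module K = CommutativeRing (fieldRing K)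
    module Δ = Group Δ
  open RootsOfUnity K using (1^n≈1)
  open Exp K.commutativeSemiring using (^-distrib-*; ^-congˡ; ^-congʳ; ^-homo-*)

  σ[]-ζ : ∀ i → Auto.apply σ[ i ] ζ ≈ ζ ^ suc (toℕ i)
  σ[]-ζ i = σ-ζ (suc (toℕ i)) (below (suc n) i)

  σ[]-injective : ∀ {i k} → σ[ i ] Δ.≈ σ[ k ] → i ≡ k
  σ[]-injective {i} {k} h = Fin.suc-injective (RootsOfUnity.powers-injective K n ζ ζⁿ≈1 ζ-primitive
    (K.trans (K.sym (σ[]-ζ i)) (K.trans (h ζ) (σ[]-ζ k))))

  -- τ ζ is again a p-th root of unity, hence a power of ζ, and an automorphism is determined by its
  -- value at ζ.
  σ[]-surjective : ∀ τ → ∃ λ i → σ[ i ] Δ.≈ τ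
  σ[]-surjective τ = match (RootsOfUnity.root-is-power K n ζ ζⁿ≈1 ζ-primitive (proj₂ (n×1-invertible extension n))
    (Auto.apply τ ζ) (K.trans (K.sym (Auto-^ L τ ζ (suc n))) (K.trans (Auto.⟦⟧-cong τ ζⁿ≈1) (Auto.1#-homo τ))))
    where
    1<p : 1 ℕ.< suc n
    1<p = ℕ.nonTrivial⇒n>1 (suc n) {{ℕ.prime⇒nonTrivial p-prime}}
    match : (∃ λ (i : Fin (suc n)) → Auto.apply τ ζ ≈ ζ ^ toℕ i) → ∃ λ i → σ[ i ] Δ.≈ τ
    match (suc i , τζ≈ζⁱ) = i , Auto-ext L σ[ i ] τ (K.trans (σ[]-ζ i) (K.sym τζ≈ζⁱ))
    -- Exponent 0 would give τ ζ = 1 = τ 1, hence ζ = 1, contradicting primitivity because 1 < p.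
    match (zero  , τζ≈1)  = contradiction (ζ-primitive (s≤s z≤n) 1<p) (#-irrefl ζ¹≈1)
      where
      ζ¹≈1 : ζ ^ 1 ≈ 1#
      ζ¹≈1 = K.trans (K.*-identityʳ ζ) (Auto.injective τ (K.trans τζ≈1 (K.sym (Auto.1#-homo τ))))

  -- Both sides send ζ to the inverse of ζⁱ⁺¹, once as ζ raised to p - (i+1) and once as the
  -- (i+1)-st power of ζᵖ⁻¹.
  σ[opposite] : ∀ i → σ[ opposite i ] Δ.≈ j p-prime Δ.∙ σ[ i ]
  σ[opposite] i = Auto-ext L σ[ opposite i ] (j p-prime Δ.∙ σ[ i ]) (begin
    Auto.apply σ[ opposite i ] ζ                 ≈⟨ σ[]-ζ (opposite i) ⟩
    ζ ^ suc (toℕ (opposite i))                   ≈⟨ K.*-identityʳ _ ⟨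
    ζ ^ suc (toℕ (opposite i)) * 1#              ≈⟨ K.*-congˡ inverse₂ ⟨
    ζ ^ suc (toℕ (opposite i)) * (ζ ^ k * (ζ ^ n) ^ k) ≈⟨ K.*-assoc _ _ _ ⟨
    ζ ^ suc (toℕ (opposite i)) * ζ ^ k * (ζ ^ n) ^ k   ≈⟨ K.*-congʳ inverse₁ ⟩
    1# * (ζ ^ n) ^ k                             ≈⟨ K.*-identityˡ _ ⟩
    (ζ ^ n) ^ k                                  ≈⟨ ^-congˡ k (σ-ζ n _) ⟨
    Auto.apply (j p-prime) ζ ^ k                 ≈⟨ Auto-^ L (j p-prime) ζ k ⟨
    Auto.apply (j p-prime) (ζ ^ k)               ≈⟨ Auto.⟦⟧-cong (j p-prime) (σ[]-ζ i) ⟨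
    Auto.apply (j p-prime) (Auto.apply σ[ i ] ζ) ∎)
    where
    open ≈-Reasoning K.setoid
    k = suc (toℕ i)
    inverse₁ : ζ ^ suc (toℕ (opposite i)) * ζ ^ k ≈ 1#
    inverse₁ = K.trans (K.sym (^-homo-* ζ (suc (toℕ (opposite i))) k)) (K.trans (^-congʳ ζ (≡.cong suc
      (≡.trans (≡.cong (ℕ._+ k) (Fin.opposite-prop i)) (ℕ.m∸n+n≡m (Fin.toℕ<n i))))) ζⁿ≈1)
    inverse₂ : ζ ^ k * (ζ ^ n) ^ k ≈ 1#
    inverse₂ = K.trans (K.sym (^-distrib-* ζ (ζ ^ n) k)) (K.trans (^-congˡ k ζⁿ≈1) (1^n≈1 k))

-- `GaloisGroup` takes p in the form `suc n`, where `p ∸ 1` computes; the case split carries its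
-- results to an arbitrary prime.
σ[]-injective : ∀ {p} → Prime p → (L : Cyclotomic ℚ-field p a b c) (S : PowerAutomorphisms L) →
                let open CyclotomicGraph p L S; open Group Δ in ∀ {i k} → σ[ i ] ≈ σ[ k ] → i ≡ k
σ[]-injective {p = zero}  p-prime L S {()}
σ[]-injective {p = suc n} p-prime L S = GaloisGroup.σ[]-injective p-prime L S

σ[]-surjective : ∀ {p} → Prime p → (L : Cyclotomic ℚ-field p a b c) (S : PowerAutomorphisms L) →
                 let open CyclotomicGraph p L S; open Group Δ in ∀ τ → ∃ λ i → σ[ i ] ≈ τ
σ[]-surjective {p = zero}  p-prime = contradiction p-prime ℕ.¬prime[0]
σ[]-surjective {p = suc n} p-prime = GaloisGroup.σ[]-surjective p-prime

σ[opposite] : ∀ {p} (p-prime : Prime p) (L : Cyclotomic ℚ-field p a b c) (S : PowerAutomorphisms L) →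
              let open CyclotomicGraph p L S; open Group Δ in ∀ i → σ[ opposite i ] ≈ j p-prime ∙ σ[ i ]
σ[opposite] {p = zero}  p-prime L S ()
σ[opposite] {p = suc n} p-prime = GaloisGroup.σ[opposite] p-prime

σ₁≈ε : ∀ {p} (p-prime : Prime p) (L : Cyclotomic ℚ-field p a b c) (S : PowerAutomorphisms L) →
       let open CyclotomicGraph p L S; open Group Δ in σ₁ p-prime ≈ ε
σ₁≈ε p-prime L S = Auto-ext L (σ₁ p-prime) (Group.ε Δ) (K.trans (σ-ζ 1 _) (K.*-identityʳ ζ))
  where
  open Cyclotomic L using (ζ; K)
  open CyclotomicGraph _ L S
  open PowerAutomorphisms S
  module K = CommutativeRing (fieldRing K)

-- Parity of p - 1 and the assembly for p, ℓ and ψ.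

even-or-odd : ∀ n → (∃ λ m → n ≡ m ℕ.* 2) ⊎ (∃ λ m → suc n ≡ m ℕ.* 2)
even-or-odd zero    = inj₁ (0 , ≡.refl)
even-or-odd (suc n) with even-or-odd n
... | inj₁ (m , n≡m*2)   = inj₂ (suc m , ≡.cong (λ k → suc (suc k)) n≡m*2)
... | inj₂ (m , 1+n≡m*2) = inj₁ (m , 1+n≡m*2)

-- Were p - 1 odd, 2 would divide p, and irreducibility would force p = 2.
even-pred : ∀ {p} → Prime p → p ≢ 2 → ∃ λ m → p ∸ 1 ≡ m ℕ.* 2
even-pred {zero}  p-prime _ = contradiction p-prime ℕ.¬prime[0]
even-pred {suc n} p-prime p≢2 with even-or-odd n
... | inj₁ even = even
... | inj₂ (m , p≡m*2) with ℕ.prime⇒irreducible p-prime (ℕ.divides m p≡m*2)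
...   | inj₂ 2≡p = contradiction (≡.sym 2≡p) p≢2

≅-trans : (R : CommutativeRing a ℓa) {M : Mod R b ℓb} {N : Mod R c ℓc} {P : Mod R d ℓd} →
          _≅_ R M N → _≅_ R N P → _≅_ R M P
≅-trans _ {P = P} (f , f-iso) (g , g-iso) = g ∘ f , ModuleComposition.isLeftModuleIsomorphism (LeftModule.≈ᴹ-trans P) f-iso g-iso

module Components
  {a₁ a₂ a₃ b₁ b₂ b₃ c₁ c₂ c₃ : Level}
  (p ℓ : ℕ) (hp : Prime p) (hℓ : Prime ℓ) (h : ¬ (ℓ ∣ p ∸ 1))
  (L : Cyclotomic ℚ-field p a₁ a₂ a₃) (S : PowerAutomorphisms L)
  (Q : FractionField (ℤ-adicRing ℓ) b₁ b₂ b₃)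
  (K : Cyclotomic (FractionField.Frac Q) (p ∸ 1) c₁ c₂ c₃)
  (V : ℓ-adicValuation Q K)
  (ψ : Setting.Character p ℓ hp hℓ h L S Q K V)
  where

  private
    module 𝒪 = CommutativeRing (Setting.𝒪 p ℓ hp hℓ h L S Q K V)
    module Σ𝒪 = SemiringSum 𝒪.semiring
    module 𝕂 = HeytingField (Cyclotomic.K K)
    module Δ = Group (CyclotomicGraph.Δ p L S)
    module χ = RingHomomorphism (Setting.ℤℓ→𝒪 p ℓ hp hℓ h L S Q K V)

    π : Δ.Carrier → Permutation (p ∸ 1) (p ∸ 1)
    π = translation (CyclotomicGraph.Δ p L S) (CyclotomicGraph.σ[_] p L S) (σ[]-injective hp L S) (σ[]-surjective hp L S)

    module B = Bouquet (Setting.𝒪 p ℓ hp hℓ h L S Q K V) (CyclotomicGraph.Δ p L S) ψ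
      (CyclotomicGraph.σ[_] p L S) π
      (σ-translation (CyclotomicGraph.Δ p L S) (CyclotomicGraph.σ[_] p L S) (σ[]-injective hp L S) (σ[]-surjective hp L S))
      (ℤ-adicRing ℓ) (ℤ→ℤ-adic ℓ) (Setting.ℤℓ→𝒪 p ℓ hp hℓ h L S Q K V)

  -- Equality in 𝒪 is equality in K: 𝕂.refl avoids the comparison of integrality proofs that 𝒪.refl would require.
  1/[p-1]*[p-1]≈1 : Setting.1/p-1 p ℓ hp hℓ h L S Q K V ψ 𝒪.* Σ𝒪.sum {p ∸ 1} (λ _ → 𝒪.1#) 𝒪.≈ 𝒪.1#
  1/[p-1]*[p-1]≈1 = 𝒪.trans
    {Setting.1/p-1 p ℓ hp hℓ h L S Q K V ψ 𝒪.* Σ𝒪.sum {p ∸ 1} (λ _ → 𝒪.1#)}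
    {χ.⟦_⟧ (proj₁ (inverse ℓ hℓ h)) 𝒪.* Σ𝒪.sum {p ∸ 1} (λ _ → 𝒪.1#)}
    {𝒪.1#}
    𝕂.refl
    (B.inverse-n {s = proj₁ (inverse ℓ hℓ h)} (digitwise (_≈ₐ_.at (proj₂ (inverse ℓ hℓ h)))))

  ψ⟨pθ⟩≈ : Setting.ψ⟨pθ⟩ p ℓ hp hℓ h L S Q K V ψ 𝒪.≈ B.stickelberger
  ψ⟨pθ⟩≈ = 𝕂.refl

  component≅𝒪/ψ⟨pθ⟩ : _≅_ (Setting.𝒪 p ℓ hp hℓ h L S Q K V) (Setting.component p ℓ hp hℓ h L S Q K V ψ)
                           (Setting.𝒪 p ℓ hp hℓ h L S Q K V /⟨ Setting.ψ⟨pθ⟩ p ℓ hp hℓ h L S Q K V ψ ⟩)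
  component≅𝒪/ψ⟨pθ⟩ = B.isotypic-component-≅ {CyclotomicGraph.X p L S} ≡.refl (CyclotomicGraph.α p L S hp)
    (σ₁≈ε hp L S) (λ i _ → Δ.refl {CyclotomicGraph.σ[_] p L S i Δ.⁻¹})
    {CyclotomicGraph.BF-Y p L S hp} ≡.refl {Setting.BF-𝒪 p ℓ hp hℓ h L S Q K V} ≡.refl
    {Setting.1/p-1 p ℓ hp hℓ h L S Q K V ψ} 1/[p-1]*[p-1]≈1 {Setting.idempotent p ℓ hp hℓ h L S Q K V ψ} ≡.refl
    {Setting.component p ℓ hp hℓ h L S Q K V ψ} ≡.refl {Setting.ψ⟨pθ⟩ p ℓ hp hℓ h L S Q K V ψ} ψ⟨pθ⟩≈

  module _ (nontrivial : Setting.Nontrivial p ℓ hp hℓ h L S Q K V ψ) where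
    -- No τ with ψ(τ) ≠ 1 is available, so the sum vanishes by tightness of the apartness relation.
    sum-u≈0 : Σ𝒪.sum B.u 𝒪.≈ 𝒪.0#
    sum-u≈0 = proj₁ (𝕂.tight _ _) (λ s#0 → nontrivial (λ τ → fixed⇒1 s#0 (B.ψ-fixes-sum τ)))
      where open RootsOfUnity (Cyclotomic.K K) using (fixed⇒1)

    module _ (p≢2 : p ≢ 2) (even : Setting.Even p ℓ hp hℓ h L S Q K V ψ) where
      ψ⟨pθ⟩≈0 : Setting.ψ⟨pθ⟩ p ℓ hp hℓ h L S Q K V ψ 𝒪.≈ 𝒪.0#
      ψ⟨pθ⟩≈0 = 𝒪.trans {Setting.ψ⟨pθ⟩ p ℓ hp hℓ h L S Q K V ψ} {B.stickelberger} {𝒪.0#} ψ⟨pθ⟩≈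
        (B.stickelberger≈0 (CyclotomicGraph.j p L S hp) (σ[opposite] hp L S) even {Setting.1/p-1 p ℓ hp hℓ h L S Q K V ψ}
          (proj₁ (even-pred hp p≢2)) (proj₂ (even-pred hp p≢2)) 1/[p-1]*[p-1]≈1 sum-u≈0)

      component≅𝒪 : _≅_ (Setting.𝒪 p ℓ hp hℓ h L S Q K V) (Setting.component p ℓ hp hℓ h L S Q K V ψ) (regular (Setting.𝒪 p ℓ hp hℓ h L S Q K V))
      component≅𝒪 = ≅-trans (Setting.𝒪 p ℓ hp hℓ h L S Q K V)
        {Setting.component p ℓ hp hℓ h L S Q K V ψ}
        {Setting.𝒪 p ℓ hp hℓ h L S Q K V /⟨ Setting.ψ⟨pθ⟩ p ℓ hp hℓ h L S Q K V ψ ⟩}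
        {regular (Setting.𝒪 p ℓ hp hℓ h L S Q K V)}
        component≅𝒪/ψ⟨pθ⟩
        (R/0≅R (Setting.𝒪 p ℓ hp hℓ h L S Q K V) {Setting.ψ⟨pθ⟩ p ℓ hp hℓ h L S Q K V ψ} ψ⟨pθ⟩≈0)

theorem5p11 : ∀ {a₁ a₂ a₃ b₁ b₂ b₃ c₁ c₂ c₃ : Level}
    (p ℓ : ℕ) (p-prime : Prime p) (p≢2 : p ≢ 2)
    (ℓ-prime : Prime ℓ) (ℓ∤p-1 : ¬ (ℓ ∣ p ∸ 1))
    (ℚ⟨ζₚ⟩ : Cyclotomic ℚ-field p a₁ a₂ a₃) (σ : PowerAutomorphisms ℚ⟨ζₚ⟩)
    (ℚℓ : FractionField (ℤ-adicRing ℓ) b₁ b₂ b₃)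
    (ℚℓ⟨μ⟩ : Cyclotomic (FractionField.Frac ℚℓ) (p ∸ 1) c₁ c₂ c₃)
    (v : ℓ-adicValuation ℚℓ ℚℓ⟨μ⟩) →
    (ψ : Setting.Character p ℓ p-prime ℓ-prime ℓ∤p-1 ℚ⟨ζₚ⟩ σ ℚℓ ℚℓ⟨μ⟩ v) →
    (_≅_ (Setting.𝒪 p ℓ p-prime ℓ-prime ℓ∤p-1 ℚ⟨ζₚ⟩ σ ℚℓ ℚℓ⟨μ⟩ v)
         (Setting.component p ℓ p-prime ℓ-prime ℓ∤p-1 ℚ⟨ζₚ⟩ σ ℚℓ ℚℓ⟨μ⟩ v ψ)
         (Setting.𝒪 p ℓ p-prime ℓ-prime ℓ∤p-1 ℚ⟨ζₚ⟩ σ ℚℓ ℚℓ⟨μ⟩ v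
           /⟨ Setting.ψ⟨pθ⟩ p ℓ p-prime ℓ-prime ℓ∤p-1 ℚ⟨ζₚ⟩ σ ℚℓ ℚℓ⟨μ⟩ v ψ ⟩))
    × (Setting.Even p ℓ p-prime ℓ-prime ℓ∤p-1 ℚ⟨ζₚ⟩ σ ℚℓ ℚℓ⟨μ⟩ v ψ →
       Setting.Nontrivial p ℓ p-prime ℓ-prime ℓ∤p-1 ℚ⟨ζₚ⟩ σ ℚℓ ℚℓ⟨μ⟩ v ψ →
       _≅_ (Setting.𝒪 p ℓ p-prime ℓ-prime ℓ∤p-1 ℚ⟨ζₚ⟩ σ ℚℓ ℚℓ⟨μ⟩ v)
           (Setting.component p ℓ p-prime ℓ-prime ℓ∤p-1 ℚ⟨ζₚ⟩ σ ℚℓ ℚℓ⟨μ⟩ v ψ)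
           (regular (Setting.𝒪 p ℓ p-prime ℓ-prime ℓ∤p-1 ℚ⟨ζₚ⟩ σ ℚℓ ℚℓ⟨μ⟩ v)))
theorem5p11 p ℓ p-prime p≢2 ℓ-prime ℓ∤p-1 ℚ⟨ζₚ⟩ σ ℚℓ ℚℓ⟨μ⟩ v ψ =
  component≅𝒪/ψ⟨pθ⟩ , λ even nontrivial → component≅𝒪 nontrivial p≢2 even
  where open Components p ℓ p-prime ℓ-prime ℓ∤p-1 ℚ⟨ζₚ⟩ σ ℚℓ ℚℓ⟨μ⟩ v ψ
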